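{- For any $k\geq 2$ and integers $m_1,\dots,m_k\geq 1$, the number of equivalent embeddings of the cubic caterpillar-Halin graph $H_{m_1,\dots,m_k}$ into surfaces of Euler-genus $2$ is $$\varepsilon_{m_1,\dots,m_k}(2)=8\sum_{i=1}^k\Big(-9+4i+(-3+4i)m_i+2m_i^2\Big)+2\sum_{i=2}^k\big(2^{m_i+3}+3\cdot 2^{m_{i-1}+3}\big)-2^{m_1+5}+32\sum_{i=2}^k\sum_{j=1}^{i-1}(m_jm_i+m_j).$$
   Context: Counting embeddings. The Euler-genus of a closed surface is $2j$ for the orientable surface with $j$ handles and $c$ for the non-orientable surface with $c$ crosscaps. A pure rotation system of a graph $G$ assigns to every vertex a cyclic permutation of its incident edges; a general rotation system is a pure rotation system together with a map $\tau:E(G)\to\{0,1\}$ (an edge $e$ is twisted if $\tau(e)=1$, untwisted otherwise); it determines a cellular embedding of $G$ in a closed surface. For a fixed spanning tree $T$ of $G$, a $T$-rotation system is a general rotation system with $\tau(e)=0$ for all $e\in E(T)$. Embeddings with equivalent $T$-rotation systems are identified, so the number $\varepsilon_G(i)$ of equivalent embeddings of $G$ into surfaces of Euler-genus $i$ is the number of $T$-rotation systems whose embedding surface has Euler-genus $i$. The graphs $H_{m_1,\dots,m_k}$. Let $k\ge 2$, $m_1,\dots,m_k\ge 1$. Put $n_1=m_1$, $n_i=m_i+1$ for $1<i<k$, $n_k=m_k$, and $\ell=n_1+\dots+n_k$. Take the path $v_0v_1\cdots v_{\ell+1}$ drawn horizontally and attach to each $v_i$ ($1\le i\le\ell$) a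 leaf $u_i$; the first $n_1$ of the leaves $u_i$ are drawn above the path, the next $n_2$ below, the next $n_3$ above, and so on alternately. Add a cycle $C$ through all leaves of this tree in their planar order: $v_0$, then the upper leaves $u_i$ in increasing order of index, then $v_{\ell+1}$, then the lower leaves $u_i$ in decreasing order of index. The resulting cubic graph is the cubic caterpillar-Halin graph $H_{m_1,\dots,m_k}$. Write $\varepsilon_{m_1,\dots,m_k}(j)=\varepsilon_{H_{m_1,\dots,m_k}}(j)$. -}

module Defs where

open import Data.Bool.Base using (Bool; true; false; not; if_then_else_; _∨_)
open import Data.Empty using (⊥)
open import Data.Fin.Base using (Fin; zero; suc; toℕ; fromℕ; inject₁)
open import Data.Fin.Properties using (+↔⊎)
open import Data.Integer.Base as ℤ using (ℤ; +_; 0ℤ)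
open import Data.List.Base
  using (List; []; _∷_; _++_; map; foldr; concatMap; replicate; length;
         lookup; allFin; filterᵇ; reverse; applyUpTo)
open import Data.List.Properties using (length-++; length-replicate)
open import Data.Nat.Base using (ℕ; zero; suc; _+_; _*_; _∸_; _≡ᵇ_; NonZero)
open import Data.Nat.DivMod using (_mod_)
open import Data.Nat.ListAction using (sum)
open import Data.Nat.GeneralisedArithmetic using (iterate)
open import Data.Product using (Σ; ∃; _×_; _,_; proj₁; proj₂)
open import Data.Sum.Base using (_⊎_; inj₁; inj₂)
open import Data.Sum.Function.Propositional using (_⊎-↔_)
open import Data.Unit.Base using (⊤)
open import Function.Base using (_∘_)
open import Function.Bundles using (Inverse; _↔_; _⇔_)
open import Function.Definitions using (Injective)
open import Function.Properties.Inverse using (↔-sym; ↔-refl; ↔-trans)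
open import Level using (_⊔_; 0ℓ)
open import Relation.Binary.Bundles using (Setoid)
open import Relation.Binary.Construct.Closure.Equivalence as EqC using ()
open import Relation.Binary.Construct.Closure.ReflexiveTransitive using (Star)
open import Relation.Binary.PropositionalEquality
  using (_≡_; _≢_; refl; sym; trans; cong₂; setoid)
open import Relation.Nullary.Negation.Core using (¬_)

-- The quotient of the setoid S has exactly n elements.
HasCardinality : ∀ {a ℓ} → Setoid a ℓ → ℕ → Set (a ⊔ ℓ)
HasCardinality S n = Inverse S (setoid (Fin n))

cyclicSuc : ∀ {n} → Fin n → Fin n
cyclicSuc {suc n} i = suc (toℕ i) mod suc n

-- The list a , a + 1 , … , b, empty when b < a.
[_⋯_] : ℕ → ℕ → List ℕ
[ a ⋯ b ] = applyUpTo (λ i → a + i) (suc b ∸ a)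

∑-range : ℕ → ℕ → (ℕ → ℤ) → ℤ
∑-range a b f = foldr ℤ._+_ 0ℤ (map f [ a ⋯ b ])

infix 10 ∑-range
syntax ∑-range a b (λ i → x) = ∑[ i from a to b ] x

-- Each edge e has the two ends  end e true  and  end e false;  loops and
-- parallel edges are allowed.
record Graph : Set₁ where
  field
    Vertex Edge : Set
    #V #E       : ℕ
    V-finite    : Vertex ↔ Fin #V
    E-finite    : Edge ↔ Fin #E
    end         : Edge → Bool → Vertex

  -- A dart (e , b) is edge e directed away from its end  end e b.
  Dart : Set
  Dart = Edge × Bool

  edge : Dart → Edge
  edge = proj₁

  origin : Dart → Vertex
  origin (e , b) = end e b

  opposite : Dart → Dart
  opposite (e , b) = e , not b

  target : Dart → Vertex
  target = origin ∘ opposite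

  -- A set of edges is represented by its indicator function.
  EdgeSet : Set
  EdgeSet = Edge → Bool

  Step : EdgeSet → Vertex → Vertex → Set
  Step T u v = ∃ λ d → T (edge d) ≡ true × origin d ≡ u × target d ≡ v

  -- Lengths one (a loop) and two (a pair of parallel edges) are included.
  record Cycle (T : EdgeSet) : Set where
    field
      predLength        : ℕ
      dart              : Fin (suc predLength) → Dart
      inT               : ∀ i → T (edge (dart i)) ≡ true
      closed            : ∀ i → target (dart i) ≡ origin (dart (cyclicSuc i))
      vertices-distinct : Injective _≡_ _≡_ (origin ∘ dart)
      edges-distinct    : Injective _≡_ _≡_ (edge ∘ dart)

  record IsSpanningTree (T : EdgeSet) : Set where
    field
      connected : ∀ u v → Star (Step T) u v
      acyclic   : ¬ Cycle T

-- Closed surfaces, up to homeomorphism.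
data ClosedSurface : Set where
  orientable    : (handles : ℕ) → ClosedSurface
  nonorientable : (crosscaps : ℕ) .{{_ : NonZero crosscaps}} → ClosedSurface

eulerGenus : ClosedSurface → ℕ
eulerGenus (orientable j)    = 2 * j
eulerGenus (nonorientable c) = c

eulerCharacteristic : ClosedSurface → ℤ
eulerCharacteristic (orientable j)    = + 2 ℤ.- + (2 * j)
eulerCharacteristic (nonorientable c) = + 2 ℤ.- + c

IsOrientable : ClosedSurface → Set
IsOrientable (orientable _)    = ⊤
IsOrientable (nonorientable _) = ⊥

module _ (G : Graph) where
  open Graph G

  -- next d  is the dart following d in the rotation at the origin of d.
  -- As there are finitely many darts, transitivity makes  next  restrict to
  -- a permutation with a single cycle on the darts at each vertex.
  record PureRotationSystem : Set where
    field
      next        : Dart → Dart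
      next-origin : ∀ d → origin (next d) ≡ origin d
      transitive  : ∀ d d′ → origin d ≡ origin d′ → ∃ λ n → iterate next d n ≡ d′

  -- τ e ≡ true  means that e is twisted.
  record RotationSystem : Set where
    field
      pure : PureRotationSystem
      τ    : Edge → Bool
    open PureRotationSystem pure public

  record TRotationSystem (T : EdgeSet) : Set where
    field
      system     : RotationSystem
      untwistedT : ∀ e → T e ≡ true → RotationSystem.τ system e ≡ false
    open RotationSystem system public

module _ {G : Graph} where
  open Graph G

  module _ (ρ : RotationSystem G) where
    open RotationSystem ρ

    -- Flags are the triangles of the barycentric subdivision of the embedded
    -- graph.  The flag (d , true) lies at the origin of d on the side of d
    -- facing  next d,  and (d , false) on the other side.  Each flag shares
    -- its three sides with the flags it is related to by changeVertex,
    -- changeEdge and changeFace.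
    Flag : Set
    Flag = Dart × Bool

    -- The side facing the next dart at one end of an untwisted edge is
    -- the side facing the previous dart at the other end.
    data ChangeVertex : Flag → Flag → Set where
      untwisted : ∀ {d} s → τ (edge d) ≡ false →
                  ChangeVertex (d , s) (opposite d , not s)
      twisted   : ∀ {d} s → τ (edge d) ≡ true →
                  ChangeVertex (d , s) (opposite d , s)

    data ChangeEdge : Flag → Flag → Set where
      corner : ∀ d → ChangeEdge (d , true) (next d , false)

    data ChangeFace : Flag → Flag → Set where
      across : ∀ d → ChangeFace (d , true) (d , false)

    -- Faces are the classes of flags under this setoid equality.  (An
    -- isolated vertex carries no flag; a connected graph with an edge has
    -- no isolated vertex.)
    FaceSetoid : Setoid 0ℓ 0ℓ
    FaceSetoid = EqC.setoid (λ x y → ChangeVertex x y ⊎ ChangeEdge x y)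

    -- The triangles can be coherently oriented: adjacent triangles always
    -- receive opposite signs.
    OrientableEmbedding : Set
    OrientableEmbedding =
      ∃ λ (sign : Flag → Bool) → ∀ {x y} →
        ChangeVertex x y ⊎ ChangeEdge x y ⊎ ChangeFace x y → sign x ≢ sign y

    -- By the classification of closed surfaces, the embedding surface of ρ
    -- is the closed surface with the same Euler characteristic and the same
    -- orientability character.
    record EmbedsIn (S : ClosedSurface) : Set where
      field
        #F            : ℕ
        faces         : HasCardinality FaceSetoid #F
        euler         : eulerCharacteristic S ≡ + #V ℤ.- + #E ℤ.+ + #F
        orientability : IsOrientable S ⇔ OrientableEmbedding

    HasEulerGenus : ℕ → Set
    HasEulerGenus i = ∃ λ S → EmbedsIn S × eulerGenus S ≡ i

  infix 4 _≈ᵣ_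

  record _≈ᵣ_ (ρ σ : RotationSystem G) : Set where
    private
      module ρ = RotationSystem ρ
      module σ = RotationSystem σ
    field
      next-≗ : ∀ d → ρ.next d ≡ σ.next d
      τ-≗    : ∀ e → ρ.τ e ≡ σ.τ e

-- The T-rotation systems of G whose embedding surface has Euler-genus i.
TEmbeddings : (G : Graph) → Graph.EdgeSet G → ℕ → Setoid 0ℓ 0ℓ
TEmbeddings G T i = record
  { Carrier       = Σ (TRotationSystem G T) λ ρ → HasEulerGenus (system ρ) i
  ; _≈_           = λ ρ σ → system (proj₁ ρ) ≈ᵣ system (proj₁ σ)
  ; isEquivalence = record
      { refl  = record { next-≗ = λ _ → refl ; τ-≗ = λ _ → refl }
      ; sym   = λ p → record
          { next-≗ = λ d → sym (next-≗ p d) ; τ-≗ = λ e → sym (τ-≗ p e) }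
      ; trans = λ p q → record
          { next-≗ = λ d → trans (next-≗ p d) (next-≗ q d)
          ; τ-≗    = λ e → trans (τ-≗ p e) (τ-≗ q e) }
      }
  }
  where
  open TRotationSystem using (system)
  open _≈ᵣ_

-- ε_G(i) = n, computed with respect to the spanning tree T.
ε[_,_]_≐_ : (G : Graph) → Graph.EdgeSet G → ℕ → ℕ → Set
ε[ G , T ] i ≐ n = HasCardinality (TEmbeddings G T i) n

-- m 1 , … , m k  are the parameters; other values of m are not used.
module CaterpillarHalin (k : ℕ) (m : ℕ → ℕ) where

  blockSize : ℕ → ℕ
  blockSize i = if (i ≡ᵇ 1) ∨ (i ≡ᵇ k) then m i else suc (m i)

  -- Odd-numbered blocks of leaves are drawn above the path.
  isUpperBlock : ℕ → Bool
  isUpperBlock zero    = false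
  isUpperBlock (suc i) = not (isUpperBlock i)

  -- The entry of index i (from 0) tells whether the leaf u_{i+1} is drawn
  -- above the path.
  isUpper : List Bool
  isUpper = concatMap (λ i → replicate (blockSize i) (isUpperBlock i)) [ 1 ⋯ k ]

  ℓ : ℕ
  ℓ = length isUpper

  ℓ-sum : ℓ ≡ sum (map blockSize [ 1 ⋯ k ])
  ℓ-sum = go [ 1 ⋯ k ]
    where
    go : ∀ is → length (concatMap (λ i → replicate (blockSize i) (isUpperBlock i)) is)
              ≡ sum (map blockSize is)
    go []       = refl
    go (i ∷ is) = trans (length-++ (replicate (blockSize i) (isUpperBlock i)))
                        (cong₂ _+_ (length-replicate (blockSize i)) (go is))

  HVertex : Set
  HVertex = Fin (2 + ℓ) ⊎ Fin ℓ

  -- spine i  is v_i, for 0 ≤ i ≤ ℓ + 1;  leaf i  is u_{i+1}, for 0 ≤ i < ℓ.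
  pattern spine i = inj₁ i
  pattern leaf i  = inj₂ i

  upperLeaves lowerLeaves : List (Fin ℓ)
  upperLeaves = filterᵇ (lookup isUpper) (allFin ℓ)
  lowerLeaves = filterᵇ (not ∘ lookup isUpper) (allFin ℓ)

  -- The vertices of the cycle C in cyclic order.
  rim : List HVertex
  rim = spine zero ∷ map leaf upperLeaves
     ++ spine (fromℕ (suc ℓ)) ∷ map leaf (reverse lowerLeaves)

  HEdge : Set
  HEdge = Fin (suc ℓ) ⊎ Fin ℓ ⊎ Fin (length rim)

  pattern pathEdge i = inj₁ i
  pattern leafEdge i = inj₂ (inj₁ i)
  pattern rimEdge i  = inj₂ (inj₂ i)

  endpoints : HEdge → HVertex × HVertex
  endpoints (pathEdge i) = spine (inject₁ i) , spine (suc i)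
  endpoints (leafEdge i) = spine (inject₁ (suc i)) , leaf i
  endpoints (rimEdge i)  = lookup rim i , lookup rim (cyclicSuc i)

  H : Graph
  H = record
    { Vertex   = HVertex
    ; Edge     = HEdge
    ; #V       = (2 + ℓ) + ℓ
    ; #E       = suc ℓ + (ℓ + length rim)
    ; V-finite = ↔-sym +↔⊎
    ; E-finite = ↔-trans (↔-refl ⊎-↔ ↔-sym +↔⊎) (↔-sym +↔⊎)
    ; end      = λ e b → if b then proj₁ (endpoints e) else proj₂ (endpoints e)
    }

open CaterpillarHalin public using (H)

{-# OPTIONS --safe #-}

-- In a cubic graph a rotation at a vertex is one of two opposite ones.
-- Measuring rotations and twistings against a fixed reference rotation, a
-- T-rotation system amounts to the direction of the rotation at one vertex and
-- an arbitrary set of relatively twisted edges:  the tree T being untwisted,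
-- its twistings determine all other directions.  The faces depend on the
-- relatively twisted edges only.
--
-- They are counted by sweeping H along its path.  Three edges always lead from
-- the processed part of the graph to the rest, so that the partial faces pair
-- up six corners in one of 15 ways.  Each edge glues two pairs of corners, and
-- each gluing either merges two partial faces or closes one;  as there are as
-- many gluings as corners, the faces are the gluings of the second sort.  Hence
-- the face numbers are computed by an automaton with 15 states, which fall into
-- five kinds.  At most one face closes per leaf, so that a surface of
-- Euler-genus 2 leaves room for at most two leaves at which none does, and the
-- number of accepted words obeys a recursion along the path that is solved
-- explicitly:  the powers of two come from the runs of leaves on one side.
module Submission where

-- The spanning tree is arbitrary and given only by connectedness and the absence of cycles, so it
-- cannot be adapted to the sweep. Passing to relative twists decouples the two: the tree enters
-- only in showing that every relative twisting, together with a direction at `v_0`, comes from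
-- exactly one T-rotation system, and the sweep then runs over all functions from edges to bits. The
-- free direction at `v_0` is the factor 2 in front of the number of words. Euler-genus 2 comprises
-- the torus and the Klein bottle. Both have characteristic 0, so belonging to the count is a
-- condition on the number of faces alone: it must be ℓ + 1, two less than the ℓ + 3 faces on the
-- sphere. Orientability only decides which of the two surfaces is named. Faces are classes of a
-- global relation, whereas the automaton sees six corners. The bridge is a quotient built one
-- gluing at a time, in which the pattern of identifications among the listed corners suffices to
-- tell how the total number of classes changes. The same device keeps track of the components of a
-- growing forest when the tree equations are solved.

-- Finite quotients built one gluing at a time

module PartialQuotients where

  open import Data.Fin.Base using (Fin; zero; suc; punchOut; punchIn)
  open import Data.Fin.Properties as Fin
      using (punchOut-injective; punchOut-cong; punchInᵢ≢i; punchOut-punchIn)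
  open import Data.List.Base using (List; []; _∷_; length)
  open import Data.List.Relation.Unary.All using (All; []; _∷_)
  open import Data.Nat.Base using (ℕ; zero; suc; _+_)
  open import Data.Nat.Properties as ℕ using (+-suc)
  open import Data.Product using (_×_; _,_)
  open import Data.Sum.Base using (_⊎_; inj₁; inj₂)
  open import Data.Vec.Base as Vec using (Vec; []; _∷_)
  open import Data.Vec.Properties using (lookup-map)
  open import Function.Base using (_∘_; id)
  open import Function.Bundles using (_⇔_; mk⇔; Equivalence)
  open import Relation.Binary.Construct.Closure.Equivalence as EqC using (EqClosure)
  open import Relation.Binary.PropositionalEquality
  open import Relation.Nullary.Decidable.Core using (Dec; yes; no)
  open import Relation.Nullary.Negation.Core using (contradiction)

  open Equivalence using (to; from)

  Joined : ∀ {A : Set} → A → A → A → A → Set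
  Joined i j k k′ = k ≡ k′ ⊎ (k ≡ i × k′ ≡ j) ⊎ (k ≡ j × k′ ≡ i)

  -- An equivalence rather than an implication: whether a later gluing merges two classes must be
  -- decidable from any other map with the same kernel.
  Joins : ∀ {A B : Set} → (A → B) → A → A → Set
  Joins f i j = ∀ k k′ → f k ≡ f k′ ⇔ Joined i j k k′

  Joined-map : ∀ {A B : Set} {i j k k′ : A} {i₁ j₁ k₁ k₁′ : B} →
               (k ≡ k′ → k₁ ≡ k₁′) → (k ≡ i → k₁ ≡ i₁) → (k ≡ j → k₁ ≡ j₁) →
               (k′ ≡ i → k₁′ ≡ i₁) → (k′ ≡ j → k₁′ ≡ j₁) →
               Joined i j k k′ → Joined i₁ j₁ k₁ k₁′
  Joined-map f g h g′ h′ (inj₁ p)              = inj₁ (f p)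
  Joined-map f g h g′ h′ (inj₂ (inj₁ (p , q))) = inj₂ (inj₁ (g p , h′ q))
  Joined-map f g h g′ h′ (inj₂ (inj₂ (p , q))) = inj₂ (inj₂ (h p , g′ q))

  id-joins : ∀ {A : Set} {i j : A} → i ≡ j → Joins id i j
  id-joins refl k k′ = mk⇔ inj₁ λ where
    (inj₁ p)              → p
    (inj₂ (inj₁ (p , q))) → trans p (sym q)
    (inj₂ (inj₂ (p , q))) → trans p (sym q)

  -- Labels are not renumbered after a merge, unlike the classes in `collapse`; only their kernel is
  -- ever compared.
  relabel : ℕ → ℕ → ℕ → ℕ
  relabel i j k with k ℕ.≟ i
  ... | yes _ = j
  ... | no  _ = k

  relabel-joins : ∀ i j → Joins (relabel i j) i j
  relabel-joins i j k k′ with k ℕ.≟ i | k′ ℕ.≟ i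
  ... | yes p | yes q = mk⇔ (λ _ → inj₁ (trans p (sym q))) (λ _ → refl)
  ... | yes p | no ¬q = mk⇔ (λ r → inj₂ (inj₁ (p , sym r))) λ where
    (inj₁ r)              → contradiction (trans (sym r) p) ¬q
    (inj₂ (inj₁ (_ , r))) → sym r
    (inj₂ (inj₂ (_ , r))) → contradiction r ¬q
  ... | no ¬p | yes q = mk⇔ (λ r → inj₂ (inj₂ (r , q))) λ where
    (inj₁ r)              → contradiction (trans r q) ¬p
    (inj₂ (inj₁ (r , _))) → contradiction r ¬p
    (inj₂ (inj₂ (r , _))) → r
  ... | no ¬p | no ¬q = mk⇔ inj₁ λ where
    (inj₁ r)              → r
    (inj₂ (inj₁ (r , _))) → contradiction r ¬p
    (inj₂ (inj₂ (_ , r))) → contradiction r ¬q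

  collapse : ∀ {n} {i j : Fin (suc n)} → i ≢ j → Fin (suc n) → Fin n
  collapse {i = i} i≢j k with i Fin.≟ k
  ... | yes _   = punchOut i≢j
  ... | no  i≢k = punchOut i≢k

  collapse-joins : ∀ {n} {i j : Fin (suc n)} (i≢j : i ≢ j) → Joins (collapse i≢j) i j
  collapse-joins {i = i} i≢j k k′ with i Fin.≟ k | i Fin.≟ k′
  ... | yes p | yes q = mk⇔ (λ _ → inj₁ (trans (sym p) q)) (λ _ → refl)
  ... | yes p | no ¬q =
    mk⇔ (λ r → inj₂ (inj₁ (sym p , sym (punchOut-injective i≢j ¬q r)))) λ where
      (inj₁ r)              → contradiction (trans p r) ¬q
      (inj₂ (inj₁ (_ , r))) → punchOut-cong i (sym r)
      (inj₂ (inj₂ (_ , r))) → contradiction (sym r) ¬q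
  ... | no ¬p | yes q =
    mk⇔ (λ r → inj₂ (inj₂ (punchOut-injective ¬p i≢j r , sym q))) λ where
      (inj₁ r)              → contradiction (trans q (sym r)) ¬p
      (inj₂ (inj₁ (r , _))) → contradiction (sym r) ¬p
      (inj₂ (inj₂ (r , _))) → punchOut-cong i r
  ... | no ¬p | no ¬q = mk⇔ (inj₁ ∘ punchOut-injective ¬p ¬q) λ where
      (inj₁ r)              → punchOut-cong i r
      (inj₂ (inj₁ (r , _))) → contradiction (sym r) ¬p
      (inj₂ (inj₂ (_ , r))) → contradiction (sym r) ¬q

  collapse-punchIn : ∀ {n} {i j : Fin (suc n)} (i≢j : i ≢ j) k → collapse i≢j (punchIn i k) ≡ k
  collapse-punchIn {i = i} i≢j k with i Fin.≟ punchIn i k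
  ... | yes p = contradiction (sym p) (punchInᵢ≢i i k)
  ... | no _  = trans (punchOut-cong i refl) (punchOut-punchIn i)

  indicator : ∀ {P : Set} → Dec P → ℕ
  indicator (yes _) = 1
  indicator (no  _) = 0

  opaque
    mergeLabels : ∀ {k} → List (Fin k × Fin k) → Vec ℕ k → Vec ℕ k
    mergeLabels []             L = L
    mergeLabels ((a , b) ∷ gs) L =
      mergeLabels gs (Vec.map (relabel (Vec.lookup L a) (Vec.lookup L b)) L)

    -- The cycle rank of the multigraph whose vertices are the labels and whose edges are the
    -- gluings.
    redundancy : ∀ {k} → List (Fin k × Fin k) → Vec ℕ k → ℕ
    redundancy []             L = 0
    redundancy ((a , b) ∷ gs) L =
      indicator (Vec.lookup L a ℕ.≟ Vec.lookup L b)
        + redundancy gs (Vec.map (relabel (Vec.lookup L a) (Vec.lookup L b)) L)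

  module _ {X : Set} (R : X → X → Set) where

    -- A stage in the computation of the quotient of X by the equivalence
    -- relation generated by R:  only related elements have been identified so
    -- far, but not necessarily all of them.
    record Partial (n : ℕ) : Set where
      field
        class     : X → Fin n
        rep       : Fin n → X
        class-rep : ∀ i → class (rep i) ≡ i
        sound     : ∀ {x y} → class x ≡ class y → EqClosure R x y

    open Partial

    Fresh : ∀ {n} → Partial n → X → Set
    Fresh Q x = ∀ y → class Q x ≡ class Q y → x ≡ y

    infix 4 _⊑_
    _⊑_ : ∀ {n n′} → Partial n → Partial n′ → Set
    Q ⊑ Q′ = ∀ {x y} → class Q x ≡ class Q y → class Q′ x ≡ class Q′ y

    -- The names of the labels are immaterial, so a set partition, which is what a state of the
    -- automaton is, can serve as labelling of whichever corners are on the boundary.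
    Pattern : ∀ {n k} → Partial n → Vec X k → Vec ℕ k → Set
    Pattern Q xs L = ∀ a b →
      class Q (Vec.lookup xs a) ≡ class Q (Vec.lookup xs b) ⇔ Vec.lookup L a ≡ Vec.lookup L b

    record Merged {n} (Q : Partial n) (x y : X) : Set where
      field
        {size}    : ℕ
        quotient  : Partial size
        joins     : ∀ z z′ → class quotient z ≡ class quotient z′ ⇔
                             Joined (class Q x) (class Q y) (class Q z) (class Q z′)
        size-≡    : class Q x ≡ class Q y → size ≡ n
        size-≢    : class Q x ≢ class Q y → suc size ≡ n

    merge : ∀ {n} (Q : Partial n) x y → R x y → Merged Q x y
    merge {zero}  Q x y r with () ← class Q x
    merge {suc n} Q x y r with class Q x Fin.≟ class Q y
    ... | yes p = record
      { quotient = Q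
      ; joins    = λ z z′ → id-joins p (class Q z) (class Q z′)
      ; size-≡   = λ _ → refl
      ; size-≢   = contradiction p
      }
    ... | no ¬p = record
      { quotient = record
        { class     = collapse ¬p ∘ class Q
        ; rep       = rep Q ∘ punchIn (class Q x)
        ; class-rep = λ i → trans (cong (collapse ¬p) (class-rep Q _)) (collapse-punchIn ¬p i)
        ; sound     = λ {z} {z′} q → sound′ (to (collapse-joins ¬p _ _) q)
        }
      ; joins  = λ z z′ → collapse-joins ¬p (class Q z) (class Q z′)
      ; size-≡ = λ p → contradiction p ¬p
      ; size-≢ = λ _ → refl
      }
      where
      sound′ : ∀ {z z′} → Joined (class Q x) (class Q y) (class Q z) (class Q z′) → EqClosure R z z′
      sound′ (inj₁ q)              = sound Q q
      sound′ (inj₂ (inj₁ (q , q′))) = EqC.transitive R (sound Q q)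
        (EqC.transitive R (EqC.return r) (EqC.symmetric R (sound Q q′)))
      sound′ (inj₂ (inj₂ (q , q′))) = EqC.transitive R (sound Q q)
        (EqC.transitive R (EqC.symmetric R (EqC.return r)) (EqC.symmetric R (sound Q q′)))

    record MergedAll {n k} (Q : Partial n) (xs : Vec X k) (gs : List (Fin k × Fin k))
                     (L : Vec ℕ k) : Set where
      field
        {size}   : ℕ
        quotient : Partial size
        labelling : Pattern quotient xs (mergeLabels gs L)
        count    : size + length gs ≡ n + redundancy gs L
        coarser  : Q ⊑ quotient
        merged   : All (λ (a , b) → class quotient (Vec.lookup xs a) ≡ class quotient (Vec.lookup xs b)) gs
        fresh    : ∀ {z} → (∀ a → Vec.lookup xs a ≢ z) → Fresh Q z → Fresh quotient z

    opaque
      unfolding mergeLabels redundancy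

      -- `Pattern` lets the labels decide whether a gluing merges two classes or falls within one,
      -- so the change in the total number of classes is computed on the `k` listed elements. A
      -- merge lowers that number by one and a redundant gluing preserves it; the field `count` says
      -- so additively, free of truncated subtraction.
      mergeAll : ∀ {n k} (Q : Partial n) (xs : Vec X k) gs L → Pattern Q xs L →
                 All (λ (a , b) → R (Vec.lookup xs a) (Vec.lookup xs b)) gs → MergedAll Q xs gs L
      mergeAll Q xs [] L pat [] = record
        { quotient = Q
        ; labelling = pat
        ; count    = refl
        ; coarser  = id
        ; merged   = []
        ; fresh    = λ _ → id
        }
      mergeAll {n} {k} Q xs ((a , b) ∷ gs) L pat (r ∷ rs) = record
        { quotient = M.quotient
        ; labelling = M.labelling
        ; count    = count
        ; coarser  = M.coarser ∘ coarser₁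
        ; merged   = M.coarser (from (M₁.joins _ _) (inj₂ (inj₁ (refl , refl)))) ∷ M.merged
        ; fresh    = λ ∉xs → M.fresh ∉xs ∘ fresh₁ ∉xs
        }
        where
        i j : ℕ
        i = Vec.lookup L a
        j = Vec.lookup L b
        L₁ : Vec ℕ k
        L₁ = Vec.map (relabel i j) L

        M₁ : Merged Q (Vec.lookup xs a) (Vec.lookup xs b)
        M₁ = merge Q _ _ r
        module M₁ = Merged M₁

        coarser₁ : Q ⊑ M₁.quotient
        coarser₁ p = from (M₁.joins _ _) (inj₁ p)

        fresh₁ : ∀ {z} → (∀ a → Vec.lookup xs a ≢ z) → Fresh Q z → Fresh M₁.quotient z
        fresh₁ ∉xs f y p with to (M₁.joins _ _) p
        ... | inj₁ q              = f y q
        ... | inj₂ (inj₁ (q , _)) = contradiction (sym (f _ q)) (∉xs a)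
        ... | inj₂ (inj₂ (q , _)) = contradiction (sym (f _ q)) (∉xs b)

        pattern₁ : Pattern M₁.quotient xs L₁
        pattern₁ c d rewrite lookup-map c (relabel i j) L | lookup-map d (relabel i j) L = mk⇔
          (from (relabel-joins i j _ _)
            ∘ Joined-map (to (pat c d)) (to (pat c a)) (to (pat c b)) (to (pat d a)) (to (pat d b))
            ∘ to (M₁.joins _ _))
          (from (M₁.joins _ _)
            ∘ Joined-map (from (pat c d)) (from (pat c a)) (from (pat c b)) (from (pat d a)) (from (pat d b))
            ∘ to (relabel-joins i j _ _))

        module M = MergedAll (mergeAll M₁.quotient xs gs L₁ pattern₁ rs)

        count : M.size + suc (length gs) ≡ n + redundancy ((a , b) ∷ gs) L
        count with i ℕ.≟ j
        ... | yes p = begin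
          M.size + suc (length gs)       ≡⟨ +-suc M.size _ ⟩
          suc (M.size + length gs)       ≡⟨ cong suc M.count ⟩
          suc (M₁.size + redundancy gs L₁)    ≡⟨ cong (λ m → suc (m + redundancy gs L₁)) (M₁.size-≡ (from (pat a b) p)) ⟩
          suc (n + redundancy gs L₁)          ≡⟨ +-suc n _ ⟨
          n + suc (redundancy gs L₁)          ∎
          where open ≡-Reasoning
        ... | no ¬p = begin
          M.size + suc (length gs)       ≡⟨ +-suc M.size _ ⟩
          suc (M.size + length gs)       ≡⟨ cong suc M.count ⟩
          suc M₁.size + redundancy gs L₁      ≡⟨ cong (_+ redundancy gs L₁) (M₁.size-≢ (¬p ∘ to (pat a b))) ⟩
          n + redundancy gs L₁                ∎
          where open ≡-Reasoning

    -- An element that no gluing has reached is alone in its class, so any label not in use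
    -- describes it. This is how a new vertex enters the sweep.
    Pattern-∷ : ∀ {n k} {Q : Partial n} {xs : Vec X k} {L : Vec ℕ k} {z l} →
                Fresh Q z → (∀ a → Vec.lookup xs a ≢ z) → (∀ a → Vec.lookup L a ≢ l) →
                Pattern Q xs L → Pattern Q (z ∷ xs) (l ∷ L)
    Pattern-∷ f ∉xs ∉L pat zero    zero    = mk⇔ (λ _ → refl) (λ _ → refl)
    Pattern-∷ f ∉xs ∉L pat zero    (suc b) =
      mk⇔ (λ p → contradiction (sym (f _ p)) (∉xs b)) (λ p → contradiction (sym p) (∉L b))
    Pattern-∷ f ∉xs ∉L pat (suc a) zero    =
      mk⇔ (λ p → contradiction (sym (f _ (sym p))) (∉xs a)) (λ p → contradiction p (∉L a))
    Pattern-∷ f ∉xs ∉L pat (suc a) (suc b) = pat a b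

    Pattern-map : ∀ {n k l} {Q : Partial n} {xs : Vec X k} {L : Vec ℕ k} (is : Vec (Fin k) l) →
                  Pattern Q xs L → Pattern Q (Vec.map (Vec.lookup xs) is) (Vec.map (Vec.lookup L) is)
    Pattern-map {xs = xs} {L} is pat a b
      rewrite lookup-map a (Vec.lookup xs) is | lookup-map b (Vec.lookup xs) is
            | lookup-map a (Vec.lookup L) is | lookup-map b (Vec.lookup L) is = pat _ _

-- The automaton of boundary pairings

module FaceAutomaton where

  open import Data.Bool.Base using (Bool; true; false; if_then_else_)
  open import Data.Fin using (Fin; zero; suc; #_)
  open import Data.Fin.Properties using (all?)
  open import Data.List.Base using (List; []; _∷_; _++_)
  open import Data.Nat.Base using (ℕ; zero; suc; _<_)
  open import Data.Nat.Properties as ℕ using ()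
  open import Data.Product using (_×_; _,_)
  open import Data.Vec.Base as Vec using (Vec; []; _∷_; lookup)
  open import Function.Base using (_∘_)
  open import Relation.Binary.PropositionalEquality
  open import Relation.Nullary.Decidable using (Dec; yes; no; toWitness; map′; _×-dec_; _→-dec_)
  open PartialQuotients

  State Letter : Set
  State  = Fin 15
  Letter = Bool × Bool × Bool

  -- Each vector is a partition of the six corners beside the three edges that
  -- leave the processed part of the graph, in the order  (path , true) ,
  -- (path , false) , (upper rim , true) , … ;  two corners have the same label
  -- when they lie on the same partial face.  These are all the partitions into
  -- three pairs.
  partitions : Vec (Vec ℕ 6) 15
  partitions =
    (0 ∷ 1 ∷ 2 ∷ 0 ∷ 1 ∷ 2 ∷ []) ∷
    (0 ∷ 0 ∷ 1 ∷ 2 ∷ 2 ∷ 1 ∷ []) ∷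
    (0 ∷ 1 ∷ 0 ∷ 2 ∷ 2 ∷ 1 ∷ []) ∷
    (0 ∷ 1 ∷ 2 ∷ 1 ∷ 0 ∷ 2 ∷ []) ∷
    (0 ∷ 1 ∷ 2 ∷ 2 ∷ 0 ∷ 1 ∷ []) ∷
    (0 ∷ 1 ∷ 0 ∷ 1 ∷ 2 ∷ 2 ∷ []) ∷
    (0 ∷ 1 ∷ 2 ∷ 2 ∷ 1 ∷ 0 ∷ []) ∷
    (0 ∷ 1 ∷ 1 ∷ 0 ∷ 2 ∷ 2 ∷ []) ∷
    (0 ∷ 1 ∷ 1 ∷ 2 ∷ 2 ∷ 0 ∷ []) ∷
    (0 ∷ 1 ∷ 0 ∷ 2 ∷ 1 ∷ 2 ∷ []) ∷
    (0 ∷ 1 ∷ 1 ∷ 2 ∷ 0 ∷ 2 ∷ []) ∷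
    (0 ∷ 1 ∷ 2 ∷ 0 ∷ 2 ∷ 1 ∷ []) ∷
    (0 ∷ 1 ∷ 2 ∷ 1 ∷ 2 ∷ 0 ∷ []) ∷
    (0 ∷ 0 ∷ 1 ∷ 2 ∷ 1 ∷ 2 ∷ []) ∷
    (0 ∷ 0 ∷ 1 ∷ 1 ∷ 2 ∷ 2 ∷ []) ∷ []

  corners : State → Vec ℕ 6
  corners = lookup partitions

  SamePartition : ∀ {k} → Vec ℕ k → Vec ℕ k → Set
  SamePartition L L′ = ∀ a b → (lookup L a ≡ lookup L b → lookup L′ a ≡ lookup L′ b)
                             × (lookup L′ a ≡ lookup L′ b → lookup L a ≡ lookup L b)

  samePartition? : ∀ {k} (L L′ : Vec ℕ k) → Dec (SamePartition L L′)
  samePartition? L L′ = all? λ a → all? λ b →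
    ((lookup L a ℕ.≟ lookup L b) →-dec (lookup L′ a ℕ.≟ lookup L′ b))
    ×-dec ((lookup L′ a ℕ.≟ lookup L′ b) →-dec (lookup L a ℕ.≟ lookup L b))

  -- An edge joins the corners p , p′ beside its dart  (e , true)  to the
  -- corners q , q′ beside  (e , false).
  glue : ∀ {A : Set} → A → A → A → A → Bool → List (A × A)
  glue p p′ q q′ twisted =
    (p , (if twisted then q else q′)) ∷ (p′ , (if twisted then q′ else q)) ∷ []

  -- The first six positions are the corners of a path vertex and of its leaf,
  -- the last six those of the old boundary.
  stepGlue : Bool → Letter → List (Fin 12 × Fin 12)
  stepGlue upper (x , y , z) =
    glue (# 6) (# 7) (# 0) (# 2) x ++ glue (# 2) (# 1) (# 3) (# 5) y ++
    (if upper then glue (# 8) (# 9) (# 5) (# 4) z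
              else glue (# 4) (# 3) (# 10) (# 11) z)

  -- The new path edge starts at the new path vertex. The new leaf takes over the pending rim edge
  -- on its own side, and the pending edge on the other side stays at its old vertex.
  stepBoundary : Bool → Vec (Fin 12) 6
  stepBoundary true  = # 1 ∷ # 0 ∷ # 4 ∷ # 3 ∷ # 10 ∷ # 11 ∷ []
  stepBoundary false = # 1 ∷ # 0 ∷ # 8 ∷ # 9 ∷ # 5 ∷ # 4 ∷ []

  -- The first three positions are the corners of the last path vertex.
  lastGlue : Letter → List (Fin 9 × Fin 9)
  lastGlue (x , y , z) =
    glue (# 3) (# 4) (# 0) (# 2) x ++ glue (# 5) (# 6) (# 2) (# 1) y ++
    glue (# 1) (# 0) (# 7) (# 8) z

  -- State labels lie below 6, so 6 to 11 are new. The path vertex has the larger ones because its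
  -- corners are added after those of the leaf.
  stepLabels : State → Vec ℕ 12
  stepLabels s = 9 ∷ 10 ∷ 11 ∷ 6 ∷ 7 ∷ 8 ∷ corners s

  lastLabels : State → Vec ℕ 9
  lastLabels s = 6 ∷ 7 ∷ 8 ∷ corners s

  stepCorners : Bool → State → Letter → Vec ℕ 6
  stepCorners b s l =
    Vec.map (lookup (mergeLabels (stepGlue b l) (stepLabels s))) (stepBoundary b)

  find : ∀ {n} → Vec ℕ 6 → (Fin (suc n) → Vec ℕ 6) → Fin (suc n)
  -- The last candidate is returned untested; `corners-δ` confirms every answer afterwards.
  find {zero}  L f = zero
  find {suc n} L f with samePartition? L (f zero)
  ... | yes _ = zero
  ... | no  _ = suc (find L (f ∘ suc))

  opaque
    δ : Bool → State → Letter → State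
    δ b s l = find (stepCorners b s l) corners

  closed : Bool → State → Letter → ℕ
  closed b s l = redundancy (stepGlue b l) (stepLabels s)

  lastClosed : State → Letter → ℕ
  lastClosed s l = redundancy (lastGlue l) (lastLabels s)

  bool? : ∀ {P : Bool → Set} → (∀ b → Dec (P b)) → Dec (∀ b → P b)
  bool? p? = map′ (λ { (t , f) true → t ; (t , f) false → f }) (λ p → p true , p false)
                  (p? true ×-dec p? false)

  letter? : ∀ {P : Letter → Set} → (∀ l → Dec (P l)) → Dec (∀ l → P l)
  letter? p? = map′ (λ { p (x , y , z) → p x y z }) (λ { p x y z → p (x , y , z) })
                    (bool? λ x → bool? λ y → bool? λ z → p? (x , y , z))

  opaque
    unfolding δ mergeLabels

    -- Decided on all 2 · 15 · 8 transitions. In particular the fifteen pairings are closed under a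
    -- step.
    corners-δ : ∀ b s l → SamePartition (stepCorners b s l) (corners (δ b s l))
    corners-δ = toWitness {a? = bool? λ b → all? λ s → letter? λ l →
      samePartition? (stepCorners b s l) (corners (δ b s l))} _

    corners-bound : ∀ s a → lookup (corners s) a < 6
    corners-bound = toWitness {a? = all? λ s → all? λ a → lookup (corners s) a ℕ.<? 6} _

-- Counting words by the number of faces they close

module WordCounts where

  open import Data.Bool.Base using (Bool; true; false; if_then_else_)
  open import Data.Fin using (Fin; zero; suc; #_; toℕ)
  open import Data.Fin.Properties as Fin using (all?; +↔⊎)
  open import Data.List.Base using (List; []; _∷_; length; map; foldr)
  open import Data.List.Properties using (≡-dec)
  open import Data.Nat.Base using (ℕ; zero; suc; _+_; _*_; _≤_; s≤s; _≤ᵇ_)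
  open import Data.Nat.ListAction using (sum)
  open import Data.Nat.Properties as ℕ using (≡-irrelevant; suc-injective; ≤-refl; m≤n⇒m≤1+n)
  open import Data.Nat.Tactic.RingSolver using (solve-∀)
  open import Data.Product using (Σ; _×_; _,_; proj₁; proj₂)
  import Data.Product.Properties as Product
  open import Data.Sum.Base using (_⊎_; inj₁; inj₂)
  open import Data.Sum.Function.Propositional using (_⊎-↔_)
  open import Data.Vec.Base using ([]; _∷_; lookup)
  open import Function.Bundles using (_↔_; mk↔ₛ′)
  open import Function.Properties.Inverse using (↔-sym; ↔-trans)
  open import Relation.Binary.PropositionalEquality
  open import Relation.Nullary.Decidable using (Dec; yes; no; isYes; toWitness)
  open import Relation.Nullary.Negation.Core using (contradiction)
  open PartialQuotients
  open FaceAutomaton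

  -- The bits of a leaf belong to the path edge arriving at its neighbour, to the leaf edge and to
  -- the rim edge completed with it. The last letter belongs to the three edges at `v_{ℓ+1}`, so
  -- that each of the 3(ℓ + 1) edges has one bit.
  Word : List Bool → Set
  Word []       = Letter
  Word (_ ∷ bs) = Letter × Word bs

  faceCount : State → (bs : List Bool) → Word bs → ℕ
  faceCount s []       l       = lastClosed s l
  faceCount s (b ∷ bs) (l , w) = closed b s l + faceCount (δ b s l) bs w

  letters : List Letter
  letters = (true  , true , true) ∷ (true  , true , false) ∷ (true  , false , true) ∷ (true  , false , false)
          ∷ (false , true , true) ∷ (false , true , false) ∷ (false , false , true) ∷ (false , false , false) ∷ []

  ∑ₗ : (Letter → ℕ) → ℕ
  ∑ₗ f = sum (map f letters)

  -- Multiplication of a generating function, given by its coefficients, by the power of the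
  -- variable with exponent `c`.
  shift : ℕ → (ℕ → ℕ) → ℕ → ℕ
  shift zero    f t       = f t
  shift (suc c) f zero    = 0
  shift (suc c) f (suc t) = shift c f t

  wordsWith : State → List Bool → ℕ → ℕ
  wordsWith s []       t = ∑ₗ λ l → indicator (lastClosed s l ℕ.≟ t)
  wordsWith s (b ∷ bs) t = ∑ₗ λ l → shift (closed b s l) (wordsWith (δ b s l) bs) t

  Σ-Bool : ∀ {P : Bool → Set} → Σ Bool P ↔ (P true ⊎ P false)
  Σ-Bool = mk↔ₛ′ (λ { (true , p) → inj₁ p ; (false , p) → inj₂ p })
                 (λ { (inj₁ p) → true , p ; (inj₂ p) → false , p })
                 (λ { (inj₁ p) → refl ; (inj₂ p) → refl })
                 (λ { (true , p) → refl ; (false , p) → refl })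

  Σ-assoc : ∀ {A : Set} {B : A → Set} {P : Σ A B → Set} → Σ (Σ A B) P ↔ Σ A λ a → Σ (B a) λ b → P (a , b)
  Σ-assoc = mk↔ₛ′ (λ { ((a , b) , p) → a , b , p }) (λ { (a , b , p) → (a , b) , p })
                  (λ _ → refl) (λ _ → refl)

  Σ-Bool-Fin : ∀ {P : Bool → Set} {f : Bool → ℕ} → (∀ b → P b ↔ Fin (f b)) → Σ Bool P ↔ Fin (f true + f false)
  Σ-Bool-Fin e = ↔-trans Σ-Bool (↔-trans (e true ⊎-↔ e false) (↔-sym +↔⊎))

  Σ-Letter-Fin : ∀ {P : Letter → Set} {f : Letter → ℕ} → (∀ l → P l ↔ Fin (f l)) → Σ Letter P ↔ Fin (∑ₗ f)
  Σ-Letter-Fin {P} {f} e = subst (λ n → Σ Letter P ↔ Fin n)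
    (reassociate (f _) (f _) (f _) (f _) (f _) (f _) (f _) (f _))
    (↔-trans Σ-assoc (Σ-Bool-Fin λ x → ↔-trans Σ-assoc (Σ-Bool-Fin λ y → Σ-Bool-Fin λ z → e (x , y , z))))
    where
    reassociate : ∀ a b c d e f g h →
      ((a + b) + (c + d)) + ((e + f) + (g + h)) ≡ a + (b + (c + (d + (e + (f + (g + (h + 0)))))))
    reassociate = solve-∀

  ≡-Fin : ∀ m n → (m ≡ n) ↔ Fin (indicator (m ℕ.≟ n))
  ≡-Fin m n with m ℕ.≟ n
  ... | yes p = mk↔ₛ′ (λ _ → zero) (λ _ → p) (λ { zero → refl }) (λ q → ≡-irrelevant p q)
  ... | no ¬p = mk↔ₛ′ (λ p → contradiction p ¬p) (λ ()) (λ ()) (λ p → contradiction p ¬p)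

  shift-Fin : ∀ {W : Set} {f : W → ℕ} {g : ℕ → ℕ} → (∀ t → (Σ W λ w → f w ≡ t) ↔ Fin (g t)) →
              ∀ c t → (Σ W λ w → c + f w ≡ t) ↔ Fin (shift c g t)
  shift-Fin e zero    t       = e t
  shift-Fin e (suc c) zero    = mk↔ₛ′ (λ ()) (λ ()) (λ ()) (λ ())
  shift-Fin e (suc c) (suc t) = ↔-trans
    (mk↔ₛ′ (λ { (w , p) → w , suc-injective p }) (λ { (w , p) → w , cong suc p })
           (λ { (w , p) → cong (w ,_) (≡-irrelevant _ p) })
           (λ { (w , p) → cong (w ,_) (≡-irrelevant _ p) }))
    (shift-Fin e c t)

  words↔Fin : ∀ s bs t → (Σ (Word bs) λ w → faceCount s bs w ≡ t) ↔ Fin (wordsWith s bs t)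
  words↔Fin s []       t = Σ-Letter-Fin λ l → ≡-Fin (lastClosed s l) t
  words↔Fin s (b ∷ bs) t = ↔-trans Σ-assoc
    (Σ-Letter-Fin λ l → shift-Fin (words↔Fin (δ b s l) bs) (closed b s l) t)

  Kind : Set
  Kind = Fin 5

  pattern noFace  = zero
  pattern pathFace  = suc zero
  pattern upperFace = suc (suc zero)
  pattern lowerFace = suc (suc (suc zero))
  pattern everyFace = suc (suc (suc (suc zero)))

  -- The number of words with a given face count turns out to depend only on
  -- which of the three outgoing edges have the same partial face on both sides.
  kind : State → Kind
  kind s = classify (same (# 0) (# 1)) (same (# 2) (# 3)) (same (# 4) (# 5))
    where
    same : Fin 6 → Fin 6 → Bool
    same a b = isYes (lookup (corners s) a ℕ.≟ lookup (corners s) b)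
    classify : Bool → Bool → Bool → Kind
    -- The six corners are perfectly matched: two edges with matched sides leave the sides of the
    -- third only each other.
    classify true  true  _     = everyFace
    classify true  false _     = pathFace
    classify false true  _     = upperFace
    classify false false true  = lowerFace
    classify false false false = noFace

  Outcome : Set
  Outcome = Kind × ℕ

  -- There are five kinds, so the key `toℕ κ + 5 * c` determines the outcome `(κ , c)`. Sorting by
  -- it yields a normal form, and multisets of outcomes can be compared as lists.
  insert : Outcome → List Outcome → List Outcome
  insert o []       = o ∷ []
  insert o (p ∷ ps) = if (toℕ (proj₁ o) + 5 * proj₂ o) ≤ᵇ (toℕ (proj₁ p) + 5 * proj₂ p)
                      then o ∷ p ∷ ps else p ∷ insert o ps

  sort : List Outcome → List Outcome
  sort = foldr insert []

  sum-insert : ∀ (h : Outcome → ℕ) o os → sum (map h (insert o os)) ≡ h o + sum (map h os)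
  sum-insert h o []       = refl
  sum-insert h o (p ∷ ps) with (toℕ (proj₁ o) + 5 * proj₂ o) ≤ᵇ (toℕ (proj₁ p) + 5 * proj₂ p)
  ... | true  = refl
  ... | false = trans (cong (h p +_) (sum-insert h o ps)) (swap (h p) (h o) _)
    where
    swap : ∀ a b c → a + (b + c) ≡ b + (a + c)
    swap = solve-∀

  sum-sort : ∀ (h : Outcome → ℕ) os → sum (map h (sort os)) ≡ sum (map h os)
  sum-sort h []       = refl
  sum-sort h (o ∷ os) = trans (sum-insert h o (sort os)) (cong (h o +_) (sum-sort h os))

  outcomes : Bool → State → List Outcome
  outcomes b s = map (λ l → kind (δ b s l) , closed b s l) letters

  -- No state follows the last vertex; `noFace` is a placeholder here.
  lastOutcomes : State → List Outcome
  lastOutcomes s = map (λ l → noFace , lastClosed s l) letters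

  2× 4× 8× : Outcome → List Outcome → List Outcome
  2× o os = o ∷ o ∷ os
  4× o os = 2× o (2× o os)
  8× o os = 4× o (4× o os)

  -- Only entries with second component 1 keep up with the maximum of one face per leaf: one letter
  -- from `noFace`, and two from `upperFace` or `lowerFace` as long as the leaf is attached on the
  -- opposite side.
  kindOutcomes : Bool → Kind → List Outcome
  kindOutcomes b noFace      = 4× (noFace , 0) ((pathFace , 0) ∷ (upperFace , 0) ∷ (lowerFace , 0) ∷ (noFace , 1) ∷ [])
  kindOutcomes b pathFace      = 8× (noFace , 0) []
  kindOutcomes true  upperFace = 8× (noFace , 0) []
  kindOutcomes true  lowerFace = 4× (lowerFace , 0) (2× (everyFace , 0) (2× (lowerFace , 1) []))
  kindOutcomes true  everyFace = 8× (lowerFace , 0) []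
  kindOutcomes false upperFace = 4× (upperFace , 0) (2× (everyFace , 0) (2× (upperFace , 1) []))
  kindOutcomes false lowerFace = 8× (noFace , 0) []
  kindOutcomes false everyFace = 8× (upperFace , 0) []

  kindLastOutcomes : Kind → List Outcome
  kindLastOutcomes noFace  = 4× (noFace , 1) ((noFace , 2) ∷ (noFace , 2) ∷ (noFace , 2) ∷ (noFace , 3) ∷ [])
  kindLastOutcomes everyFace = 8× (noFace , 1) []
  kindLastOutcomes _     = 4× (noFace , 1) (4× (noFace , 2) [])

  outcomes? : (os os′ : List Outcome) → Dec (os ≡ os′)
  outcomes? = ≡-dec (Product.≡-dec Fin._≟_ ℕ._≟_)

  opaque
    unfolding δ mergeLabels redundancy

    -- Lumpability in the sense of Markov chains: the multiset of outcomes over the eight letters is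
    -- constant on each kind, so the fifteen states may be replaced by five. Decided state by state.
    sort-outcomes : ∀ b s → sort (outcomes b s) ≡ kindOutcomes b (kind s)
    sort-outcomes = toWitness {a? = bool? λ b → all? λ s →
      outcomes? (sort (outcomes b s)) (kindOutcomes b (kind s))} _

    sort-lastOutcomes : ∀ s → sort (lastOutcomes s) ≡ kindLastOutcomes (kind s)
    sort-lastOutcomes = toWitness {a? = all? λ s →
      outcomes? (sort (lastOutcomes s)) (kindLastOutcomes (kind s))} _

  kindWords : Kind → List Bool → ℕ → ℕ
  kindWords κ []       t = sum (map (λ o → indicator (proj₂ o ℕ.≟ t)) (kindLastOutcomes κ))
  kindWords κ (b ∷ bs) t = sum (map (λ o → shift (proj₂ o) (kindWords (proj₁ o) bs) t) (kindOutcomes b κ))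

  shift-cong : ∀ c {f g} → (∀ t → f t ≡ g t) → ∀ t → shift c f t ≡ shift c g t
  shift-cong zero    f≗g t       = f≗g t
  shift-cong (suc c) f≗g zero    = refl
  shift-cong (suc c) f≗g (suc t) = shift-cong c f≗g t

  wordsWith-kind : ∀ s bs t → wordsWith s bs t ≡ kindWords (kind s) bs t
  wordsWith-kind s [] t = trans (sym (sum-sort (λ o → indicator (proj₂ o ℕ.≟ t)) (lastOutcomes s)))
    (cong (λ os → sum (map (λ o → indicator (proj₂ o ℕ.≟ t)) os)) (sort-lastOutcomes s))
  wordsWith-kind s (b ∷ bs) t = begin
    ∑ₗ (λ l → shift (closed b s l) (wordsWith (δ b s l) bs) t)  ≡⟨ ∑ₗ-cong (λ l → shift-cong (closed b s l) (wordsWith-kind (δ b s l) bs) t) letters ⟩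
    sum (map h (outcomes b s))                                   ≡⟨ sum-sort h (outcomes b s) ⟨
    sum (map h (sort (outcomes b s)))                            ≡⟨ cong (λ os → sum (map h os)) (sort-outcomes b s) ⟩
    kindWords (kind s) (b ∷ bs) t                                ∎
    where
    open ≡-Reasoning
    h : Outcome → ℕ
    h o = shift (proj₂ o) (kindWords (proj₁ o) bs) t
    ∑ₗ-cong : ∀ {f g : Letter → ℕ} → (∀ l → f l ≡ g l) → ∀ ls → sum (map f ls) ≡ sum (map g ls)
    ∑ₗ-cong f≗g []       = refl
    ∑ₗ-cong f≗g (l ∷ ls) = cong₂ _+_ (f≗g l) (∑ₗ-cong f≗g ls)

  -- `run true` belongs to `lowerFace` and `run false` to `upperFace`. While leaves are attached on
  -- side `b`, two letters keep the kind and close a face. The first leaf on the other side admits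
  -- all eight letters, each leading to `noFace`, from where a single word is maximal. At the end,
  -- four last letters close two faces.
  run : Bool → List Bool → ℕ
  run b     []           = 4
  run true  (true ∷ bs)  = 2 * run true bs
  run false (false ∷ bs) = 2 * run false bs
  run true  (false ∷ bs) = 8
  run false (true ∷ bs)  = 8

  pathRun : List Bool → ℕ
  pathRun []      = 4
  pathRun (_ ∷ _) = 8

  -- The indices 0, 1, 2 are deficits from the maximum `3 + length bs`: one face per leaf and three
  -- at the last vertex. The value 1 reflects that the planar embedding is unique up to reflection.
  words₀ words₁ : Kind → List Bool → ℕ
  words₀ noFace bs = 1
  words₀ _    bs = 0
  words₁ noFace  bs = 3 + 4 * length bs
  words₁ pathFace  bs = pathRun bs
  words₁ upperFace bs = run false bs
  words₁ lowerFace bs = run true bs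
  words₁ everyFace bs = 0

  -- Deficit two is followed from `noFace` only, the kind of the initial state. Of the eight first
  -- letters, the one that closes a face leaves the deficit at two, and the other seven use up one
  -- unit of it.
  words₂ : List Bool → ℕ
  words₂ []       = 4
  words₂ (b ∷ bs) = words₂ bs + 4 * (3 + 4 * length bs) + pathRun bs + run false bs + run true bs

  kindWords-above : ∀ κ bs t → 4 + length bs ≤ t → kindWords κ bs t ≡ 0
  kindWords-above noFace  [] _ (s≤s (s≤s (s≤s (s≤s _)))) = refl
  kindWords-above pathFace  [] _ (s≤s (s≤s (s≤s (s≤s _)))) = refl
  kindWords-above upperFace [] _ (s≤s (s≤s (s≤s (s≤s _)))) = refl
  kindWords-above lowerFace [] _ (s≤s (s≤s (s≤s (s≤s _)))) = refl
  kindWords-above everyFace [] _ (s≤s (s≤s (s≤s (s≤s _)))) = refl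
  kindWords-above noFace (b ∷ bs) (suc t) (s≤s p)
    rewrite kindWords-above noFace bs (suc t) (m≤n⇒m≤1+n p) | kindWords-above pathFace bs (suc t) (m≤n⇒m≤1+n p)
          | kindWords-above upperFace bs (suc t) (m≤n⇒m≤1+n p) | kindWords-above lowerFace bs (suc t) (m≤n⇒m≤1+n p)
          | kindWords-above noFace bs t p = refl
  kindWords-above pathFace (b ∷ bs) (suc t) (s≤s p)
    rewrite kindWords-above noFace bs (suc t) (m≤n⇒m≤1+n p) = refl
  kindWords-above upperFace (true ∷ bs) (suc t) (s≤s p)
    rewrite kindWords-above noFace bs (suc t) (m≤n⇒m≤1+n p) = refl
  kindWords-above upperFace (false ∷ bs) (suc t) (s≤s p)
    rewrite kindWords-above upperFace bs (suc t) (m≤n⇒m≤1+n p) | kindWords-above everyFace bs (suc t) (m≤n⇒m≤1+n p)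
          | kindWords-above upperFace bs t p = refl
  kindWords-above lowerFace (true ∷ bs) (suc t) (s≤s p)
    rewrite kindWords-above lowerFace bs (suc t) (m≤n⇒m≤1+n p) | kindWords-above everyFace bs (suc t) (m≤n⇒m≤1+n p)
          | kindWords-above lowerFace bs t p = refl
  kindWords-above lowerFace (false ∷ bs) (suc t) (s≤s p)
    rewrite kindWords-above noFace bs (suc t) (m≤n⇒m≤1+n p) = refl
  kindWords-above everyFace (true ∷ bs) (suc t) (s≤s p)
    rewrite kindWords-above lowerFace bs (suc t) (m≤n⇒m≤1+n p) = refl
  kindWords-above everyFace (false ∷ bs) (suc t) (s≤s p)
    rewrite kindWords-above upperFace bs (suc t) (m≤n⇒m≤1+n p) = refl

  kindWords₀ : ∀ κ bs → kindWords κ bs (3 + length bs) ≡ words₀ κ bs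
  kindWords₀ noFace  [] = refl
  kindWords₀ pathFace  [] = refl
  kindWords₀ upperFace [] = refl
  kindWords₀ lowerFace [] = refl
  kindWords₀ everyFace [] = refl
  kindWords₀ noFace  (b ∷ bs)
    rewrite kindWords-above noFace bs (4 + length bs) ≤-refl | kindWords-above pathFace bs (4 + length bs) ≤-refl | kindWords-above upperFace bs (4 + length bs) ≤-refl
          | kindWords-above lowerFace bs (4 + length bs) ≤-refl | kindWords₀ noFace bs = refl
  kindWords₀ pathFace  (b ∷ bs)     rewrite kindWords-above noFace bs (4 + length bs) ≤-refl = refl
  kindWords₀ upperFace (true ∷ bs)  rewrite kindWords-above noFace bs (4 + length bs) ≤-refl = refl
  kindWords₀ upperFace (false ∷ bs)
    rewrite kindWords-above upperFace bs (4 + length bs) ≤-refl | kindWords-above everyFace bs (4 + length bs) ≤-refl | kindWords₀ upperFace bs = refl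
  kindWords₀ lowerFace (true ∷ bs)
    rewrite kindWords-above lowerFace bs (4 + length bs) ≤-refl | kindWords-above everyFace bs (4 + length bs) ≤-refl | kindWords₀ lowerFace bs = refl
  kindWords₀ lowerFace (false ∷ bs) rewrite kindWords-above noFace bs (4 + length bs) ≤-refl = refl
  kindWords₀ everyFace (true ∷ bs)  rewrite kindWords-above lowerFace bs (4 + length bs) ≤-refl = refl
  kindWords₀ everyFace (false ∷ bs) rewrite kindWords-above upperFace bs (4 + length bs) ≤-refl = refl

  kindWords₁ : ∀ κ bs → kindWords κ bs (2 + length bs) ≡ words₁ κ bs
  kindWords₁ noFace  [] = refl
  kindWords₁ pathFace  [] = refl
  kindWords₁ upperFace [] = refl
  kindWords₁ lowerFace [] = refl
  kindWords₁ everyFace [] = refl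
  kindWords₁ noFace (b ∷ bs)
    rewrite kindWords₀ noFace bs | kindWords₀ pathFace bs | kindWords₀ upperFace bs
          | kindWords₀ lowerFace bs | kindWords₁ noFace bs = eq (length bs)
    where
    eq : ∀ n → 7 + (4 * n + 0) ≡ 3 + 4 * suc n
    eq = solve-∀
  kindWords₁ pathFace  (b ∷ bs)     rewrite kindWords₀ noFace bs = refl
  kindWords₁ upperFace (true ∷ bs)  rewrite kindWords₀ noFace bs = refl
  kindWords₁ upperFace (false ∷ bs)
    rewrite kindWords₀ upperFace bs | kindWords₀ everyFace bs | kindWords₁ upperFace bs = refl
  kindWords₁ lowerFace (true ∷ bs)
    rewrite kindWords₀ lowerFace bs | kindWords₀ everyFace bs | kindWords₁ lowerFace bs = refl
  kindWords₁ lowerFace (false ∷ bs) rewrite kindWords₀ noFace bs = refl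
  kindWords₁ everyFace (true ∷ bs)  rewrite kindWords₀ lowerFace bs = refl
  kindWords₁ everyFace (false ∷ bs) rewrite kindWords₀ upperFace bs = refl

  kindWords₂ : ∀ bs → kindWords noFace bs (1 + length bs) ≡ words₂ bs
  kindWords₂ []       = refl
  kindWords₂ (b ∷ bs)
    rewrite kindWords₁ noFace bs | kindWords₁ pathFace bs | kindWords₁ upperFace bs
          | kindWords₁ lowerFace bs | kindWords₂ bs =
    eq (3 + 4 * length bs) (pathRun bs) (run false bs) (run true bs) (words₂ bs)
    where
    eq : ∀ a b c d e → a + (a + (a + (a + (b + (c + (d + (e + 0))))))) ≡ e + 4 * a + b + c + d
    eq = solve-∀

-- Evaluation of the recursion along the blocks of leaves

module BlockSums where

  open import Defs
  open import Data.Bool.Base using (Bool; true; false; not)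
  open import Data.Bool.Properties using (not-involutive)
  import Data.Integer.Tactic.RingSolver as ℤRing
  open import Data.List.Base
      using (List; []; _∷_; _++_; length; map; replicate; concatMap; applyUpTo)
  open import Data.List.Properties using (length-replicate; length-++)
  open import Data.Nat.Base using (ℕ; zero; suc; _+_; _*_; _^_; _∸_; _≤_; _<_; z≤n; s≤s; _≡ᵇ_)
  open import Data.Nat.ListAction using (sum)
  open import Data.Nat.Properties as ℕ using (+-suc; +-identityʳ; +-comm; +-assoc)
  open import Data.Nat.Tactic.RingSolver using (solve-∀)
  open import Data.Product using (_×_; _,_; proj₁; proj₂; ∃)
  open import Function.Base using (_∘_)
  open import Relation.Binary.PropositionalEquality
  open WordCounts

  runSum : List Bool → ℕ
  runSum []       = 0
  runSum (_ ∷ bs) = runSum bs + (run true bs + run false bs)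

  -- The terms 4(3 + 4j) for j < n add up to 8n² + 4n. The `pathRun` terms give 8 for each nonempty
  -- proper suffix and 4 for the empty one, which with `words₂ [] = 4` makes 8n.
  words₂-runSum : ∀ b bs → let n = suc (length bs) in words₂ (b ∷ bs) ≡ 8 * (n * n) + 12 * n + runSum (b ∷ bs)
  words₂-runSum b []        = refl
  words₂-runSum b (b′ ∷ bs) rewrite words₂-runSum b′ bs =
    eq (length bs) (runSum (b′ ∷ bs)) (run true (b′ ∷ bs)) (run false (b′ ∷ bs))
    where
    eq : ∀ n r x y →
      (8 * (suc n * suc n) + 12 * suc n + r) + 4 * (3 + 4 * suc n) + 8 + y + x
        ≡ 8 * (suc (suc n) * suc (suc n)) + 12 * suc (suc n) + (r + (x + y))
    eq = solve-∀

  run-replicate : ∀ b n bs → run b (replicate n b ++ bs) ≡ 2 ^ n * run b bs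
  run-replicate b     zero    bs = sym (+-identityʳ _)
  run-replicate true  (suc n) bs rewrite run-replicate true n bs = sym (ℕ.*-assoc 2 (2 ^ n) _)
  run-replicate false (suc n) bs rewrite run-replicate false n bs = sym (ℕ.*-assoc 2 (2 ^ n) _)

  run-not : ∀ b bs → run (not b) (b ∷ bs) ≡ 8
  run-not true  bs = refl
  run-not false bs = refl

  runSum-∷ : ∀ b c bs → runSum (c ∷ bs) ≡ runSum bs + (run b bs + run (not b) bs)
  runSum-∷ true  c bs = refl
  runSum-∷ false c bs = cong (_+_ (runSum bs)) (+-comm (run true bs) _)

  -- Over the suffixes with 0 to n leading copies of `b`, the runs of `b` form a geometric series
  -- with sum `run b bs` times 2^(n+1) - 1, whose negative term stands on the left. The runs of
  -- `not b` are 8 on each suffix that starts with a copy.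
  runSum-replicate : ∀ b n bs → runSum (replicate (suc n) b ++ bs) + run b bs
                              ≡ runSum bs + run (not b) bs + 8 * n + run b bs * 2 ^ suc n
  runSum-replicate b zero    bs rewrite runSum-∷ b b bs = eq (runSum bs) (run b bs) (run (not b) bs)
    where
    eq : ∀ s r r′ → s + (r + r′) + r ≡ s + r′ + 8 * 0 + r * 2
    eq = solve-∀
  runSum-replicate b (suc n) bs
    rewrite runSum-∷ b b (replicate (suc n) b ++ bs) | run-not b (replicate n b ++ bs)
          | run-replicate b (suc n) bs = begin
    s + (2 ^ suc n * r + 8) + r                            ≡⟨ eq₁ s (2 ^ suc n) r ⟩
    (s + r) + (2 ^ suc n * r + 8)                          ≡⟨ cong (_+ (2 ^ suc n * r + 8)) (runSum-replicate b n bs) ⟩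
    runSum bs + r′ + 8 * n + r * 2 ^ suc n + (2 ^ suc n * r + 8) ≡⟨ eq₂ (runSum bs) r′ n r (2 ^ suc n) ⟩
    runSum bs + r′ + 8 * suc n + r * (2 * 2 ^ suc n)       ∎
    where
    open ≡-Reasoning
    s = runSum (replicate (suc n) b ++ bs)
    r = run b bs
    r′ = run (not b) bs
    eq₁ : ∀ s p r → s + (p * r + 8) + r ≡ (s + r) + (p * r + 8)
    eq₁ = solve-∀
    eq₂ : ∀ s r′ n r p → s + r′ + 8 * n + r * p + (p * r + 8) ≡ s + r′ + 8 * suc n + r * (2 * p)
    eq₂ = solve-∀

  -- Nothing follows the block, so the runs beyond it are 4 instead of 8, which halves the
  -- coefficient 16 of the power found for inner blocks.
  lastBlock : ∀ b n → 1 ≤ n → let bs = replicate n b ++ [] in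
              run (not b) bs ≡ 8 × runSum bs + run b bs + 8 ≡ 8 * n + 8 * 2 ^ n
  lastBlock b (suc n) _ = run-not b (replicate n b ++ []) , (begin
    s + r + 8                                  ≡⟨ cong (λ x → s + x + 8) (run-replicate b (suc n) []) ⟩
    s + p * run b [] + 8                       ≡⟨ cong (λ x → s + p * x + 8) (run-[] b) ⟩
    s + p * 4 + 8                              ≡⟨ eq₁ s p ⟩
    s + 4 + (p * 4 + 4)                        ≡⟨ cong (λ x → s + x + (p * 4 + 4)) (run-[] b) ⟨
    s + run b [] + (p * 4 + 4)                 ≡⟨ cong (_+ (p * 4 + 4)) (runSum-replicate b n []) ⟩
    run (not b) [] + 8 * n + run b [] * p + (p * 4 + 4)
                                               ≡⟨ cong₂ (λ x y → x + 8 * n + y * p + (p * 4 + 4)) (run-[] (not b)) (run-[] b) ⟩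
    4 + 8 * n + 4 * p + (p * 4 + 4)            ≡⟨ eq₂ n p ⟩
    8 * suc n + 8 * p                          ∎)
    where
    open ≡-Reasoning
    s = runSum (replicate (suc n) b ++ [])
    r = run b (replicate (suc n) b ++ [])
    p = 2 ^ suc n
    run-[] : ∀ b → run b [] ≡ 4
    run-[] true  = refl
    run-[] false = refl
    eq₁ : ∀ s p → s + p * 4 + 8 ≡ s + 4 + (p * 4 + 4)
    eq₁ = solve-∀
    eq₂ : ∀ n p → 4 + 8 * n + 4 * p + (p * 4 + 4) ≡ 8 * suc n + 8 * p
    eq₂ = solve-∀

  -- A following block on the other side supplies the hypothesis, and the first conclusion supplies
  -- it in turn to the preceding block. The last sum includes a run because the preceding block will
  -- ask for it.
  innerBlock : ∀ b n bs → run b bs ≡ 8 → let bs′ = replicate (suc n) b ++ bs in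
               run (not b) bs′ ≡ 8 ×
               runSum bs′ + 8 ≡ runSum bs + run (not b) bs + 8 * n + 8 * 2 ^ suc n ×
               runSum bs′ + run b bs′ + 8 ≡ runSum bs + run (not b) bs + 8 * n + 16 * 2 ^ suc n
  innerBlock b n bs r≡8 = run-not b (replicate n b ++ bs) , sum₁ , (begin
    s + run b (replicate (suc n) b ++ bs) + 8  ≡⟨ cong (λ x → s + x + 8) (run-replicate b (suc n) bs) ⟩
    s + p * run b bs + 8                       ≡⟨ cong (λ x → s + p * x + 8) r≡8 ⟩
    s + p * 8 + 8                              ≡⟨ eq₁ s p ⟩
    (s + 8) + p * 8                            ≡⟨ cong (_+ p * 8) sum₁ ⟩
    w + 8 * n + 8 * p + p * 8                  ≡⟨ eq₂ w n p ⟩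
    w + 8 * n + 16 * p                         ∎)
    where
    open ≡-Reasoning
    s = runSum (replicate (suc n) b ++ bs)
    w = runSum bs + run (not b) bs
    p = 2 ^ suc n
    sum₁ : s + 8 ≡ w + 8 * n + 8 * p
    sum₁ = begin
      s + 8                       ≡⟨ cong (s +_) r≡8 ⟨
      s + run b bs                ≡⟨ runSum-replicate b n bs ⟩
      w + 8 * n + run b bs * p    ≡⟨ cong (λ x → w + 8 * n + x * p) r≡8 ⟩
      w + 8 * n + 8 * p           ∎
    eq₁ : ∀ s p → s + p * 8 + 8 ≡ (s + 8) + p * 8
    eq₁ = solve-∀
    eq₂ : ∀ w n p → w + 8 * n + 8 * p + p * 8 ≡ w + 8 * n + 16 * p
    eq₂ = solve-∀

  range : ℕ → ℕ → List ℕ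
  range a zero    = []
  range a (suc n) = a ∷ range (suc a) n

  applyUpTo-range : ∀ a n (f : ℕ → ℕ) → (∀ i → f i ≡ a + i) → applyUpTo f n ≡ range a n
  applyUpTo-range a zero    f f≗ = refl
  applyUpTo-range a (suc n) f f≗ = cong₂ _∷_ (trans (f≗ 0) (+-identityʳ a))
    (applyUpTo-range (suc a) n (f ∘ suc) (λ i → trans (f≗ (suc i)) (+-suc a i)))

  interval-range : ∀ a b → [ a ⋯ b ] ≡ range a (suc b ∸ a)
  interval-range a b = applyUpTo-range a (suc b ∸ a) (λ i → a + i) (λ _ → refl)

  sumOver : (ℕ → ℕ) → List ℕ → ℕ
  sumOver f is = sum (map f is)

  range-∷ʳ : ∀ a n → range a (suc n) ≡ range a n ++ a + n ∷ []
  range-∷ʳ a zero    = cong (_∷ []) (sym (+-identityʳ a))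
  range-∷ʳ a (suc n) = cong (a ∷_) (trans (range-∷ʳ (suc a) n)
    (cong (λ c → range (suc a) n ++ c ∷ []) (sym (+-suc a n))))

  module Blocks (k : ℕ) (m : ℕ → ℕ) where
    open CaterpillarHalin k m using (blockSize; isUpperBlock; isUpper)

    block : ℕ → List Bool
    block i = replicate (blockSize i) (isUpperBlock i)

    <⇒≢ᵇ : ∀ {i j} → i < j → (i ≡ᵇ j) ≡ false
    <⇒≢ᵇ {zero}  (s≤s _) = refl
    <⇒≢ᵇ {suc i} (s≤s p) = <⇒≢ᵇ p

    ≡ᵇ-refl : ∀ i → (i ≡ᵇ i) ≡ true
    ≡ᵇ-refl zero    = refl
    ≡ᵇ-refl (suc i) = ≡ᵇ-refl i

    blockSize-inner : ∀ {i} → 2 ≤ i → i < k → blockSize i ≡ suc (m i)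
    blockSize-inner {suc (suc i)} (s≤s (s≤s _)) i<k rewrite <⇒≢ᵇ i<k = refl

    blockSize-last : ∀ {i} → 2 ≤ i → i ≡ k → blockSize i ≡ m i
    blockSize-last {suc (suc i)} (s≤s (s≤s _)) refl rewrite ≡ᵇ-refl i = refl

    -- The block before block `i` lies on the other side, so by `runSum-replicate` it needs `runSum`
    -- and the run of block `i` together. The summand 8 per block compensates for the negative
    -- terms, which keeps the invariant within ℕ.
    TailSums : ℕ → ℕ → Set
    TailSums i q = let bs = concatMap block (range i (suc q)) in
      run (not (isUpperBlock i)) bs ≡ 8 ×
      runSum bs + run (isUpperBlock i) bs + 8 * suc q
        ≡ 8 * sumOver m (range i (suc q)) + 32 * sumOver (λ j → 2 ^ m j) (range i q) + 8 * 2 ^ m k ×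
      length bs ≡ sumOver m (range i (suc q)) + q

    tailSums : ∀ i q → 2 ≤ i → i + q ≡ k → (∀ j → i ≤ j → j ≤ k → 1 ≤ m j) → TailSums i q
    tailSums i zero 2≤i i+q≡k pos
      with refl ← trans (sym (+-identityʳ i)) i+q≡k
      with e ← blockSize i | refl ← blockSize-last 2≤i refl =
        proj₁ block-sums
      , trans (proj₂ block-sums) (eq (m i) (2 ^ m i))
      , trans (length-++ (replicate (m i) _)) (cong (_+ 0) (trans (length-replicate (m i)) (sym (+-identityʳ _))))
      where
      block-sums = lastBlock (isUpperBlock i) (m i) (pos i ℕ.≤-refl ℕ.≤-refl)
      eq : ∀ m p → 8 * m + 8 * p ≡ 8 * (m + 0) + 0 + 8 * p
      eq = solve-∀
    tailSums i (suc q) 2≤i i+q≡k pos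
      with e ← blockSize i
         | refl ← blockSize-inner 2≤i (subst (i <_) i+q≡k (ℕ.m<m+n i (s≤s z≤n))) =
        proj₁ block-sums
      , (begin
          x + 8 * suc (suc q)                               ≡⟨ eq₁ x q ⟩
          x + 8 + 8 * suc q                                 ≡⟨ cong (_+ 8 * suc q) (proj₂ (proj₂ block-sums)) ⟩
          -- An inner block has `m i + 1` leaves; this turns the coefficient 16 into 32.
          w + 8 * m i + 16 * (2 * p) + 8 * suc q            ≡⟨ eq₂ w (m i) p (8 * suc q) ⟩
          (w + 8 * suc q) + 8 * m i + 32 * p                ≡⟨ cong (λ y → y + 8 * m i + 32 * p) (proj₁ (proj₂ rest)) ⟩
          8 * S + 32 * P + 8 * 2 ^ m k + 8 * m i + 32 * p   ≡⟨ eq₃ S P (2 ^ m k) (m i) p ⟩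
          8 * (m i + S) + 32 * (p + P) + 8 * 2 ^ m k        ∎)
      , (begin
          length (replicate (suc (m i)) u ++ bs)            ≡⟨ length-++ (replicate (suc (m i)) u) ⟩
          length (replicate (suc (m i)) u) + length bs      ≡⟨ cong₂ _+_ (length-replicate (suc (m i))) (proj₂ (proj₂ rest)) ⟩
          suc (m i) + (S + q)                               ≡⟨ eq₄ (m i) S q ⟩
          m i + S + suc q                                   ∎)
      where
      open ≡-Reasoning
      u = isUpperBlock i
      bs = concatMap block (range (suc i) (suc q))
      rest : TailSums (suc i) q
      rest = tailSums (suc i) q (ℕ.m≤n⇒m≤1+n 2≤i) (trans (sym (+-suc i q)) i+q≡k)
                      (λ j i<j → pos j (ℕ.<⇒≤ i<j))
      block-sums = innerBlock u (m i) bs (trans (cong (λ c → run c bs) (sym (not-involutive u))) (proj₁ rest))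
      x = runSum (replicate (suc (m i)) u ++ bs) + run u (replicate (suc (m i)) u ++ bs)
      w = runSum bs + run (not u) bs
      p = 2 ^ m i
      S = sumOver m (range (suc i) (suc q))
      P = sumOver (λ j → 2 ^ m j) (range (suc i) q)
      eq₁ : ∀ x q → x + 8 * suc (suc q) ≡ x + 8 + 8 * suc q
      eq₁ = solve-∀
      eq₂ : ∀ w m p c → w + 8 * m + 16 * (2 * p) + c ≡ (w + c) + 8 * m + 32 * p
      eq₂ = solve-∀
      eq₃ : ∀ S P l m p → 8 * S + 32 * P + 8 * l + 8 * m + 32 * p ≡ 8 * (m + S) + 32 * (p + P) + 8 * l
      eq₃ = solve-∀
      eq₄ : ∀ m S q → suc m + (S + q) ≡ m + S + suc q
      eq₄ = solve-∀

  module WordTotal (q : ℕ) (m : ℕ → ℕ) (pos : ∀ i → 1 ≤ i → i ≤ 2 + q → 1 ≤ m i) where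
    open CaterpillarHalin (2 + q) m using (isUpper)
    open Blocks (2 + q) m

    S P : ℕ
    S = sumOver m (range 1 (2 + q))
    P = sumOver (λ j → 2 ^ m j) (range 2 q)

    -- `S + q` is the number of leaves, as the q inner blocks have one leaf more than their
    -- parameter. The correction 8q + 24 consists of 8 for each inner block, 8 for the last block,
    -- and 16 for the first, which has one leaf fewer than an inner block with the same parameter.
    Total : List Bool → Set
    Total bs = ∃ λ r → words₂ bs ≡ 8 * ((S + q) * (S + q)) + 12 * (S + q) + r
                     × r + 8 * q + 24 ≡ 8 * S + 8 * 2 ^ m 1 + 32 * P + 8 * 2 ^ m (2 + q)

    words₂-isUpper : Total isUpper
    words₂-isUpper = subst Total (cong (concatMap block) (sym (interval-range 1 (2 + q)))) words₂-blocks
      where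
      words₂-blocks : Total (concatMap block (range 1 (2 + q)))
      words₂-blocks with m 1 in eq | pos 1 (s≤s z≤n) (s≤s z≤n)
      ... | suc n | _ =
          runSum bs
        , trans (words₂-runSum true (replicate n true ++ tail))
            (cong (λ l → 8 * (l * l) + 12 * l + runSum bs) len)
        , ℕ.+-cancelʳ-≡ 8 _ _ (begin
            runSum bs + 8 * q + 24 + 8                      ≡⟨ eq₁ (runSum bs) q ⟩
            (runSum bs + 8) + 8 * q + 24                    ≡⟨ cong (λ x → x + 8 * q + 24) (proj₁ (proj₂ block-sums)) ⟩
            w + 8 * n + 8 * 2 ^ suc n + 8 * q + 24          ≡⟨ eq₂ w n (2 ^ suc n) q ⟩
            (w + 8 * suc q) + 8 * suc n + 8 * 2 ^ suc n + 8 ≡⟨ cong (λ x → x + 8 * suc n + 8 * 2 ^ suc n + 8) (proj₁ (proj₂ rest)) ⟩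
            8 * S′ + 32 * P + 8 * L + 8 * suc n + 8 * 2 ^ suc n + 8
                                                            ≡⟨ eq₃ S′ P L n (2 ^ suc n) ⟩
            8 * (suc n + S′) + 8 * 2 ^ suc n + 32 * P + 8 * L + 8 ∎)
        where
        open ≡-Reasoning
        tail = concatMap block (range 2 (suc q))
        bs = replicate (suc n) true ++ tail
        rest : TailSums 2 q
        rest = tailSums 2 q ℕ.≤-refl refl (λ j 2≤j → pos j (ℕ.<⇒≤ 2≤j))
        block-sums = innerBlock true n tail (proj₁ rest)
        S′ = sumOver m (range 2 (suc q))
        L = 2 ^ m (2 + q)
        w = runSum tail + run false tail
        len : length bs ≡ suc n + S′ + q
        len = begin
          length bs                                       ≡⟨ length-++ (replicate (suc n) true) ⟩
          length (replicate (suc n) true) + length tail   ≡⟨ cong₂ _+_ (length-replicate (suc n)) (proj₂ (proj₂ rest)) ⟩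
          suc n + (S′ + q)                                ≡⟨ +-assoc (suc n) S′ q ⟨
          suc n + S′ + q                                  ∎
        eq₁ : ∀ s q → s + 8 * q + 24 + 8 ≡ (s + 8) + 8 * q + 24
        eq₁ = solve-∀
        eq₂ : ∀ w n p q → w + 8 * n + 8 * p + 8 * q + 24 ≡ (w + 8 * suc q) + 8 * suc n + 8 * p + 8
        eq₂ = solve-∀
        eq₃ : ∀ S P l n p → 8 * S + 32 * P + 8 * l + 8 * suc n + 8 * p + 8
                          ≡ 8 * (suc n + S) + 8 * p + 32 * P + 8 * l + 8
        eq₃ = solve-∀

-- Agreement with the stated integer formula

module ClosedForm where

  open import Defs
  open import Data.Integer.Base using (ℤ; +_; -_; _+_; _-_; _*_; 0ℤ)
  open import Data.Integer.Properties using (pos-+; pos-*; +-identityʳ; +-identityˡ; +-assoc)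
  open import Data.Integer.Tactic.RingSolver using (solve-∀)
  open import Data.List.Base using (List; []; _∷_; _++_; map; foldr; applyUpTo)
  open import Data.List.Properties using (applyUpTo-∷ʳ)
  open import Data.Nat.Base as ℕ using (ℕ; zero; suc; _∸_; _≤_) renaming (_^_ to _^ℕ_; _+_ to _+ℕ_)
  open import Data.Nat.Properties using (^-distribˡ-+-*)
  open import Data.Product using (_,_)
  open import Relation.Binary.PropositionalEquality
  open WordCounts
  open BlockSums

  ∑ₗᵢₛₜ : (ℕ → ℤ) → List ℕ → ℤ
  ∑ₗᵢₛₜ f is = foldr _+_ 0ℤ (map f is)

  ∑-∷ʳ : ∀ f is i → ∑ₗᵢₛₜ f (is ++ i ∷ []) ≡ ∑ₗᵢₛₜ f is + f i
  ∑-∷ʳ f []       i = trans (+-identityʳ (f i)) (sym (+-identityˡ (f i)))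
  ∑-∷ʳ f (j ∷ is) i = trans (cong (_+_ (f j)) (∑-∷ʳ f is i)) (sym (+-assoc (f j) _ (f i)))

  ∑-applyUpTo-suc : ∀ f (g : ℕ → ℕ) n → ∑ₗᵢₛₜ f (applyUpTo g (suc n)) ≡ ∑ₗᵢₛₜ f (applyUpTo g n) + f (g n)
  ∑-applyUpTo-suc f g n = trans (cong (∑ₗᵢₛₜ f) (sym (applyUpTo-∷ʳ g n))) (∑-∷ʳ f (applyUpTo g n) (g n))

  ∑-pos : ∀ (f : ℕ → ℕ) is → ∑ₗᵢₛₜ (λ i → + f i) is ≡ + sumOver f is
  ∑-pos f []       = refl
  ∑-pos f (i ∷ is) = trans (cong (_+_ (+ (f i))) (∑-pos f is)) (sym (pos-+ (f i) (sumOver f is)))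

  -- Makes the inner sum of the double sum a function of `m i` and the total of the earlier
  -- parameters, so that one induction on `k` suffices.
  ∑-affine : ∀ (m : ℕ → ℤ) (M : ℤ) is → ∑ₗᵢₛₜ (λ j → m j * M + m j) is ≡ ∑ₗᵢₛₜ m is * M + ∑ₗᵢₛₜ m is
  ∑-affine m M []       = refl
  ∑-affine m M (j ∷ is) = trans (cong (_+_ (m j * M + m j)) (∑-affine m M is)) (eq (m j) M (∑ₗᵢₛₜ m is))
    where
    eq : ∀ a M s → (a * M + a) + (s * M + s) ≡ (a + s) * M + (a + s)
    eq = solve-∀

  module Formula (m : ℕ → ℕ) where

    linear : ℕ → ℤ
    linear i = - (+ 9) + + 4 * + i + (- (+ 3) + + 4 * + i) * + m i + + 2 * (+ m i * + m i)

    double : ℕ → ℤ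
    double i = ∑[ j from 1 to i ∸ 1 ] (+ m j * + m i + + m j)

    power : ℕ → ℤ
    power i = + (2 ^ℕ (m i +ℕ 3)) + + 3 * + (2 ^ℕ (m (i ∸ 1) +ℕ 3))

    total : ℕ → ℤ
    total k = ∑[ j from 1 to k ] (+ m j)

    -- The squares 16 m_i² of the single sum and the products 32 m_j m_i of the double sum complete
    -- the square of the total. The induction starts at k = 1, where the sums from 2 are empty.
    quadratic-part : ∀ n → let k = suc n in
      + 8 * (∑[ i from 1 to k ] linear i) + + 32 * (∑[ i from 2 to k ] double i)
        ≡ + 16 * (total k * total k) + (+ 32 * + k + - (+ 24)) * total k + + 16 * (+ k * + k) + - (+ 56) * + k
    quadratic-part zero = eq (+ m 1)
      where
      eq : ∀ x → + 8 * ((- (+ 9) + + 4 * + 1 + (- (+ 3) + + 4 * + 1) * x + + 2 * (x * x)) + 0ℤ) + + 32 * 0ℤ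
        ≡ + 16 * ((x + 0ℤ) * (x + 0ℤ)) + (+ 32 * + 1 + - (+ 24)) * (x + 0ℤ) + + 16 * (+ 1 * + 1) + - (+ 56) * + 1
      eq = solve-∀
    quadratic-part (suc n) = begin
      + 8 * (∑[ i from 1 to k ] linear i) + + 32 * (∑[ i from 2 to k ] double i)
        ≡⟨ cong₂ (λ x y → + 8 * x + + 32 * y)
             (∑-applyUpTo-suc linear (λ i → 1 +ℕ i) (suc n)) (∑-applyUpTo-suc double (λ i → 2 +ℕ i) n) ⟩
      + 8 * (x + linear k) + + 32 * (y + double k)
        ≡⟨ eq₁ x y (linear k) (double k) ⟩
      (+ 8 * x + + 32 * y) + (+ 8 * linear k + + 32 * double k)
        ≡⟨ cong₂ (λ a b → a + (+ 8 * linear k + + 32 * b)) (quadratic-part n)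
             (∑-affine (λ j → + m j) (+ m k) [ 1 ⋯ suc n ]) ⟩
      + 16 * (S * S) + (+ 32 * + suc n + - (+ 24)) * S + + 16 * (+ suc n * + suc n) + - (+ 56) * + suc n
        + (+ 8 * linear k + + 32 * (S * + m k + S))
        ≡⟨ eq₂ S (+ m k) (+ suc n) ⟩
      + 16 * ((S + + m k) * (S + + m k)) + (+ 32 * + k + - (+ 24)) * (S + + m k) + + 16 * (+ k * + k) + - (+ 56) * + k
        ≡⟨ cong (λ s → + 16 * (s * s) + (+ 32 * + k + - (+ 24)) * s + + 16 * (+ k * + k) + - (+ 56) * + k)
             (∑-applyUpTo-suc (λ j → + m j) (λ i → 1 +ℕ i) (suc n)) ⟨
      + 16 * (total k * total k) + (+ 32 * + k + - (+ 24)) * total k + + 16 * (+ k * + k) + - (+ 56) * + k ∎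
      where
      open ≡-Reasoning
      k = suc (suc n)
      S = total (suc n)
      x = ∑[ i from 1 to suc n ] linear i
      y = ∑[ i from 2 to suc n ] double i
      eq₁ : ∀ x y a b → + 8 * (x + a) + + 32 * (y + b) ≡ (+ 8 * x + + 32 * y) + (+ 8 * a + + 32 * b)
      eq₁ = solve-∀
      eq₂ : ∀ S M k →
        + 16 * (S * S) + (+ 32 * k + - (+ 24)) * S + + 16 * (k * k) + - (+ 56) * k
          + (+ 8 * (- (+ 9) + + 4 * (+ 1 + k) + (- (+ 3) + + 4 * (+ 1 + k)) * M + + 2 * (M * M)) + + 32 * (S * M + S))
        ≡ + 16 * ((S + M) * (S + M)) + (+ 32 * (+ 1 + k) + - (+ 24)) * (S + M) + + 16 * ((+ 1 + k) * (+ 1 + k))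
          + - (+ 56) * (+ 1 + k)
      eq₂ = solve-∀

    2^-+ : ∀ a b → + (2 ^ℕ (a +ℕ b)) ≡ + (2 ^ℕ a) * + (2 ^ℕ b)
    2^-+ a b = trans (cong +_ (^-distribˡ-+-* 2 a b)) (pos-* (2 ^ℕ a) (2 ^ℕ b))

    power≡ : ∀ i → power i ≡ + (2 ^ℕ m i) * + 8 + + 3 * (+ (2 ^ℕ m (i ∸ 1)) * + 8)
    power≡ i = cong₂ (λ x y → x + + 3 * y) (2^-+ (m i) 3) (2^-+ (m (i ∸ 1)) 3)

    -- An inner index receives 8 as `m i` and 24 as `m (i ∸ 1)`, doubled to 64. The first index
    -- occurs only as predecessor, with 48, of which the subtracted power takes 32; the last occurs
    -- only as `m i`, with 16.
    power-part : ∀ q → let k = 2 +ℕ q in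
      + 2 * (∑[ i from 2 to k ] power i) + - + (2 ^ℕ (m 1 +ℕ 5))
        ≡ + 16 * + (2 ^ℕ m 1) + + 64 * (∑[ i from 2 to suc q ] (+ (2 ^ℕ m i))) + + 16 * + (2 ^ℕ m k)
    power-part zero = trans
      (cong₂ (λ x y → + 2 * (x + 0ℤ) + - y) (power≡ 2) (2^-+ (m 1) 5)) (eq (+ (2 ^ℕ m 1)) (+ (2 ^ℕ m 2)))
      where
      eq : ∀ x y → + 2 * ((y * + 8 + + 3 * (x * + 8)) + 0ℤ) + - (x * + 32) ≡ + 16 * x + + 64 * 0ℤ + + 16 * y
      eq = solve-∀
    power-part (suc q) = begin
      + 2 * (∑[ i from 2 to k ] power i) + - z
        ≡⟨ cong (λ x → + 2 * x + - z) (∑-applyUpTo-suc power (λ i → 2 +ℕ i) (suc q)) ⟩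
      + 2 * (x + power k) + - z
        ≡⟨ cong (λ w → + 2 * (x + w) + - z) (power≡ k) ⟩
      + 2 * (x + (M * + 8 + + 3 * (L * + 8))) + - z
        ≡⟨ eq₁ x z L M ⟩
      (+ 2 * x + - z) + (+ 16 * M + + 48 * L)
        ≡⟨ cong (_+ (+ 16 * M + + 48 * L)) (power-part q) ⟩
      + 16 * F + + 64 * P + + 16 * L + (+ 16 * M + + 48 * L)
        ≡⟨ eq₂ F P L M ⟩
      + 16 * F + + 64 * (P + L) + + 16 * M
        ≡⟨ cong (λ p → + 16 * F + + 64 * p + + 16 * M) (∑-applyUpTo-suc (λ i → + (2 ^ℕ m i)) (λ i → 2 +ℕ i) q) ⟨
      + 16 * F + + 64 * (∑[ i from 2 to suc (suc q) ] (+ (2 ^ℕ m i))) + + 16 * M ∎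
      where
      open ≡-Reasoning
      k = 3 +ℕ q
      x = ∑[ i from 2 to 2 +ℕ q ] power i
      z = + (2 ^ℕ (m 1 +ℕ 5))
      F = + (2 ^ℕ m 1)
      L = + (2 ^ℕ m (2 +ℕ q))
      M = + (2 ^ℕ m (3 +ℕ q))
      P = ∑[ i from 2 to suc q ] (+ (2 ^ℕ m i))
      eq₁ : ∀ x z L M → + 2 * (x + (M * + 8 + + 3 * (L * + 8))) + - z ≡ (+ 2 * x + - z) + (+ 16 * M + + 48 * L)
      eq₁ = solve-∀
      eq₂ : ∀ F P L M → + 16 * F + + 64 * P + + 16 * L + (+ 16 * M + + 48 * L) ≡ + 16 * F + + 64 * (P + L) + + 16 * M
      eq₂ = solve-∀

  module _ (q : ℕ) (m : ℕ → ℕ) (pos : ∀ i → 1 ≤ i → i ≤ 2 +ℕ q → 1 ≤ m i) where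
    open CaterpillarHalin (2 +ℕ q) m using (isUpper)
    open Formula m
    open WordTotal q m pos using (words₂-isUpper)

    formula : let k = 2 +ℕ q in
      + (2 ℕ.* words₂ isUpper) ≡
        + 8 * (∑[ i from 1 to k ]
                (- (+ 9) + + 4 * + i + (- (+ 3) + + 4 * + i) * + m i + + 2 * (+ m i * + m i)))
      + + 2 * (∑[ i from 2 to k ]
                (+ (2 ^ℕ (m i +ℕ 3)) + + 3 * + (2 ^ℕ (m (i ∸ 1) +ℕ 3))))
      - + (2 ^ℕ (m 1 +ℕ 5))
      + + 32 * (∑[ i from 2 to k ] (∑[ j from 1 to i ∸ 1 ] (+ m j * + m i + + m j)))
    formula with words₂-isUpper
    ... | r , words≡ , r≡ = begin
      + (2 ℕ.* words₂ isUpper)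
        ≡⟨ cong (λ w → + (2 ℕ.* w)) words≡ ⟩
      + (2 ℕ.* (8 ℕ.* (ℓ ℕ.* ℓ) +ℕ 12 ℕ.* ℓ +ℕ r))
        ≡⟨ cast₁ ⟩
      + 2 * (+ 8 * ((+ S + + q) * (+ S + + q)) + + 12 * (+ S + + q) + + r)
        ≡⟨ eq₁ (+ S) (+ q) (+ r) ⟩
      -- The known equation concerns r + 8q + 24, so twice 8q + 24 is added and taken off again.
      + 2 * (+ 8 * ((+ S + + q) * (+ S + + q)) + + 12 * (+ S + + q)) + + 2 * (+ r + + 8 * + q + + 24) + - (+ 16 * + q) + - (+ 48)
        ≡⟨ cong (λ x → + 2 * (+ 8 * ((+ S + + q) * (+ S + + q)) + + 12 * (+ S + + q)) + + 2 * x + - (+ 16 * + q) + - (+ 48))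
                cast₂ ⟩
      + 2 * (+ 8 * ((+ S + + q) * (+ S + + q)) + + 12 * (+ S + + q)) + + 2 * (+ 8 * + S + + 8 * F + + 32 * + P + + 8 * L)
        + - (+ 16 * + q) + - (+ 48)
        ≡⟨ eq₂ (+ S) (+ q) F (+ P) L ⟩
      (+ 16 * (+ S * + S) + (+ 32 * + k + - (+ 24)) * + S + + 16 * (+ k * + k) + - (+ 56) * + k)
        + (+ 16 * F + + 64 * + P + + 16 * L)
        ≡⟨ cong₂ (λ s p → (+ 16 * (s * s) + (+ 32 * + k + - (+ 24)) * s + + 16 * (+ k * + k) + - (+ 56) * + k)
                            + (+ 16 * F + + 64 * p + + 16 * L)) S≡ P≡ ⟨
      (+ 16 * (total k * total k) + (+ 32 * + k + - (+ 24)) * total k + + 16 * (+ k * + k) + - (+ 56) * + k)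
        + (+ 16 * F + + 64 * (∑[ i from 2 to suc q ] (+ (2 ^ℕ m i))) + + 16 * L)
        ≡⟨ cong₂ _+_ (quadratic-part (suc q)) (power-part q) ⟨
      (+ 8 * (∑[ i from 1 to k ] linear i) + + 32 * (∑[ i from 2 to k ] double i))
        + (+ 2 * (∑[ i from 2 to k ] power i) + - + (2 ^ℕ (m 1 +ℕ 5)))
        ≡⟨ eq₃ (∑[ i from 1 to k ] linear i) (∑[ i from 2 to k ] double i) (∑[ i from 2 to k ] power i) (+ (2 ^ℕ (m 1 +ℕ 5))) ⟩
      + 8 * (∑[ i from 1 to k ] linear i) + + 2 * (∑[ i from 2 to k ] power i) - + (2 ^ℕ (m 1 +ℕ 5))
        + + 32 * (∑[ i from 2 to k ] double i) ∎
      where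
      open ≡-Reasoning
      k = 2 +ℕ q
      S = sumOver m (range 1 k)
      P = sumOver (λ j → 2 ^ℕ m j) (range 2 q)
      ℓ = S +ℕ q
      F = + (2 ^ℕ m 1)
      L = + (2 ^ℕ m k)
      S≡ : total k ≡ + S
      S≡ = trans (∑-pos m [ 1 ⋯ k ]) (cong (λ is → + sumOver m is) (interval-range 1 k))
      P≡ : ∑[ i from 2 to suc q ] (+ (2 ^ℕ m i)) ≡ + P
      P≡ = trans (∑-pos (λ i → 2 ^ℕ m i) [ 2 ⋯ suc q ])
                 (cong (λ is → + sumOver (λ i → 2 ^ℕ m i) is) (interval-range 2 (suc q)))
      cast₁ : + (2 ℕ.* (8 ℕ.* (ℓ ℕ.* ℓ) +ℕ 12 ℕ.* ℓ +ℕ r))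
            ≡ + 2 * (+ 8 * ((+ S + + q) * (+ S + + q)) + + 12 * (+ S + + q) + + r)
      cast₁ = trans (pos-* 2 (8 ℕ.* (ℓ ℕ.* ℓ) +ℕ 12 ℕ.* ℓ +ℕ r)) (cong₂ (λ x y → + 2 * (x + y + + r))
        (trans (pos-* 8 (ℓ ℕ.* ℓ)) (cong (λ x → + 8 * x) (pos-* ℓ ℓ))) (pos-* 12 ℓ))
      cast₂ : + r + + 8 * + q + + 24 ≡ + 8 * + S + + 8 * F + + 32 * + P + + 8 * L
      cast₂ = begin
        + r + + 8 * + q + + 24       ≡⟨ cong (λ x → + r + x + + 24) (pos-* 8 q) ⟨
        + (r +ℕ 8 ℕ.* q +ℕ 24)       ≡⟨ cong +_ r≡ ⟩
        + (8 ℕ.* S +ℕ 8 ℕ.* (2 ^ℕ m 1) +ℕ 32 ℕ.* P +ℕ 8 ℕ.* (2 ^ℕ m k))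
          ≡⟨ cong₂ _+_ (cong₂ _+_ (cong₂ _+_ (pos-* 8 S) (pos-* 8 (2 ^ℕ m 1))) (pos-* 32 P)) (pos-* 8 (2 ^ℕ m k)) ⟩
        + 8 * + S + + 8 * F + + 32 * + P + + 8 * L ∎
      eq₁ : ∀ S q r → + 2 * (+ 8 * ((S + q) * (S + q)) + + 12 * (S + q) + r)
        ≡ + 2 * (+ 8 * ((S + q) * (S + q)) + + 12 * (S + q)) + + 2 * (r + + 8 * q + + 24) + - (+ 16 * q) + - (+ 48)
      eq₁ = solve-∀
      eq₂ : ∀ S q F P L →
        + 2 * (+ 8 * ((S + q) * (S + q)) + + 12 * (S + q)) + + 2 * (+ 8 * S + + 8 * F + + 32 * P + + 8 * L)
          + - (+ 16 * q) + - (+ 48)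
        ≡ (+ 16 * (S * S) + (+ 32 * (+ 2 + q) + - (+ 24)) * S + + 16 * ((+ 2 + q) * (+ 2 + q)) + - (+ 56) * (+ 2 + q))
          + (+ 16 * F + + 64 * P + + 16 * L)
      eq₂ = solve-∀
      eq₃ : ∀ a b c d → (+ 8 * a + + 32 * b) + (+ 2 * c + - d) ≡ + 8 * a + + 2 * c + - d + + 32 * b
      eq₃ = solve-∀

-- Cubic rotation systems relative to a reference rotation

module CubicRotations where

  open import Defs
  open import Data.Bool.Base using (Bool; true; false; not; if_then_else_; _xor_)
  open import Data.Bool.Properties using (not-involutive)
  open import Data.Fin.Base using (Fin; zero; suc)
  open import Data.Nat.Base using (zero; suc)
  open import Data.Nat.GeneralisedArithmetic using (iterate)
  open import Data.Product using (∃; _×_; _,_)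
  open import Data.Sum.Base using (_⊎_; inj₁; inj₂; [_,_]′)
  open import Function.Base using (_∘_)
  open import Relation.Binary.Bundles using (Setoid)
  open import Relation.Binary.Construct.Closure.Equivalence as EqC using ()
  open import Relation.Binary.PropositionalEquality
  open import Relation.Nullary.Negation.Core using (contradiction)
  open PartialQuotients

  hasCardinality : ∀ {a ℓ} (S : Setoid a ℓ) {n} → let open Setoid S in
                   (class : Carrier → Fin n) (rep : Fin n → Carrier) →
                   (∀ i → class (rep i) ≡ i) →
                   (∀ {x y} → x ≈ y → class x ≡ class y) →
                   (∀ {x y} → class x ≡ class y → x ≈ y) → HasCardinality S n
  hasCardinality S class rep class-rep complete sound = record
    { to        = class
    ; from      = rep
    ; to-cong   = complete
    ; from-cong = λ { refl → Setoid.refl S }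
    ; inverse   = (λ p → trans (complete p) (class-rep _))
                , (λ { {x} refl → sound (class-rep (class x)) })
    }

  rotate : Bool → Fin 3 → Fin 3
  rotate true  zero             = suc zero
  rotate true  (suc zero)       = suc (suc zero)
  rotate true  (suc (suc zero)) = zero
  rotate false zero             = suc (suc zero)
  rotate false (suc zero)       = zero
  rotate false (suc (suc zero)) = suc zero

  rotate-rotate : ∀ i → rotate true (rotate false i) ≡ i
  rotate-rotate zero             = refl
  rotate-rotate (suc zero)       = refl
  rotate-rotate (suc (suc zero)) = refl

  positive : Fin 3 → Bool
  positive (suc zero) = true
  positive _          = false

  Transitive : (Fin 3 → Fin 3) → Set
  Transitive f = ∀ i j → ∃ λ n → iterate f i n ≡ j

  -- `iterate` performs its first application at the start, so the induction continues from `b` with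
  -- the two points exchanged.
  iterate-2-cycle : ∀ {f : Fin 3 → Fin 3} {a b} → f a ≡ b → f b ≡ a →
                    ∀ n → iterate f a n ≡ a ⊎ iterate f a n ≡ b
  iterate-2-cycle fa fb zero = inj₁ refl
  iterate-2-cycle {f} fa fb (suc n) with iterate-2-cycle {f} fb fa n
  ... | inj₁ p rewrite fa = inj₂ p
  ... | inj₂ p rewrite fa = inj₁ p

  -- The orbit of `a` would miss `c`. With `a` and `b` equal this also excludes fixed points, and
  -- only the two 3-cycles remain.
  no-2-cycle : ∀ {f} → Transitive f → ∀ {a b} → f a ≡ b → f b ≡ a → ∀ c → c ≢ a → c ≢ b → ∀ {A : Set} → A
  no-2-cycle {f} t {a} fa fb c c≢a c≢b with t a c
  ... | n , refl = contradiction (iterate-2-cycle {f} fa fb n) [ c≢a , c≢b ]′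

  transitive⇒rotate : ∀ f → Transitive f → ∀ i → f i ≡ rotate (positive (f zero)) i
  transitive⇒rotate f t with f zero in e₀ | f (suc zero) in e₁ | f (suc (suc zero)) in e₂
  ... | zero           | _              | _              = no-2-cycle t e₀ e₀ (suc zero) (λ ()) (λ ())
  ... | suc zero       | zero           | _              = no-2-cycle t e₀ e₁ (suc (suc zero)) (λ ()) (λ ())
  ... | suc zero       | suc zero       | _              = no-2-cycle t e₁ e₁ zero (λ ()) (λ ())
  ... | suc zero       | suc (suc zero) | suc zero       = no-2-cycle t e₁ e₂ zero (λ ()) (λ ())
  ... | suc zero       | suc (suc zero) | suc (suc zero) = no-2-cycle t e₂ e₂ zero (λ ()) (λ ())
  ... | suc (suc zero) | _              | zero           = no-2-cycle t e₀ e₂ (suc zero) (λ ()) (λ ())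
  ... | suc (suc zero) | _              | suc (suc zero) = no-2-cycle t e₂ e₂ zero (λ ()) (λ ())
  ... | suc (suc zero) | suc zero       | suc zero       = no-2-cycle t e₁ e₁ zero (λ ()) (λ ())
  ... | suc (suc zero) | suc (suc zero) | suc zero       = no-2-cycle t e₁ e₂ zero (λ ()) (λ ())
  ... | suc zero       | suc (suc zero) | zero           = λ { zero → e₀ ; (suc zero) → e₁ ; (suc (suc zero)) → e₂ }
  ... | suc (suc zero) | zero           | suc zero       = λ { zero → e₀ ; (suc zero) → e₁ ; (suc (suc zero)) → e₂ }

  rotate-transitive : ∀ b → Transitive (rotate b)
  rotate-transitive true  zero             zero             = 0 , refl
  rotate-transitive true  zero             (suc zero)       = 1 , refl
  rotate-transitive true  zero             (suc (suc zero)) = 2 , refl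
  rotate-transitive true  (suc zero)       zero             = 2 , refl
  rotate-transitive true  (suc zero)       (suc zero)       = 0 , refl
  rotate-transitive true  (suc zero)       (suc (suc zero)) = 1 , refl
  rotate-transitive true  (suc (suc zero)) zero             = 1 , refl
  rotate-transitive true  (suc (suc zero)) (suc zero)       = 2 , refl
  rotate-transitive true  (suc (suc zero)) (suc (suc zero)) = 0 , refl
  rotate-transitive false zero             zero             = 0 , refl
  rotate-transitive false zero             (suc zero)       = 2 , refl
  rotate-transitive false zero             (suc (suc zero)) = 1 , refl
  rotate-transitive false (suc zero)       zero             = 1 , refl
  rotate-transitive false (suc zero)       (suc zero)       = 0 , refl
  rotate-transitive false (suc zero)       (suc (suc zero)) = 2 , refl
  rotate-transitive false (suc (suc zero)) zero             = 2 , refl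
  rotate-transitive false (suc (suc zero)) (suc zero)       = 1 , refl
  rotate-transitive false (suc (suc zero)) (suc (suc zero)) = 0 , refl

  positive-rotate : ∀ b → positive (rotate b zero) ≡ b
  positive-rotate true  = refl
  positive-rotate false = refl

  -- Exclusive nor. It translates between sides seen along a rotation of direction `o` and sides
  -- seen along the reference, in either sense.
  agree : Bool → Bool → Bool
  agree o s = if o then s else not s

  agree-involutive : ∀ o s → agree o (agree o s) ≡ s
  agree-involutive true  s     = refl
  agree-involutive false true  = refl
  agree-involutive false false = refl

  -- Corner `i` lies between slot `i` and its successor, so the side of slot `i` away from the
  -- successor is the corner of the preceding slot.
  side : Bool → Fin 3 → Fin 3
  side s i = if s then i else rotate false i

  side-rotate : ∀ o i → side (agree o true) i ≡ side (agree o false) (rotate o i)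
  side-rotate false i                = refl
  side-rotate true  zero             = refl
  side-rotate true  (suc zero)       = refl
  side-rotate true  (suc (suc zero)) = refl

  -- A choice of reference rotation  dartAt v 0 , dartAt v 1 , dartAt v 2  at
  -- each vertex v of a cubic graph.
  record CubicFrame (G : Graph) : Set where
    open Graph G
    field
      dartAt        : Vertex → Fin 3 → Dart
      slot          : Dart → Fin 3
      origin-dartAt : ∀ v i → origin (dartAt v i) ≡ v
      slot-dartAt   : ∀ v i → slot (dartAt v i) ≡ i
      dartAt-slot   : ∀ d → dartAt (origin d) (slot d) ≡ d

  module _ {G : Graph} (frame : CubicFrame G) where
    open Graph G
    open CubicFrame frame

    -- The corner (v , i) lies between  dartAt v i  and its successor in the
    -- reference rotation.
    Corner : Set
    Corner = Vertex × Fin 3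

    cornerOf : Dart → Bool → Corner
    cornerOf d s = origin d , side s (slot d)

    -- Sides are measured in the reference rotation, so the directions at the vertices have
    -- disappeared from the relation. As in `ChangeVertex`, an untwisted edge exchanges the sides.
    data Glued (t : Edge → Bool) : Corner → Corner → Set where
      glued : ∀ e s → Glued t (cornerOf (e , true) s) (cornerOf (e , false) (agree (not (t e)) (not s)))

    rotationSystem : (Vertex → Bool) → (Edge → Bool) → RotationSystem G
    rotationSystem o τ = record
      { pure = record
        { next        = λ d → dartAt (origin d) (rotate (o (origin d)) (slot d))
        ; next-origin = λ d → origin-dartAt _ _
        ; transitive  = λ d d′ p → let n , q = rotate-transitive (o (origin d)) (slot d) (slot d′) in
            n , (begin
              iterate next d n                                                ≡⟨ iterate-next d n ⟩
              dartAt (origin d) (iterate (rotate (o (origin d))) (slot d) n)  ≡⟨ cong₂ dartAt p q ⟩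
              dartAt (origin d′) (slot d′)                                    ≡⟨ dartAt-slot d′ ⟩
              d′                                                              ∎)
        }
      ; τ = τ
      }
      where
      open ≡-Reasoning
      next : Dart → Dart
      next d = dartAt (origin d) (rotate (o (origin d)) (slot d))
      iterate-next : ∀ d n → iterate next d n ≡ dartAt (origin d) (iterate (rotate (o (origin d))) (slot d) n)
      iterate-next d zero    = sym (dartAt-slot d)
      iterate-next d (suc n) rewrite iterate-next (next d) n
        | origin-dartAt (origin d) (rotate (o (origin d)) (slot d))
        | slot-dartAt (origin d) (rotate (o (origin d)) (slot d)) = refl

    module Rotation (ρ : RotationSystem G) where
      open RotationSystem ρ

      direction : Vertex → Bool
      direction v = positive (slot (next (dartAt v zero)))

      -- Reversing the rotation at one end of an edge toggles its twisting.
      twist : Edge → Bool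
      twist e = τ e xor (direction (end e true) xor direction (end e false))

      private
        step : Vertex → Fin 3 → Fin 3
        step v i = slot (next (dartAt v i))

        next-step : ∀ v i → next (dartAt v i) ≡ dartAt v (step v i)
        next-step v i = trans (sym (dartAt-slot _))
          (cong (λ u → dartAt u (step v i)) (trans (next-origin _) (origin-dartAt v i)))

        iterate-step : ∀ v i n → iterate next (dartAt v i) n ≡ dartAt v (iterate (step v) i n)
        iterate-step v i zero    = refl
        iterate-step v i (suc n) = trans (cong (λ d → iterate next d n) (next-step v i)) (iterate-step v _ n)

        step-transitive : ∀ v → Transitive (step v)
        step-transitive v i j with transitive (dartAt v i) (dartAt v j) (trans (origin-dartAt v i) (sym (origin-dartAt v j)))
        ... | n , p = n , (begin
          iterate (step v) i n                  ≡⟨ slot-dartAt v _ ⟨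
          slot (dartAt v (iterate (step v) i n)) ≡⟨ cong slot (iterate-step v i n) ⟨
          slot (iterate next (dartAt v i) n)    ≡⟨ cong slot p ⟩
          slot (dartAt v j)                     ≡⟨ slot-dartAt v j ⟩
          j                                     ∎)
          where open ≡-Reasoning

      next-dartAt : ∀ v i → next (dartAt v i) ≡ dartAt v (rotate (direction v) i)
      next-dartAt v i = trans (next-step v i) (cong (dartAt v) (transitive⇒rotate (step v) (step-transitive v) i))

      next-rotate : ∀ d → next d ≡ dartAt (origin d) (rotate (direction (origin d)) (slot d))
      next-rotate d = trans (cong next (sym (dartAt-slot d))) (next-dartAt (origin d) (slot d))

      -- The two flags that `ChangeEdge` joins have the same image; what remains of the face
      -- relation is `Glued twist`.
      cornerFlag : Flag ρ → Corner
      cornerFlag (d , s) = cornerOf d (agree (direction (origin d)) s)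

      cornerFlag-dartAt : ∀ v i s → cornerFlag (dartAt v i , s) ≡ (v , side (agree (direction v) s) i)
      cornerFlag-dartAt v i s =
        cong₂ (λ u j → u , side (agree (direction u) s) j) (origin-dartAt v i) (slot-dartAt v i)

      flagOf : Corner → Flag ρ
      flagOf (v , i) = dartAt v i , direction v

      infix 4 _≈_
      _≈_ : Flag ρ → Flag ρ → Set
      _≈_ = Setoid._≈_ (FaceSetoid ρ)

      private module ≈ = Setoid (FaceSetoid ρ)

      -- If side and direction coincide, the flag is the chosen representative already; if not, a
      -- single `ChangeEdge` leads to it.
      flag≈flagOf : ∀ f → f ≈ flagOf (cornerFlag f)
      flag≈flagOf (d , s) with direction (origin d) in eq | s
      ... | true  | true  = ≈.reflexive (cong (_, _) (sym (dartAt-slot d)))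
      ... | false | false = ≈.reflexive (cong (_, _) (sym (dartAt-slot d)))
      ... | true  | false = ≈.sym (EqC.return (inj₂
        (subst (λ d′ → ChangeEdge ρ (d⁻ , true) (d′ , false)) next-d⁻ (corner d⁻))))
        where
        d⁻ = dartAt (origin d) (rotate false (slot d))
        next-d⁻ : next d⁻ ≡ d
        next-d⁻ = begin
          next d⁻                                                        ≡⟨ next-dartAt (origin d) _ ⟩
          dartAt (origin d) (rotate (direction (origin d)) (rotate false (slot d)))
                                                  ≡⟨ cong (λ o → dartAt (origin d) (rotate o (rotate false (slot d)))) eq ⟩
          dartAt (origin d) (rotate true (rotate false (slot d)))        ≡⟨ cong (dartAt (origin d)) (rotate-rotate (slot d)) ⟩
          dartAt (origin d) (slot d)                                     ≡⟨ dartAt-slot d ⟩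
          d                                                              ∎
          where open ≡-Reasoning
      ... | false | true = ≈.trans (EqC.return (inj₂ (corner d)))
        (≈.reflexive (cong (_, false)
        (trans (next-rotate d) (cong (λ o → dartAt (origin d) (rotate o (slot d))) eq))))

      private
        -- A parity identity: translating the sides at the two ends contributes `o` and `o′`,
        -- exactly what `twist` adds to `τ`.
        opposite-side : ∀ τ o o′ s → agree (not (τ xor (o xor o′))) (not (agree o s)) ≡ agree o′ (agree (not τ) (not s))
        opposite-side false false false false = refl
        opposite-side false false false true  = refl
        opposite-side false false true  false = refl
        opposite-side false false true  true  = refl
        opposite-side false true  false false = refl
        opposite-side false true  false true  = refl
        opposite-side false true  true  false = refl
        opposite-side false true  true  true  = refl
        opposite-side true  false false false = refl
        opposite-side true  false false true  = refl
        opposite-side true  false true  false = refl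
        opposite-side true  false true  true  = refl
        opposite-side true  true  false false = refl
        opposite-side true  true  false true  = refl
        opposite-side true  true  true  false = refl
        opposite-side true  true  true  true  = refl

      glued-flags : ∀ e s → Glued twist (cornerFlag ((e , true) , s))
                                        (cornerFlag ((e , false) , agree (not (τ e)) (not s)))
      glued-flags e s = subst (λ s′ → Glued twist (cornerFlag ((e , true) , s)) (cornerOf (e , false) s′))
        (opposite-side (τ e) (direction (end e true)) (direction (end e false)) s)
        (glued e (agree (direction (end e true)) s))

      changeVertex : ∀ d s → (d , s) ≈ (opposite d , agree (not (τ (edge d))) (not s))
      changeVertex d s with τ (edge d) in eq
      ... | false = EqC.return (inj₁ (untwisted s eq))
      ... | true  = ≈.trans (EqC.return (inj₁ (twisted s eq))) (≈.reflexive (cong (opposite d ,_) (sym (not-involutive s))))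

      module _ {n} (Q : Partial (Glued twist) n)
               (complete : ∀ {x y} → Glued twist x y → Partial.class Q x ≡ Partial.class Q y) where
        open Partial Q

        private
          face : Flag ρ → Fin n
          face = class ∘ cornerFlag

          face-vertex : ∀ d s → face (d , s) ≡ face (opposite d , agree (not (τ (edge d))) (not s))
          face-vertex (e , true)  s = complete (glued-flags e s)
          face-vertex (e , false) s = sym (trans (complete (glued-flags e (agree (not (τ e)) (not s))))
            (cong (λ s′ → face ((e , false) , s′)) (involutive (τ e) s)))
            where
            involutive : ∀ τ s → agree (not τ) (not (agree (not τ) (not s))) ≡ s
            involutive true  true  = refl
            involutive true  false = refl
            involutive false true  = refl
            involutive false false = refl

          face-resp : ∀ {x y} → ChangeVertex ρ x y ⊎ ChangeEdge ρ x y → face x ≡ face y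
          face-resp (inj₁ (untwisted {d} s eq)) =
            trans (face-vertex d s) (cong (λ t → face (opposite d , agree (not t) (not s))) eq)
          face-resp (inj₁ (twisted {d} s eq)) =
            trans (face-vertex d s) (trans (cong (λ t → face (opposite d , agree (not t) (not s))) eq)
              (cong (λ s′ → face (opposite d , s′)) (not-involutive s)))
          face-resp (inj₂ (corner d)) = cong class (begin
            cornerFlag (d , true)
              ≡⟨ cong (origin d ,_) (side-rotate o (slot d)) ⟩
            origin d , side (agree o false) (rotate o (slot d))
              ≡⟨ cornerFlag-dartAt (origin d) (rotate o (slot d)) false ⟨
            cornerFlag (dartAt (origin d) (rotate o (slot d)) , false)
              ≡⟨ cong (λ d′ → cornerFlag (d′ , false)) (next-rotate d) ⟨
            cornerFlag (next d , false) ∎)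
            where
            open ≡-Reasoning
            o = direction (origin d)

          glued⇒≈ : ∀ {x y} → Glued twist x y → flagOf x ≈ flagOf y
          glued⇒≈ (glued e s) = ≈.trans (≈.reflexive (cong flagOf (cong (cornerOf (e , true)) (sym s≡))))
            (≈.trans (≈.sym (flag≈flagOf ((e , true) , s′))) (≈.trans (changeVertex (e , true) s′)
            (≈.trans (flag≈flagOf ((e , false) , agree (not (τ e)) (not s′)))
              (≈.reflexive (cong (λ r → flagOf (cornerOf (e , false) r))
                (trans (sym (opposite-side (τ e) (direction (end e true)) (direction (end e false)) s′))
                       (cong (λ r → agree (not (twist e)) (not r)) s≡)))))))
            where
            s′ = agree (direction (end e true)) s
            s≡ : agree (direction (end e true)) s′ ≡ s
            s≡ = agree-involutive (direction (end e true)) s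

        faces-cardinality : HasCardinality (FaceSetoid ρ) n
        faces-cardinality = hasCardinality (FaceSetoid ρ) face (flagOf ∘ rep)
          (λ i → trans (cong class (cornerFlag-flagOf (rep i))) (class-rep i))
          (EqC.gfold isEquivalence face face-resp)
          (λ {x} {y} p → ≈.trans (flag≈flagOf x) (≈.trans
             (EqC.gfold ≈.isEquivalence flagOf glued⇒≈ (sound p)) (≈.sym (flag≈flagOf y))))
          where
          cornerFlag-flagOf : ∀ x → cornerFlag (flagOf x) ≡ x
          cornerFlag-flagOf (v , i) = trans (cornerFlag-dartAt v i (direction v)) (cong (v ,_) (agree-self (direction v) i))
            where
            agree-self : ∀ o i → side (agree o o) i ≡ i
            agree-self true  i = refl
            agree-self false i = refl

-- Potentials with prescribed differences along a spanning tree

module SpanningTreePotentials where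

  open import Defs
  open import Data.Bool.Base using (Bool; true; false; _xor_; _∧_)
  open import Data.Bool.Properties as Bool using (xor-comm; xor-identityʳ)
  open import Data.Fin.Base using (Fin; zero; suc; toℕ; fromℕ; fromℕ<; inject₁)
  open import Data.Fin.Properties as Fin
      using (toℕ-injective; toℕ-fromℕ<; toℕ-inject₁; toℕ-fromℕ; toℕ<n)
  open import Data.Fin.Relation.Unary.Top using (view; ‵fromℕ; ‵inject₁)
  open import Data.List.Base using (List; []; _∷_; length; lookup)
  open import Data.List.Relation.Unary.All as All using (All; []; _∷_)
  open import Data.List.Relation.Unary.AllPairs using (AllPairs; []; _∷_)
  open import Data.List.Relation.Unary.Any using (here; there)
  open import Data.List.Membership.Propositional using (_∈_)
  import Data.List.Membership.DecPropositional as DecMembership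
  open import Data.Nat.Base using (ℕ; zero; suc; _<_; _≤_; s≤s)
  open import Data.Nat.DivMod using (_%_; m<n⇒m%n≡m; n%n≡0)
  open import Data.Nat.Properties as ℕ using ()
  open import Data.Product using (∃; Σ; _×_; _,_; proj₁; proj₂)
  open import Data.Sum.Base using (_⊎_; inj₁; inj₂; [_,_]′)
  open import Data.Unit.Base using (⊤; tt)
  open import Function.Base using (_∘_)
  open import Function.Bundles using (_↔_; Inverse; Injection; Equivalence)
  open import Function.Definitions using (Injective)
  open import Relation.Binary.Construct.Closure.Equivalence as EqC using (EqClosure)
  open import Relation.Binary.Construct.Closure.ReflexiveTransitive using (Star; ε; _◅_)
  open import Relation.Binary.Construct.Closure.Symmetric using (fwd; bwd)
  open import Relation.Binary.Definitions using (DecidableEquality)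
  open import Relation.Binary.PropositionalEquality
  open import Relation.Nullary.Decidable using (yes; no; isYes; via-injection)
  open import Function.Properties.Inverse using (↔⇒↣)
  open import Data.List.Relation.Unary.All.Properties using (¬Any⇒All¬)
  open import Data.List.Membership.Propositional.Properties using (∈-lookup)
  open import Relation.Nullary.Negation.Core using (¬_; contradiction)
  open PartialQuotients

  cyclicSuc-inject₁ : ∀ {n} (i : Fin n) → cyclicSuc (inject₁ i) ≡ suc i
  cyclicSuc-inject₁ {n} i = toℕ-injective (trans (toℕ-fromℕ< _)
    (trans (m<n⇒m%n≡m (s≤s (subst (_< n) (sym (toℕ-inject₁ i)) (toℕ<n i)))) (cong suc (toℕ-inject₁ i))))

  cyclicSuc-fromℕ : ∀ n → cyclicSuc (fromℕ n) ≡ zero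
  cyclicSuc-fromℕ n = toℕ-injective (trans (toℕ-fromℕ< _)
    (trans (cong (λ m → suc m % suc n) (toℕ-fromℕ n)) (n%n≡0 (suc n))))

  AllPairs-lookup-injective : ∀ {A B : Set} (f : A → B) {xs : List A} →
    AllPairs (λ x y → f x ≢ f y) xs → Injective _≡_ _≡_ (f ∘ lookup xs)
  AllPairs-lookup-injective f (_ ∷ _)  {zero}  {zero}  p = refl
  AllPairs-lookup-injective f (≢s ∷ _) {zero}  {suc j} p = contradiction p (All.lookup ≢s (∈-lookup j))
  AllPairs-lookup-injective f (≢s ∷ _) {suc i} {zero}  p = contradiction (sym p) (All.lookup ≢s (∈-lookup i))
  AllPairs-lookup-injective f (_ ∷ ps) {suc i} {suc j} p = cong suc (AllPairs-lookup-injective f ps p)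

  module Paths {G : Graph} (_≟_ : DecidableEquality (Graph.Vertex G)) {T : Graph.EdgeSet G}
               {A : Graph.Edge G → Set} (A⇒T : ∀ {e} → A e → T e ≡ true) where

    open Graph G
    open DecMembership _≟_ using (_∈?_)

    data Path : Vertex → Vertex → Set where
      []   : ∀ {v} → Path v v
      step : ∀ {u w v} d → origin d ≡ u → target d ≡ w → A (edge d) → Path w v → Path u v

    vertices : ∀ {u v} → Path u v → List Vertex
    vertices {u} []                = u ∷ []
    vertices {u} (step _ _ _ _ p) = u ∷ vertices p

    darts : ∀ {u v} → Path u v → List Dart
    darts []                = []
    darts (step d _ _ _ p) = d ∷ darts p

    Simple : ∀ {u v} → Path u v → Set
    Simple     []                = ⊤
    Simple {u} (step _ _ _ _ p) = All (u ≢_) (vertices p) × Simple p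

    SimplePath : Vertex → Vertex → Set
    SimplePath u v = Σ (Path u v) Simple

    start : ∀ {u v} {P : Vertex → Set} (p : Path u v) → All P (vertices p) → P u
    start []                (q ∷ _) = q
    start (step _ _ _ _ _) (q ∷ _) = q

    finish : ∀ {u v} {P : Vertex → Set} (p : Path u v) → All P (vertices p) → P v
    finish []                (q ∷ _)  = q
    finish (step _ _ _ _ p) (_ ∷ qs) = finish p qs

    avoids : ∀ {x u v} (p : Path u v) → All (x ≢_) (vertices p) →
             All (λ d → x ≢ origin d × x ≢ target d) (darts p)
    avoids []                         _        = []
    avoids (step d refl refl _ p) (q ∷ qs) = (q , start p qs) ∷ avoids p qs

    suffix : ∀ {u v x} (p : Path u v) → Simple p → x ∈ vertices p → SimplePath x v
    suffix []                    s       (here refl) = [] , s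
    suffix p@(step _ _ _ _ _) s       (here refl) = p , s
    suffix (step _ _ _ _ p)   (_ , s) (there x∈p) = suffix p s x∈p

    -- Loop erasure: if the path visits `u` already, the part before that visit is dropped.
    prepend : ∀ {u w v} d → origin d ≡ u → target d ≡ w → A (edge d) → SimplePath w v → SimplePath u v
    prepend {u} d o t a (p , s) with u ∈? vertices p
    ... | yes u∈p = suffix p s u∈p
    ... | no  u∉p = step d o t a p , ¬Any⇒All¬ _ u∉p , s

    Adjacent : Vertex → Vertex → Set
    Adjacent u v = ∃ λ e → A e × end e true ≡ u × end e false ≡ v

    simplePath : ∀ {u v} → EqClosure Adjacent u v → SimplePath u v
    simplePath ε = [] , tt
    simplePath (fwd (e , a , o , t) ◅ w) = prepend (e , true) o t a (simplePath w)
    simplePath (bwd (e , a , o , t) ◅ w) = prepend (e , false) t o a (simplePath w)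

    same-edge : ∀ {d d′ : Dart} → edge d ≡ edge d′ → origin d ≡ origin d′ ⊎ origin d ≡ target d′
    same-edge {_ , true}  {_ , true}  refl = inj₁ refl
    same-edge {_ , true}  {_ , false} refl = inj₂ refl
    same-edge {_ , false} {_ , true}  refl = inj₂ refl
    same-edge {_ , false} {_ , false} refl = inj₁ refl

    origins-distinct : ∀ {u v} (p : Path u v) → Simple p → AllPairs (λ d d′ → origin d ≢ origin d′) (darts p)
    origins-distinct []                   _        = []
    origins-distinct (step d refl _ _ p) (q , s) = All.map proj₁ (avoids p q) ∷ origins-distinct p s

    edges-distinct : ∀ {u v} (p : Path u v) → Simple p → AllPairs (λ d d′ → edge d ≢ edge d′) (darts p)
    edges-distinct []                   _        = []
    edges-distinct (step d refl _ _ p) (q , s) =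
      All.map (λ (≢o , ≢t) p → [ ≢o , ≢t ]′ (same-edge p)) (avoids p q) ∷ edges-distinct p s

    end≢origins : ∀ {u v} (p : Path u v) → Simple p → All (λ d → v ≢ origin d) (darts p)
    end≢origins []                   _        = []
    end≢origins (step d refl _ _ p) (q , s) = ≢-sym (finish p q) ∷ end≢origins p s

    edges-allowed : ∀ {u v} (p : Path u v) → All (A ∘ edge) (darts p)
    edges-allowed []                = []
    edges-allowed (step _ _ _ a p) = a ∷ edges-allowed p

    consecutive : ∀ {u v} c (p : Path u v) → target c ≡ u → ∀ j →
      target (lookup (c ∷ darts p) (inject₁ j)) ≡ origin (lookup (c ∷ darts p) (suc j))
    consecutive c (step d o t _ p) q zero    = trans q (sym o)
    consecutive c (step d o t _ p) q (suc j) = consecutive d p t j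

    last-target : ∀ {u v} c (p : Path u v) → target c ≡ u → target (lookup (c ∷ darts p) (fromℕ _)) ≡ v
    last-target c []                q = q
    last-target c (step d o t _ p) q = last-target d p t

    -- The dart `c` heads the list. Its origin is the end of the simple path, which is the origin of
    -- no dart on it, and its edge is not on the path because the path uses edges of `A` only.
    cycle : ∀ {u v} → SimplePath u v → ∀ c → T (edge c) ≡ true → ¬ A (edge c) →
            origin c ≡ v → target c ≡ u → Cycle T
    cycle {u} (p , s) c c∈T c∉A refl t = record
      { predLength        = length (darts p)
      ; dart              = lookup (c ∷ darts p)
      ; inT               = λ i → All.lookup {P = λ d → T (edge d) ≡ true} (c∈T ∷ All.map A⇒T (edges-allowed p)) (∈-lookup i)
      ; closed            = closed
      ; vertices-distinct = AllPairs-lookup-injective origin (end≢origins p s ∷ origins-distinct p s)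
      ; edges-distinct    = AllPairs-lookup-injective edge
          (All.map (λ { a refl → c∉A a }) (edges-allowed p) ∷ edges-distinct p s)
      }
      where
      closed : ∀ i → target (lookup (c ∷ darts p) i) ≡ origin (lookup (c ∷ darts p) (cyclicSuc i))
      closed i with view i
      ... | ‵inject₁ j rewrite cyclicSuc-inject₁ j = consecutive c p t j
      ... | ‵fromℕ rewrite cyclicSuc-fromℕ (length (darts p)) = last-target c p t

  weaken : ∀ {X : Set} {R S : X → X → Set} {n} → (∀ {x y} → R x y → S x y) → Partial R n → Partial S n
  weaken R⊆S Q = record
    { class     = class
    ; rep       = rep
    ; class-rep = class-rep
    ; sound     = EqC.map R⊆S ∘ sound
    }
    where open Partial Q

  discrete : ∀ {X : Set} {R : X → X → Set} {n} → X ↔ Fin n → Partial R n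
  discrete {R = R} X↔Fin = record
    { class     = Inverse.to X↔Fin
    ; rep       = Inverse.from X↔Fin
    ; class-rep = λ i → Inverse.inverseˡ X↔Fin refl
    ; sound     = λ {x} p → subst (EqClosure R x) (Injection.injective (↔⇒↣ X↔Fin) p) ε
    }

  xor-translate : ∀ x y z → (x xor z) xor (y xor z) ≡ x xor y
  xor-translate false false false = refl
  xor-translate false false true  = refl
  xor-translate false true  false = refl
  xor-translate false true  true  = refl
  xor-translate true  false false = refl
  xor-translate true  false true  = refl
  xor-translate true  true  false = refl
  xor-translate true  true  true  = refl

  module Potential (G : Graph) {T : Graph.EdgeSet G} (tree : Graph.IsSpanningTree G T) where
    open Graph G
    open IsSpanningTree tree

    difference : (Vertex → Bool) → Edge → Bool
    difference p e = p (end e true) xor p (end e false)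

    Solves : (Vertex → Bool) → (Edge → Bool) → Set
    Solves p t = ∀ e → T e ≡ true → difference p e ≡ t e

    _≟_ : DecidableEquality Vertex
    _≟_ = via-injection (↔⇒↣ V-finite) Fin._≟_

    index : Edge → ℕ
    index e = toℕ (Inverse.to E-finite e)

    Before : ℕ → Edge → Set
    Before k e = T e ≡ true × index e < k

    module Before k = Paths {G} _≟_ {T} {Before k} proj₁

    module _ (t : Edge → Bool) where

      -- The components of the forest of tree edges with index below `k`. Soundness turns equal
      -- classes into a path, hence into a forbidden cycle; `complete` makes both ends of an old
      -- edge change together when a whole component is modified.
      record Stage (k : ℕ) : Set where
        field
          {size}    : ℕ
          quotient  : Partial (Before.Adjacent k) size
          potential : Vertex → Bool
        open Partial quotient public
        field
          complete  : ∀ e → Before k e → class (end e true) ≡ class (end e false)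
          solves    : ∀ e → Before k e → difference potential e ≡ t e

      stage : ∀ k → k ≤ #E → Stage k
      stage zero _ = record
        { quotient  = discrete V-finite
        ; potential = λ _ → false
        ; complete  = λ { _ (_ , ()) }
        ; solves    = λ { _ (_ , ()) }
        }
      stage (suc k) k<#E = extend (T e) refl
        where
        open Stage (stage k (ℕ.<⇒≤ k<#E))

        e : Edge
        e = Inverse.from E-finite (fromℕ< k<#E)

        index-e : index e ≡ k
        index-e = trans (cong toℕ (Inverse.inverseˡ E-finite refl)) (toℕ-fromℕ< k<#E)

        earlier : ∀ {e′} → Before (suc k) e′ → e′ ≢ e → Before k e′
        earlier {e′} (e′∈T , i) e′≢e with ℕ.m<1+n⇒m<n∨m≡n i
        ... | inj₁ i<k = e′∈T , i<k
        ... | inj₂ i≡k = contradiction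
          (Injection.injective (↔⇒↣ E-finite) (toℕ-injective (trans i≡k (sym index-e)))) e′≢e

        later : ∀ {e′} → Before k e′ → Before (suc k) e′
        later (e′∈T , i) = e′∈T , ℕ.m<n⇒m<1+n i

        adjacent-later : ∀ {x y} → Before.Adjacent k x y → Before.Adjacent (suc k) x y
        adjacent-later (e′ , b , p) = e′ , later b , p

        extend : ∀ b → T e ≡ b → Stage (suc k)
        extend false e∉T = record
          { quotient  = weaken adjacent-later quotient
          ; potential = potential
          ; complete  = λ e′ b → complete e′ (earlier b λ { refl → contradiction (trans (sym e∉T) (proj₁ b)) λ () })
          ; solves    = λ e′ b → solves e′ (earlier b λ { refl → contradiction (trans (sym e∉T) (proj₁ b)) λ () })
          }
        extend true e∈T = record
          { quotient  = M.quotient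
          ; potential = potential′
          ; complete  = complete′
          ; solves    = solves′
          }
          where
          u = end e true
          v = end e false

          -- Otherwise a simple path of earlier tree edges from `u` to `v`, closed by `e`, would be
          -- a cycle in the tree.
          u≁v : class u ≢ class v
          u≁v p = acyclic (Before.cycle k (Before.simplePath k (sound p)) (e , false) e∈T
            (λ (_ , i) → ℕ.<-irrefl index-e i) refl refl)

          e-before : Before (suc k) e
          e-before = e∈T , s≤s (ℕ.≤-reflexive index-e)

          module M = Merged (merge _ (weaken adjacent-later quotient) u v (e , e-before , refl , refl))
          open Partial M.quotient using () renaming (class to class′)

          -- The error of the old potential on `e`. Adding it throughout the component of `u`, which
          -- does not contain `v`, repairs `e` and leaves all earlier differences intact.
          discrepancy : Bool
          discrepancy = difference potential e xor t e

          inClass : Fin size → Bool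
          inClass i = isYes (i Fin.≟ class u)

          potential′ : Vertex → Bool
          potential′ z = potential z xor (inClass (class z) ∧ discrepancy)

          complete′ : ∀ e′ → Before (suc k) e′ → class′ (end e′ true) ≡ class′ (end e′ false)
          complete′ e′ b with Inverse.to E-finite e′ Fin.≟ Inverse.to E-finite e
          ... | yes p with refl ← Injection.injective (↔⇒↣ E-finite) p =
            Equivalence.from (M.joins u v) (inj₂ (inj₁ (refl , refl)))
          ... | no ¬p = Equivalence.from (M.joins _ _) (inj₁ (complete e′ (earlier b λ { refl → ¬p refl })))

          solves′ : ∀ e′ → Before (suc k) e′ → difference potential′ e′ ≡ t e′
          solves′ e′ b with Inverse.to E-finite e′ Fin.≟ Inverse.to E-finite e
          ... | no ¬p = trans
            (trans (cong (λ c → potential′ (end e′ true) xor (potential (end e′ false) xor (inClass c ∧ discrepancy)))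
                         (sym (complete e′ b′)))
                   (xor-translate (potential (end e′ true)) (potential (end e′ false)) _))
            (solves e′ b′)
            where
            b′ = earlier b λ { refl → ¬p refl }
          ... | yes p with refl ← Injection.injective (↔⇒↣ E-finite) p
            with class u Fin.≟ class u | class v Fin.≟ class u
          ... | no ¬q | _     = contradiction refl ¬q
          ... | yes _ | yes q = contradiction (sym q) u≁v
          ... | yes _ | no _  = correct (potential u) (potential v) (t e)
            where
            correct : ∀ x y z → (x xor ((x xor y) xor z)) xor (y xor false) ≡ z
            correct false false z = xor-identityʳ z
            correct false true  false = refl
            correct false true  true  = refl
            correct true  false false = refl
            correct true  false true  = refl
            correct true  true  false = refl
            correct true  true  true  = refl

      solution : ∃ λ p → Solves p t
      solution = potential , λ e e∈T → solves e (e∈T , toℕ<n (Inverse.to E-finite e))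
        where open Stage (stage #E ℕ.≤-refl)

      solution-from : ∀ r b → ∃ λ p → p r ≡ b × Solves p t
      solution-from r b = (λ v → p v xor (p r xor b)) , normalise (p r) b , λ e e∈T →
          trans (xor-translate (p (end e true)) (p (end e false)) (p r xor b)) (p-solves e e∈T)
        where
        p = proj₁ solution
        p-solves = proj₂ solution
        normalise : ∀ x y → x xor (x xor y) ≡ y
        normalise false y     = refl
        normalise true  false = refl
        normalise true  true  = refl

    -- Agreement at `r` spreads along tree walks, as both potentials have the same difference on
    -- each tree edge.
    solution-unique : ∀ {p p′ t} → Solves p t → Solves p′ t → ∀ {r} → p r ≡ p′ r → ∀ v → p v ≡ p′ v
    solution-unique {p} {p′} {t} s s′ {r} pr v = go (connected r v) pr
      where
      agree-along : ∀ a b c d → a xor b ≡ c xor d → a ≡ c → b ≡ d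
      agree-along false b .false d q refl = q
      agree-along true  b .true  d q refl = Bool.not-injective q
      differences : ∀ d → T (edge d) ≡ true → p (origin d) xor p (target d) ≡ p′ (origin d) xor p′ (target d)
      differences (e , true)  e∈T = trans (s e e∈T) (sym (s′ e e∈T))
      differences (e , false) e∈T = trans (xor-comm (p (end e false)) _)
        (trans (trans (s e e∈T) (sym (s′ e e∈T))) (xor-comm _ (p′ (end e false))))
      go : ∀ {x y} → Star (Step T) x y → p x ≡ p′ x → p y ≡ p′ y
      go ε                              q = q
      go ((d , d∈T , refl , refl) ◅ w) q = go w (agree-along _ (p (target d)) _ (p′ (target d)) (differences d d∈T) q)

-- A reference rotation for the caterpillar-Halin graph

module HalinFrame where

  open import Defs
  open import Data.Bool.Base using (Bool; true; false; not)
  open import Data.Bool.Properties using (T-≡)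
  open import Data.Fin.Base using (Fin; zero; suc; fromℕ; inject₁; punchOut)
  open import Data.Fin.Properties as Fin using (any?; injective⇒≤; punchOut-injective)
  open import Data.Fin.Relation.Unary.Top
      using (View; view; ‵fromℕ; ‵inject₁; view-inject₁; view-fromℕ)
  open import Data.List.Base using ([]; _∷_; _++_; map; length; lookup; filterᵇ; allFin; reverse)
  open import Data.List.Properties using (length-++; length-map; length-reverse; length-tabulate)
  open import Data.List.Membership.Propositional using (_∈_)
  open import Data.List.Membership.Propositional.Properties
      using (∈-++⁺ˡ; ∈-++⁺ʳ; ∈-map⁺; ∈-filter⁺; ∈-allFin)
  open import Data.List.Relation.Unary.Any as Any using (here; there)
  open import Data.List.Relation.Unary.Any.Properties using (lookup-index; reverse⁺)
  open import Data.Nat.Base using (ℕ; zero; suc; _+_)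
  open import Data.Nat.Properties as ℕ using (+-suc)
  open import Data.Product using (∃; _,_)
  open import Data.Sum.Base using (inj₂)
  open import Function.Base using (_∘_; id)
  open import Function.Bundles using (Equivalence)
  open import Function.Definitions using (Injective)
  open import Relation.Binary.PropositionalEquality
  open import Relation.Nullary.Decidable using (yes; no; T?)
  open import Relation.Nullary.Negation.Core using (contradiction)
  open PartialQuotients
  open CubicRotations
  open SpanningTreePotentials

  cyclicPred : ∀ {n} → Fin (suc n) → Fin (suc n)
  cyclicPred {n} zero = fromℕ n
  cyclicPred (suc i)  = inject₁ i

  cyclicSuc-cyclicPred : ∀ {n} (i : Fin (suc n)) → cyclicSuc (cyclicPred i) ≡ i
  cyclicSuc-cyclicPred {n} zero = cyclicSuc-fromℕ n
  cyclicSuc-cyclicPred (suc i)  = cyclicSuc-inject₁ i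

  cyclicPred-cyclicSuc : ∀ {n} (i : Fin (suc n)) → cyclicPred (cyclicSuc i) ≡ i
  cyclicPred-cyclicSuc i with view i
  ... | ‵inject₁ j rewrite cyclicSuc-inject₁ j = refl
  ... | ‵fromℕ {n} rewrite cyclicSuc-fromℕ n = refl

  injective⇒surjective : ∀ {m n} {f : Fin m → Fin n} → m ≡ n → Injective _≡_ _≡_ f → ∀ j → ∃ λ i → f i ≡ j
  injective⇒surjective {suc m} {f = f} refl inj j with any? (λ i → f i Fin.≟ j)
  ... | yes p = p
  ... | no ¬p = contradiction
    (injective⇒≤ {f = λ i → punchOut (avoids i)} (λ q → inj (punchOut-injective (avoids _) (avoids _) q)))
    ℕ.1+n≰n
    where
    avoids : ∀ i → j ≢ f i
    avoids i q = ¬p (i , sym q)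
  injective⇒surjective {zero} refl inj ()

  length-filterᵇ : ∀ {A : Set} (p : A → Bool) xs → length (filterᵇ p xs) + length (filterᵇ (not ∘ p) xs) ≡ length xs
  length-filterᵇ p []       = refl
  length-filterᵇ p (x ∷ xs) with p x
  ... | true  = cong suc (length-filterᵇ p xs)
  ... | false = trans (+-suc _ _) (cong suc (length-filterᵇ p xs))

  module Frame (k : ℕ) (m : ℕ → ℕ) where
    open CaterpillarHalin k m hiding (H)
    open Graph (H k m) using (Dart; origin)

    -- Both ends of the path lie on the rim and have a single path edge, so they are separated from
    -- the other path vertices.
    data VertexView : HVertex → Set where
      start : VertexView (spine zero)
      inner : ∀ a → VertexView (spine (suc (inject₁ a)))
      end   : VertexView (spine (fromℕ (suc ℓ)))
      leaf′ : ∀ a → VertexView (leaf a)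

    spineView : ∀ {w} → View w → VertexView (spine (suc w))
    spineView ‵fromℕ       = end
    spineView (‵inject₁ a) = inner a

    vertexView : ∀ v → VertexView v
    vertexView (spine zero)    = start
    vertexView (spine (suc w)) = spineView (view w)
    vertexView (leaf a)        = leaf′ a

    vertexView-inner : ∀ a → vertexView (spine (suc (inject₁ a))) ≡ inner a
    vertexView-inner a = cong spineView (view-inject₁ a)

    vertexView-end : vertexView (spine (fromℕ (suc ℓ))) ≡ end
    vertexView-end = cong spineView (view-fromℕ ℓ)

    rimVertex : Fin (2 + ℓ) → HVertex
    rimVertex zero          = spine zero
    rimVertex (suc zero)    = spine (fromℕ (suc ℓ))
    rimVertex (suc (suc a)) = leaf a

    rimVertex-injective : Injective _≡_ _≡_ rimVertex
    rimVertex-injective {zero}        {zero}        p    = refl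
    rimVertex-injective {zero}        {suc zero}    ()
    rimVertex-injective {zero}        {suc (suc _)} ()
    rimVertex-injective {suc zero}    {zero}        ()
    rimVertex-injective {suc zero}    {suc zero}    p    = refl
    rimVertex-injective {suc zero}    {suc (suc _)} ()
    rimVertex-injective {suc (suc _)} {zero}        ()
    rimVertex-injective {suc (suc _)} {suc zero}    ()
    rimVertex-injective {suc (suc a)} {suc (suc a)} refl = refl

    length-rim : length rim ≡ 2 + ℓ
    length-rim = cong suc (begin
      length (map leaf upperLeaves ++ spine (fromℕ (suc ℓ)) ∷ map leaf (reverse lowerLeaves))
        ≡⟨ length-++ (map leaf upperLeaves) ⟩
      length (map leaf upperLeaves) + suc (length (map leaf (reverse lowerLeaves)))
        ≡⟨ +-suc _ _ ⟩
      suc (length (map leaf upperLeaves) + length (map leaf (reverse lowerLeaves)))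
        ≡⟨ cong suc (cong₂ _+_ (length-map leaf upperLeaves)
             (trans (length-map leaf (reverse lowerLeaves)) (length-reverse lowerLeaves))) ⟩
      suc (length upperLeaves + length lowerLeaves)
        ≡⟨ cong suc (length-filterᵇ (lookup isUpper) (allFin ℓ)) ⟩
      suc (length (allFin ℓ))
        ≡⟨ cong suc (length-tabulate id) ⟩
      suc ℓ ∎)
      where
      open ≡-Reasoning

    rimVertex∈rim : ∀ r → rimVertex r ∈ rim
    rimVertex∈rim zero       = here refl
    rimVertex∈rim (suc zero) = there (∈-++⁺ʳ (map leaf upperLeaves) (here refl))
    rimVertex∈rim (suc (suc a)) with lookup isUpper a in eq
    ... | true  = there (∈-++⁺ˡ (∈-map⁺ inj₂
      (∈-filter⁺ (T? ∘ lookup isUpper) (∈-allFin a) (Equivalence.from T-≡ eq))))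
    ... | false = there (∈-++⁺ʳ (map leaf upperLeaves) (there (∈-map⁺ inj₂ (reverse⁺
      (∈-filter⁺ (T? ∘ not ∘ lookup isUpper) (∈-allFin a) (Equivalence.from T-≡ (cong not eq)))))))

    position : Fin (2 + ℓ) → Fin (length rim)
    position r = Any.index (rimVertex∈rim r)

    lookup-position : ∀ r → lookup rim (position r) ≡ rimVertex r
    lookup-position r = sym (lookup-index (rimVertex∈rim r))

    -- The rim has 2 + ℓ entries and contains 2 + ℓ distinct vertices. Counting thus shows that none
    -- is repeated, without an analysis of the filtered lists.
    position-surjective : ∀ j → ∃ λ r → position r ≡ j
    position-surjective = injective⇒surjective (sym length-rim) λ {r} {r′} p →
      rimVertex-injective (trans (sym (lookup-position r)) (trans (cong (lookup rim) p) (lookup-position r′)))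

    -- A rim edge carries the position of its first end, so the edge arriving at a vertex carries
    -- the preceding position.
    rimDart : Fin (2 + ℓ) → Fin 2 → Dart
    rimDart r zero       = rimEdge (position r) , true
    rimDart r (suc zero) = rimEdge (cyclicPred (position r)) , false

    -- The order at a path vertex is the same for upper and lower leaves, so in general this is not
    -- the planar rotation. Any reference will do, as the relative twists range over all functions.
    dartAt′ : ∀ {v} → VertexView v → Fin 3 → Dart
    dartAt′ start     zero             = pathEdge zero , true
    dartAt′ start     (suc i)          = rimDart zero i
    dartAt′ (inner a) zero             = pathEdge (inject₁ a) , false
    dartAt′ (inner a) (suc zero)       = pathEdge (suc a) , true
    dartAt′ (inner a) (suc (suc zero)) = leafEdge a , true
    dartAt′ end       zero             = pathEdge (fromℕ ℓ) , false
    dartAt′ end       (suc i)          = rimDart (suc zero) i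
    dartAt′ (leaf′ a) zero             = leafEdge a , false
    dartAt′ (leaf′ a) (suc i)          = rimDart (suc (suc a)) i

    pathSlot : Fin (suc ℓ) → Fin 3
    pathSlot zero    = zero
    pathSlot (suc _) = suc zero

    slot : Dart → Fin 3
    slot (pathEdge i , true)  = pathSlot i
    slot (pathEdge _ , false) = zero
    slot (leafEdge _ , true)  = suc (suc zero)
    slot (leafEdge _ , false) = zero
    slot (rimEdge _  , true)  = suc zero
    slot (rimEdge _  , false) = suc (suc zero)

    origin-rimDart : ∀ r i → origin (rimDart r i) ≡ rimVertex r
    origin-rimDart r zero       = lookup-position r
    origin-rimDart r (suc zero) = trans (cong (lookup rim) (cyclicSuc-cyclicPred (position r))) (lookup-position r)

    slot-rimDart : ∀ r i → slot (rimDart r i) ≡ suc i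
    slot-rimDart r zero       = refl
    slot-rimDart r (suc zero) = refl

    origin-dartAt′ : ∀ {v} (V : VertexView v) i → origin (dartAt′ V i) ≡ v
    origin-dartAt′ start     zero             = refl
    origin-dartAt′ start     (suc i)          = origin-rimDart zero i
    origin-dartAt′ (inner a) zero             = refl
    origin-dartAt′ (inner a) (suc zero)       = refl
    origin-dartAt′ (inner a) (suc (suc zero)) = refl
    origin-dartAt′ end       zero             = refl
    origin-dartAt′ end       (suc i)          = origin-rimDart (suc zero) i
    origin-dartAt′ (leaf′ a) zero             = refl
    origin-dartAt′ (leaf′ a) (suc i)          = origin-rimDart (suc (suc a)) i

    slot-dartAt′ : ∀ {v} (V : VertexView v) i → slot (dartAt′ V i) ≡ i
    slot-dartAt′ start     zero             = refl
    slot-dartAt′ start     (suc i)          = slot-rimDart zero i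
    slot-dartAt′ (inner a) zero             = refl
    slot-dartAt′ (inner a) (suc zero)       = refl
    slot-dartAt′ (inner a) (suc (suc zero)) = refl
    slot-dartAt′ end       zero             = refl
    slot-dartAt′ end       (suc i)          = slot-rimDart (suc zero) i
    slot-dartAt′ (leaf′ a) zero             = refl
    slot-dartAt′ (leaf′ a) (suc i)          = slot-rimDart (suc (suc a)) i

    dartAt : HVertex → Fin 3 → Dart
    dartAt v = dartAt′ (vertexView v)

    dartAt-rim : ∀ r i → dartAt (rimVertex r) (suc i) ≡ rimDart r i
    dartAt-rim zero          i = refl
    dartAt-rim (suc zero)    i = cong (λ V → dartAt′ V (suc i)) vertexView-end
    dartAt-rim (suc (suc a)) i = refl

    dartAt-slot : ∀ d → dartAt (origin d) (slot d) ≡ d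
    dartAt-slot (pathEdge zero    , true)  = refl
    dartAt-slot (pathEdge (suc a) , true)  = cong (λ V → dartAt′ V (suc zero)) (vertexView-inner a)
    dartAt-slot (pathEdge i       , false) with view i
    ... | ‵fromℕ     = refl
    ... | ‵inject₁ a = refl
    dartAt-slot (leafEdge a       , true)  = cong (λ V → dartAt′ V (suc (suc zero))) (vertexView-inner a)
    dartAt-slot (leafEdge a       , false) = refl
    dartAt-slot (rimEdge j        , true)  with r , refl ← position-surjective j =
      trans (cong (λ v → dartAt v (suc zero)) (lookup-position r)) (dartAt-rim r zero)
    dartAt-slot (rimEdge j        , false) with r , p ← position-surjective (cyclicSuc j) = begin
      dartAt (lookup rim (cyclicSuc j)) (suc (suc zero)) ≡⟨ cong (λ i → dartAt (lookup rim i) (suc (suc zero))) p ⟨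
      dartAt (lookup rim (position r)) (suc (suc zero))  ≡⟨ cong (λ v → dartAt v (suc (suc zero))) (lookup-position r) ⟩
      dartAt (rimVertex r) (suc (suc zero))              ≡⟨ dartAt-rim r (suc zero) ⟩
      rimEdge (cyclicPred (position r)) , false          ≡⟨ cong (λ i → rimEdge (cyclicPred i) , false) p ⟩
      rimEdge (cyclicPred (cyclicSuc j)) , false         ≡⟨ cong (λ i → rimEdge i , false) (cyclicPred-cyclicSuc j) ⟩
      rimEdge j , false                                  ∎
      where open ≡-Reasoning

    frame : CubicFrame (H k m)
    frame = record
      { dartAt        = dartAt
      ; slot          = slot
      ; origin-dartAt = origin-dartAt′ ∘ vertexView
      ; slot-dartAt   = slot-dartAt′ ∘ vertexView
      ; dartAt-slot   = dartAt-slot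
      }

-- The sweep along the path

module HalinTraversal where

  open import Defs
  open import Data.Bool.Base using (Bool; true; false; not; if_then_else_; T)
  open import Data.Fin using (Fin; zero; suc; toℕ; fromℕ; inject₁; #_)
  open import Data.Fin.Properties as Fin
      using (toℕ-injective; toℕ-inject₁; toℕ-fromℕ; inject₁-injective; fromℕ≢inject₁)
  open import Data.List.Base using (List; []; _∷_; map; length; lookup)
  open import Data.List.Relation.Unary.All using (All; []; _∷_)
  open import Data.List.Relation.Unary.All.Properties using (++⁺; ++⁻ˡ; ++⁻ʳ)
  open import Data.List.Relation.Unary.Linked using (_∷_)
  open import Data.Nat.Base using (ℕ; zero; suc; _+_; _*_; _<_; s≤s)
  open import Data.Nat.Properties as ℕ using (+-suc)
  open import Data.Nat.Tactic.RingSolver using (solve-∀)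
  open import Data.Product using (_×_; _,_; proj₁; proj₂)
  open import Data.Sum.Properties using (inj₁-injective; inj₂-injective)
  open import Data.Vec.Base as Vec using (Vec; []; _∷_)
  open import Data.Vec.Relation.Unary.All as VecAll using ([]; _∷_)
  open import Data.Vec.Relation.Unary.All.Properties using (lookup⁺)
  open import Function.Base using (_∘_)
  open import Function.Bundles using (mk⇔; Equivalence)
  open import Relation.Binary.PropositionalEquality
  open PartialQuotients
  open FaceAutomaton
  open WordCounts
  open CubicRotations
  open SpanningTreePotentials
  open HalinFrame

  toWord : ∀ bs → (Fin (length bs) → Letter) → Letter → Word bs
  toWord []       f l = l
  toWord (b ∷ bs) f l = f zero , toWord bs (f ∘ suc) l

  Pattern-resp : ∀ {X : Set} {R : X → X → Set} {n k} {Q : Partial R n} {xs : Vec X k} {L L′ : Vec ℕ k} →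
                 SamePartition L L′ → Pattern R Q xs L → Pattern R Q xs L′
  Pattern-resp same pat a b = mk⇔ (proj₁ (same a b) ∘ Equivalence.to (pat a b))
                                  (Equivalence.from (pat a b) ∘ proj₂ (same a b))

  module Traversal (k : ℕ) (m : ℕ → ℕ) where
    open CaterpillarHalin k m hiding (H)
    open Graph (H k m) using (Edge; Dart; origin)
    open Frame k m using (frame)

    private
      N : ℕ
      N = length rim

    endV : HVertex
    endV = spine (fromℕ (suc ℓ))

    innerV : Fin ℓ → HVertex
    innerV a = spine (suc (inject₁ a))

    inner-injective : ∀ {a a′} → innerV a ≡ innerV a′ → a ≡ a′
    inner-injective = inject₁-injective ∘ Fin.suc-injective ∘ inj₁-injective

    inner≢end : ∀ {a} → innerV a ≢ endV
    inner≢end = fromℕ≢inject₁ ∘ sym ∘ Fin.suc-injective ∘ inj₁-injective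

    JoinsOnRim : Fin N → HVertex → HVertex → Set
    JoinsOnRim j u v = lookup rim j ≡ u × lookup rim (cyclicSuc j) ≡ v

    -- js lists the rim edges in the order in which a traversal of the graph
    -- along the path completes them;  cu and cl are the last visited upper and
    -- lower vertices of the rim.
    Walk : HVertex → HVertex → (bs : List Bool) → (Fin (length bs) → Fin ℓ) →
           (Fin (length bs) → Fin N) → Fin N → Fin N → Set
    Walk cu cl []       ι js ju jl = JoinsOnRim ju cu endV × JoinsOnRim jl endV cl
    Walk cu cl (b ∷ bs) ι js ju jl =
      JoinsOnRim (js zero) (if b then cu else leaf (ι zero)) (if b then leaf (ι zero) else cl) ×
      Walk (if b then leaf (ι zero) else cu) (if b then cl else leaf (ι zero)) bs (ι ∘ suc) (js ∘ suc) ju jl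

    module _ (t : Edge → Bool) where

      R : Corner frame → Corner frame → Set
      R = Glued frame t

      Along : (Corner frame → Corner frame → Set) → Edge → Set
      Along S e = ∀ s → S (cornerOf frame (e , true) s) (cornerOf frame (e , false) (agree (not (t e)) (not s)))

      module _ {k} (S : Corner frame → Corner frame → Set) e (xs : Vec (Corner frame) k) {p p′ q q′ : Fin k}
               (p≡  : Vec.lookup xs p  ≡ cornerOf frame (e , true)  true)
               (p′≡ : Vec.lookup xs p′ ≡ cornerOf frame (e , true)  false)
               (q≡  : Vec.lookup xs q  ≡ cornerOf frame (e , false) true)
               (q′≡ : Vec.lookup xs q′ ≡ cornerOf frame (e , false) false) where

        along⇒glue : Along S e → All (λ (a , b) → S (Vec.lookup xs a) (Vec.lookup xs b)) (glue p p′ q q′ (t e))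
        along⇒glue r with t e | r true | r false
        ... | true  | r₁ | r₂ = subst₂ S (sym p≡) (sym q≡) r₁ ∷ subst₂ S (sym p′≡) (sym q′≡) r₂ ∷ []
        ... | false | r₁ | r₂ = subst₂ S (sym p≡) (sym q′≡) r₁ ∷ subst₂ S (sym p′≡) (sym q≡) r₂ ∷ []

        glue⇒along : All (λ (a , b) → S (Vec.lookup xs a) (Vec.lookup xs b)) (glue p p′ q q′ (t e)) → Along S e
        glue⇒along r s with t e
        glue⇒along (r₁ ∷ r₂ ∷ []) true  | true  = subst₂ S p≡ q≡ r₁
        glue⇒along (r₁ ∷ r₂ ∷ []) false | true  = subst₂ S p′≡ q′≡ r₂
        glue⇒along (r₁ ∷ r₂ ∷ []) true  | false = subst₂ S p≡ q′≡ r₁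
        glue⇒along (r₁ ∷ r₂ ∷ []) false | false = subst₂ S p′≡ q≡ r₂

      Identified : ∀ {n} → Partial R n → Corner frame → Corner frame → Set
      Identified Q x y = Partial.class Q x ≡ Partial.class Q y

      Done : ∀ {n} → Partial R n → Edge → Set
      Done Q = Along (Identified Q)

      -- The rim is oriented: the pending edge leaves `cu`, at slot 1, but enters `cl`, at slot 2.
      -- The corner numbers are the two sides of these slots.
      boundary : Fin (suc ℓ) → HVertex → HVertex → Vec (Corner frame) 6
      boundary pe cu cl = cornerOf frame (pathEdge pe , true) true ∷ cornerOf frame (pathEdge pe , true) false ∷
                          (cu , # 1) ∷ (cu , # 0) ∷ (cl , # 2) ∷ (cl , # 1) ∷ []

      record Untouched {n} (Q : Partial R n) (pe : Fin (suc ℓ)) (cu cl v : HVertex) : Set where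
        field
          fresh : ∀ i → Fresh R Q (v , i)
          ≢pe   : spine (inject₁ pe) ≢ v
          ≢cu   : cu ≢ v
          ≢cl   : cl ≢ v

      boundary-avoids : ∀ {n} {Q : Partial R n} {pe cu cl v} → Untouched Q pe cu cl v →
                        VecAll.All (λ x → proj₁ x ≢ v) (boundary pe cu cl)
      boundary-avoids u = ≢pe ∷ ≢pe ∷ ≢cu ∷ ≢cu ∷ ≢cl ∷ ≢cl ∷ []
        where open Untouched u

      Pattern-vertex : ∀ {n k v} {Q : Partial R n} {xs : Vec (Corner frame) k} {L : Vec ℕ k} l →
        (∀ i → Fresh R Q (v , i)) → VecAll.All (λ x → proj₁ x ≢ v) xs → (∀ a → Vec.lookup L a < l) →
        Pattern R Q xs L → Pattern R Q ((v , # 0) ∷ (v , # 1) ∷ (v , # 2) ∷ xs) (l ∷ suc l ∷ suc (suc l) ∷ L)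
      Pattern-vertex {v = v} {Q} {xs} {L} l f ∉xs bound pat =
        Pattern-∷ R {Q = Q} (f (# 0)) 0∉ l∉ (Pattern-∷ R {Q = Q} (f (# 1)) 1∉ l+1∉
          (Pattern-∷ R {Q = Q} (f (# 2)) (λ a q → lookup⁺ ∉xs a (cong proj₁ q)) l+2∉ pat))
        where
        1∉ : ∀ a → Vec.lookup ((v , # 2) ∷ xs) a ≢ (v , # 1)
        1∉ zero    ()
        1∉ (suc a) q = lookup⁺ ∉xs a (cong proj₁ q)
        0∉ : ∀ a → Vec.lookup ((v , # 1) ∷ (v , # 2) ∷ xs) a ≢ (v , # 0)
        0∉ zero    ()
        0∉ (suc zero) ()
        0∉ (suc (suc a)) q = lookup⁺ ∉xs a (cong proj₁ q)
        l+2∉ : ∀ a → Vec.lookup L a ≢ suc (suc l)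
        l+2∉ a q = ℕ.<⇒≢ (ℕ.m<n⇒m<1+n (ℕ.m<n⇒m<1+n (bound a))) q
        l+1∉ : ∀ a → Vec.lookup (suc (suc l) ∷ L) a ≢ suc l
        l+1∉ zero    q = ℕ.<⇒≢ ℕ.≤-refl (sym q)
        l+1∉ (suc a) q = ℕ.<⇒≢ (ℕ.m<n⇒m<1+n (bound a)) q
        l∉ : ∀ a → Vec.lookup (suc l ∷ suc (suc l) ∷ L) a ≢ l
        l∉ zero          q = ℕ.<⇒≢ ℕ.≤-refl (sym q)
        l∉ (suc zero)    q = ℕ.<⇒≢ (ℕ.m<n⇒m<1+n ℕ.≤-refl) (sym q)
        l∉ (suc (suc a)) q = ℕ.<⇒≢ (bound a) q

      rim-corner : ∀ j {u} → lookup rim j ≡ u → ∀ s → (u , side s (# 1)) ≡ cornerOf frame (rimEdge j , true) s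
      rim-corner j refl s = refl

      rim-corner′ : ∀ j {u} → lookup rim (cyclicSuc j) ≡ u → ∀ s → (u , side s (# 2)) ≡ cornerOf frame (rimEdge j , false) s
      rim-corner′ j refl s = refl

      letter : Fin ℓ → Fin N → Letter
      letter a j = t (pathEdge (inject₁ a)) , t (leafEdge a) , t (rimEdge j)

      record Advanced {n} (Q : Partial R n) (b : Bool) (a : Fin ℓ) (j : Fin N) (cu cl : HVertex) (s : State) : Set where
        field
          {size}    : ℕ
          quotient  : Partial R size
          coarser   : _⊑_ R Q quotient
          count     : size + 6 ≡ n + closed b s (letter a j)
          labelling  : Pattern R quotient
                        (boundary (suc a) (if b then leaf a else cu) (if b then cl else leaf a))
                        (corners (δ b s (letter a j)))
          path-done : Done quotient (pathEdge (inject₁ a))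
          leaf-done : Done quotient (leafEdge a)
          rim-done  : Done quotient (rimEdge j)
          untouched : ∀ {v} → Untouched Q (inject₁ a) cu cl v → innerV a ≢ v → leaf a ≢ v →
                      Untouched quotient (suc a) (if b then leaf a else cu) (if b then cl else leaf a) v

      -- The six corners of the path vertex and the leaf enter as singletons, three edges contribute
      -- six gluings, and the new boundary is read off at `stepBoundary`, where `corners-δ`
      -- recognises the next state.
      advance : ∀ {n} (Q : Partial R n) b a j {cu cl} s →
                Pattern R Q (boundary (inject₁ a) cu cl) (corners s) →
                Untouched Q (inject₁ a) cu cl (innerV a) → Untouched Q (inject₁ a) cu cl (leaf a) →
                JoinsOnRim j (if b then cu else leaf a) (if b then leaf a else cl) →
                Advanced Q b a j cu cl s
      advance {n} Q b a j {cu} {cl} s pat uᵢ uₗ (j-from , j-to) = record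
        { quotient  = M.quotient
        ; coarser   = M.coarser
        ; count     = trans (cong (M.size +_) (sym (length-stepGlue b (letter a j)))) M.count
        ; labelling  = next-pattern b (corners (δ b s (letter a j))) (Pattern-resp {Q = M.quotient}
                        {xs = Vec.map (Vec.lookup xs) (stepBoundary b)} {L = stepCorners b s (letter a j)} {L′ = corners (δ b s (letter a j))}
                        (corners-δ b s (letter a j))
                        (Pattern-map R {Q = M.quotient} {xs} {mergeLabels (stepGlue b (letter a j)) (stepLabels s)}
                                     (stepBoundary b) M.labelling))
        ; path-done = glue⇒along (Identified M.quotient) (pathEdge (inject₁ a)) xs refl refl refl refl (++⁻ˡ (glue (# 6) (# 7) (# 0) (# 2) _) M.merged)
        ; leaf-done = glue⇒along (Identified M.quotient) (leafEdge a) xs refl refl refl refl (++⁻ˡ (glue (# 2) (# 1) (# 3) (# 5) _)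
                        (++⁻ʳ (glue (# 6) (# 7) (# 0) (# 2) _) M.merged))
        ; rim-done  = proj₂ (rim-glue b j-from j-to (Identified M.quotient)) (++⁻ʳ (glue (# 2) (# 1) (# 3) (# 5) _)
                        (++⁻ʳ (glue (# 6) (# 7) (# 0) (# 2) _) M.merged))
        ; untouched = untouched b
        }
        where
        xs : Vec (Corner frame) 12
        xs = (innerV a , # 0) ∷ (innerV a , # 1) ∷ (innerV a , # 2) ∷
             (leaf a , # 0) ∷ (leaf a , # 1) ∷ (leaf a , # 2) ∷ boundary (inject₁ a) cu cl

        pattern₀ : Pattern R Q xs (stepLabels s)
        pattern₀ = Pattern-vertex {Q = Q} 9 (Untouched.fresh uᵢ)
          ((λ ()) ∷ (λ ()) ∷ (λ ()) ∷ boundary-avoids uᵢ)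
          (λ { zero → ℕ.m<n⇒m<1+n (ℕ.m<n⇒m<1+n ℕ.≤-refl)
             ; (suc zero) → ℕ.m<n⇒m<1+n ℕ.≤-refl
             ; (suc (suc zero)) → ℕ.≤-refl
             ; (suc (suc (suc a))) → ℕ.m<n⇒m<1+n (ℕ.m<n⇒m<1+n (ℕ.m<n⇒m<1+n (corners-bound s a))) })
          (Pattern-vertex {Q = Q} 6 (Untouched.fresh uₗ) (boundary-avoids uₗ) (corners-bound s) pat)

        rimGlue : Bool → Bool → List (Fin 12 × Fin 12)
        rimGlue b z = if b then glue (# 8) (# 9) (# 5) (# 4) z else glue (# 4) (# 3) (# 10) (# 11) z

        rim-glue : ∀ b → lookup rim j ≡ (if b then cu else leaf a) →
                   lookup rim (cyclicSuc j) ≡ (if b then leaf a else cl) →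
                   ∀ S → let All-S = All (λ (a , b) → S (Vec.lookup xs a) (Vec.lookup xs b)) (rimGlue b (t (rimEdge j))) in
                   (Along S (rimEdge j) → All-S) × (All-S → Along S (rimEdge j))
        rim-glue true  p q S =
            along⇒glue S (rimEdge j) xs (rim-corner j p true) (rim-corner j p false) (rim-corner′ j q true) (rim-corner′ j q false)
          , glue⇒along S (rimEdge j) xs (rim-corner j p true) (rim-corner j p false) (rim-corner′ j q true) (rim-corner′ j q false)
        rim-glue false p q S =
            along⇒glue S (rimEdge j) xs (rim-corner j p true) (rim-corner j p false) (rim-corner′ j q true) (rim-corner′ j q false)
          , glue⇒along S (rimEdge j) xs (rim-corner j p true) (rim-corner j p false) (rim-corner′ j q true) (rim-corner′ j q false)

        M : MergedAll R Q xs (stepGlue b (letter a j)) (stepLabels s)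
        M = mergeAll R Q xs (stepGlue b (letter a j)) (stepLabels s) pattern₀
          (++⁺ (along⇒glue R (pathEdge (inject₁ a)) xs refl refl refl refl (λ s → glued (pathEdge (inject₁ a)) s))
          (++⁺ (along⇒glue R (leafEdge a) xs refl refl refl refl (λ s → glued (leafEdge a) s))
               (proj₁ (rim-glue b j-from j-to R) (λ s → glued (rimEdge j) s))))
        module M = MergedAll M

        length-stepGlue : ∀ b l → length (stepGlue b l) ≡ 6
        length-stepGlue true  _ = refl
        length-stepGlue false _ = refl

        next-pattern : ∀ b L → Pattern R M.quotient (Vec.map (Vec.lookup xs) (stepBoundary b)) L →
          Pattern R M.quotient (boundary (suc a) (if b then leaf a else cu) (if b then cl else leaf a)) L
        next-pattern true  L p = p
        next-pattern false L p = p

        untouched : ∀ b {v} → Untouched Q (inject₁ a) cu cl v → innerV a ≢ v → leaf a ≢ v →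
          Untouched M.quotient (suc a) (if b then leaf a else cu) (if b then cl else leaf a) v
        untouched b {v} u inner≢ leaf≢ = record
          { fresh = λ i → M.fresh (λ c q → lookup⁺ xs-avoid c (cong proj₁ q)) (Untouched.fresh u i)
          ; ≢pe   = inner≢
          ; ≢cu   = ≢cu b
          ; ≢cl   = ≢cl b
          }
          where
          xs-avoid : VecAll.All (λ x → proj₁ x ≢ v) xs
          xs-avoid = inner≢ ∷ inner≢ ∷ inner≢ ∷ leaf≢ ∷ leaf≢ ∷ leaf≢ ∷ boundary-avoids u
          ≢cu : ∀ b → (if b then leaf a else cu) ≢ v
          ≢cu true  = leaf≢
          ≢cu false = Untouched.≢cu u
          ≢cl : ∀ b → (if b then cl else leaf a) ≢ v
          ≢cl true  = Untouched.≢cl u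
          ≢cl false = leaf≢

      word : ∀ bs (ι : Fin (length bs) → Fin ℓ) (js : Fin (length bs) → Fin N) → Fin N → Fin N → Word bs
      word bs ι js ju jl = toWord bs (λ i → letter (ι i) (js i))
        (t (pathEdge (fromℕ ℓ)) , t (rimEdge ju) , t (rimEdge jl))

      record Traversed {n} (Q : Partial R n) bs (ι : Fin (length bs) → Fin ℓ) js ju jl s : Set where
        field
          {size}         : ℕ
          quotient       : Partial R size
          coarser        : _⊑_ R Q quotient
          count          : size + 6 * suc (length bs) ≡ n + faceCount s bs (word bs ι js ju jl)
          path-done      : ∀ i → Done quotient (pathEdge (inject₁ (ι i)))
          leaf-done      : ∀ i → Done quotient (leafEdge (ι i))
          rim-done       : ∀ i → Done quotient (rimEdge (js i))
          last-path-done : Done quotient (pathEdge (fromℕ ℓ))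
          upper-done     : Done quotient (rimEdge ju)
          lower-done     : Done quotient (rimEdge jl)

      -- The induction runs over suffixes of `isUpper`, while the leaves keep their indices in the
      -- whole graph; `ι` mediates between the two.
      traverse : ∀ bs ι js ju jl {pe cu cl} s {n} (Q : Partial R n) →
                 Pattern R Q (boundary pe cu cl) (corners s) → Walk cu cl bs ι js ju jl →
                 (∀ i → toℕ (ι i) ≡ toℕ pe + toℕ i) → toℕ pe + length bs ≡ ℓ →
                 (∀ i → Untouched Q pe cu cl (innerV (ι i))) → (∀ i → Untouched Q pe cu cl (leaf (ι i))) →
                 Untouched Q pe cu cl endV →
                 Traversed Q bs ι js ju jl s
      traverse [] ι js ju jl {pe} {cu} {cl} s Q pat ((ju-from , ju-to) , (jl-from , jl-to)) ι≡ pe+0≡ℓ _ _ uₑ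
        -- With no leaf left, the pending path edge has index ℓ and is the one ending at `v_{ℓ+1}`.
        with refl ← toℕ-injective {i = pe} {j = fromℕ ℓ}
                      (trans (sym (ℕ.+-identityʳ (toℕ pe))) (trans pe+0≡ℓ (sym (toℕ-fromℕ ℓ)))) = record
        { quotient       = M.quotient
        ; coarser        = M.coarser
        ; count          = M.count
        ; path-done      = λ ()
        ; leaf-done      = λ ()
        ; rim-done       = λ ()
        ; last-path-done = glue⇒along (Identified M.quotient) (pathEdge (fromℕ ℓ)) xs refl refl refl refl (++⁻ˡ (glue (# 3) (# 4) (# 0) (# 2) _) M.merged)
        ; upper-done     = glue⇒along (Identified M.quotient) (rimEdge ju) xs (rim-corner ju ju-from true) (rim-corner ju ju-from false)
                             (rim-corner′ ju ju-to true) (rim-corner′ ju ju-to false)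
                             (++⁻ˡ (glue (# 5) (# 6) (# 2) (# 1) _) (++⁻ʳ (glue (# 3) (# 4) (# 0) (# 2) _) M.merged))
        ; lower-done     = glue⇒along (Identified M.quotient) (rimEdge jl) xs (rim-corner jl jl-from true) (rim-corner jl jl-from false)
                             (rim-corner′ jl jl-to true) (rim-corner′ jl jl-to false)
                             (++⁻ʳ (glue (# 5) (# 6) (# 2) (# 1) _) (++⁻ʳ (glue (# 3) (# 4) (# 0) (# 2) _) M.merged))
        }
        where
        xs : Vec (Corner frame) 9
        xs = (endV , # 0) ∷ (endV , # 1) ∷ (endV , # 2) ∷ boundary (fromℕ ℓ) cu cl

        l : Letter
        l = t (pathEdge (fromℕ ℓ)) , t (rimEdge ju) , t (rimEdge jl)

        M : MergedAll R Q xs (lastGlue l) (lastLabels s)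
        M = mergeAll R Q xs (lastGlue l) (lastLabels s)
          (Pattern-vertex {Q = Q} 6 (Untouched.fresh uₑ) (boundary-avoids uₑ) (corners-bound s) pat)
          (++⁺ (along⇒glue R (pathEdge (fromℕ ℓ)) xs refl refl refl refl (λ s → glued (pathEdge (fromℕ ℓ)) s))
          (++⁺ (along⇒glue R (rimEdge ju) xs (rim-corner ju ju-from true) (rim-corner ju ju-from false)
                  (rim-corner′ ju ju-to true) (rim-corner′ ju ju-to false) (λ s → glued (rimEdge ju) s))
               (along⇒glue R (rimEdge jl) xs (rim-corner jl jl-from true) (rim-corner jl jl-from false)
                  (rim-corner′ jl jl-to true) (rim-corner′ jl jl-to false) (λ s → glued (rimEdge jl) s))))
        module M = MergedAll M
      traverse (b ∷ bs) ι js ju jl {pe} {cu} {cl} s {n} Q pat (j-joins , walk) ι≡ pe+l≡ℓ uᵢ uₗ uₑ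
        with refl ← toℕ-injective {i = pe} {j = inject₁ (ι zero)}
                      (trans (sym (ℕ.+-identityʳ (toℕ pe))) (trans (sym (ι≡ zero)) (sym (toℕ-inject₁ (ι zero))))) = record
        { quotient       = T.quotient
        ; coarser        = T.coarser ∘ A.coarser
        ; count          = count
        ; path-done      = λ { zero → λ s → T.coarser (A.path-done s) ; (suc i) → T.path-done i }
        ; leaf-done      = λ { zero → λ s → T.coarser (A.leaf-done s) ; (suc i) → T.leaf-done i }
        ; rim-done       = λ { zero → λ s → T.coarser (A.rim-done s) ; (suc i) → T.rim-done i }
        ; last-path-done = T.last-path-done
        ; upper-done     = T.upper-done
        ; lower-done     = T.lower-done
        }
        where
        a = ι zero
        l = letter a (js zero)
        module A = Advanced (advance Q b a (js zero) s pat (uᵢ zero) (uₗ zero) j-joins)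

        ι≡′ : ∀ i → toℕ (ι (suc i)) ≡ suc (toℕ a) + toℕ i
        ι≡′ i = trans (ι≡ (suc i)) (trans (+-suc _ _) (cong (λ c → suc (c + toℕ i)) (toℕ-inject₁ a)))

        a≢ : ∀ i → a ≢ ι (suc i)
        a≢ i q = ℕ.<⇒≢ (s≤s (ℕ.m≤m+n (toℕ a) (toℕ i))) (trans (cong toℕ q) (ι≡′ i))

        module T = Traversed (traverse bs (ι ∘ suc) (js ∘ suc) ju jl {suc a} (δ b s l) A.quotient A.labelling walk
          ι≡′ (trans (sym (trans (+-suc _ _) (cong (λ c → suc (c + length bs)) (toℕ-inject₁ a)))) pe+l≡ℓ)
          (λ i → A.untouched (uᵢ (suc i)) (λ q → a≢ i (inner-injective q)) (λ ()))
          (λ i → A.untouched (uₗ (suc i)) (λ ()) (λ q → a≢ i (inj₂-injective q)))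
          (A.untouched uₑ inner≢end (λ ())))

        count : T.size + 6 * suc (suc (length bs)) ≡ n + faceCount s (b ∷ bs) (word (b ∷ bs) ι js ju jl)
        count = begin
          T.size + 6 * suc (suc (length bs))       ≡⟨ eq T.size (length bs) ⟩
          (T.size + 6 * suc (length bs)) + 6       ≡⟨ cong (_+ 6) T.count ⟩
          (A.size + f) + 6                         ≡⟨ eq′ A.size f ⟩
          (A.size + 6) + f                         ≡⟨ cong (_+ f) A.count ⟩
          (n + closed b s l) + f                   ≡⟨ ℕ.+-assoc n _ f ⟩
          n + (closed b s l + f)                   ∎
          where
          open ≡-Reasoning
          f = faceCount (δ b s l) bs (word bs (ι ∘ suc) (js ∘ suc) ju jl)
          eq : ∀ x y → x + 6 * suc (suc y) ≡ (x + 6 * suc y) + 6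
          eq = solve-∀
          eq′ : ∀ x y → (x + y) + 6 ≡ (x + 6) + y
          eq′ = solve-∀

-- Relative twistings as words

module TwistEncoding where

  open import Defs
  open import Data.Bool.Base using (Bool; true; false; not; if_then_else_)
  open import Data.Fin using (Fin; zero; suc; fromℕ; inject₁)
  open import Data.Fin.Relation.Unary.Top
      using (View; view; ‵fromℕ; ‵inject₁; view-inject₁; view-fromℕ)
  open import Data.List.Base
      using ([]; _∷_; _++_; map; length; lookup; filterᵇ; tabulate; reverse; _∷ʳ_)
  open import Data.List.Properties using (++-assoc; map-++; unfold-reverse)
  open import Data.List.Relation.Unary.Linked using (Linked; [-]; _∷_)
  open import Data.Nat.Base using (ℕ; zero; suc; _+_)
  open import Data.Product using (∃; ∃₂; _×_; _,_; proj₁; proj₂)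
  open import Data.Sum.Base using (inj₂)
  open import Data.Vec.Base using ([]; _∷_)
  open import Function.Base using (_∘_; id)
  open import Relation.Binary.PropositionalEquality
  open PartialQuotients
  open FaceAutomaton
  open WordCounts
  open CubicRotations
  open SpanningTreePotentials
  open HalinFrame
  open HalinTraversal

  linked-∷ʳ : ∀ {A : Set} {R : A → A → Set} y ys z →
    (∀ j → R (lookup (y ∷ ys) (inject₁ j)) (lookup (y ∷ ys) (suc j))) →
    R (lookup (y ∷ ys) (fromℕ (length ys))) z → Linked R (y ∷ ys ++ z ∷ [])
  linked-∷ʳ y []        z consecutive last = last ∷ [-]
  linked-∷ʳ y (y′ ∷ ys) z consecutive last =
    consecutive zero ∷ linked-∷ʳ y′ ys z (λ j → consecutive (suc j)) last

  linked-unsnoc : ∀ {A : Set} {R : A → A → Set} xs {y z} →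
                  Linked R (xs ++ y ∷ z ∷ []) → Linked R (xs ++ y ∷ []) × R y z
  linked-unsnoc []            (r ∷ [-]) = [-] , r
  linked-unsnoc (x ∷ [])      (r ∷ rs)  = let rs′ , q = linked-unsnoc [] rs in r ∷ rs′ , q
  linked-unsnoc (x ∷ x′ ∷ xs) (r ∷ rs)  = let rs′ , q = linked-unsnoc (x′ ∷ xs) rs in r ∷ rs′ , q

  letterAt : ∀ bs → Word bs → Fin (length bs) → Letter
  letterAt (b ∷ bs) (l , w) zero    = l
  letterAt (b ∷ bs) (l , w) (suc i) = letterAt bs w i

  lastLetter : ∀ bs → Word bs → Letter
  lastLetter []       l       = l
  lastLetter (b ∷ bs) (l , w) = lastLetter bs w

  letterAt-toWord : ∀ bs f l i → letterAt bs (toWord bs f l) i ≡ f i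
  letterAt-toWord (b ∷ bs) f l zero    = refl
  letterAt-toWord (b ∷ bs) f l (suc i) = letterAt-toWord bs (f ∘ suc) l i

  lastLetter-toWord : ∀ bs f l → lastLetter bs (toWord bs f l) ≡ l
  lastLetter-toWord []       f l = refl
  lastLetter-toWord (b ∷ bs) f l = lastLetter-toWord bs (f ∘ suc) l

  toWord-letterAt : ∀ bs {f} w → (∀ i → f i ≡ letterAt bs w i) → toWord bs f (lastLetter bs w) ≡ w
  toWord-letterAt []       w       f≗ = refl
  toWord-letterAt (b ∷ bs) (l , w) f≗ = cong₂ _,_ (f≗ zero) (toWord-letterAt bs w (f≗ ∘ suc))

  toWord-cong : ∀ bs {f g l l′} → (∀ i → f i ≡ g i) → l ≡ l′ → toWord bs f l ≡ toWord bs g l′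
  toWord-cong []       f≗g l≡ = l≡
  toWord-cong (b ∷ bs) f≗g l≡ = cong₂ _,_ (f≗g zero) (toWord-cong bs (f≗g ∘ suc) l≡)

  module Encoding (k : ℕ) (m : ℕ → ℕ) where
    open CaterpillarHalin k m hiding (H)
    open Graph (H k m) using (Edge)
    open Frame k m using (frame; length-rim)
    open Traversal k m

    infix 4 _⟶_
    _⟶_ : HVertex → HVertex → Set
    u ⟶ v = ∃ λ j → JoinsOnRim j u v

    -- The cycle is cut open at `v_0`, which is repeated at the end: it is the first vertex of the
    -- upper side and of the lower side alike.
    rim-linked : Linked _⟶_ (rim ++ spine zero ∷ [])
    rim-linked = linked-∷ʳ {R = _⟶_} _ _ _
      (λ j → inject₁ j , refl , cong (lookup rim) (cyclicSuc-inject₁ j))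
      (fromℕ _ , refl , cong (lookup rim) (cyclicSuc-fromℕ _))

    walk : ∀ bs (ι : Fin (length bs) → Fin ℓ) {cu cl} → (∀ i → lookup isUpper (ι i) ≡ lookup bs i) →
           Linked _⟶_ (cu ∷ map leaf (filterᵇ (lookup isUpper) (tabulate ι)) ++
                       endV ∷ map leaf (reverse (filterᵇ (not ∘ lookup isUpper) (tabulate ι))) ++ cl ∷ []) →
           ∃ λ js → ∃₂ λ ju jl → Walk cu cl bs ι js ju jl
    walk [] ι p ((ju , ju-joins) ∷ (jl , jl-joins) ∷ [-]) = (λ ()) , ju , jl , ju-joins , jl-joins
    walk (true ∷ bs) ι {cu} {cl} p linked rewrite p zero with (j , j-joins) ∷ rest ← linked =
      let js , ju , jl , w = walk bs (ι ∘ suc) (p ∘ suc) rest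
      in (λ { zero → j ; (suc i) → js i }) , ju , jl , j-joins , w
    walk (false ∷ bs) ι {cu} {cl} p linked rewrite p zero =
      let js , ju , jl , w = walk bs (ι ∘ suc) (p ∘ suc) (subst (Linked _⟶_) (++-assoc (cu ∷ us) (endV ∷ map leaf (reverse ls)) _) (proj₁ split))
      in (λ { zero → proj₁ (proj₂ split) ; (suc i) → js i }) , ju , jl , proj₂ (proj₂ split) , w
      where
      us = map leaf (filterᵇ (lookup isUpper) (tabulate (ι ∘ suc)))
      ls = filterᵇ (not ∘ lookup isUpper) (tabulate (ι ∘ suc))
      regroup : cu ∷ us ++ endV ∷ map leaf (reverse (ι zero ∷ ls)) ++ cl ∷ []
              ≡ (cu ∷ us ++ endV ∷ map leaf (reverse ls)) ++ leaf (ι zero) ∷ cl ∷ []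
      regroup = begin
        cu ∷ us ++ endV ∷ map leaf (reverse (ι zero ∷ ls)) ++ cl ∷ []
          ≡⟨ cong (λ xs → cu ∷ us ++ endV ∷ map leaf xs ++ cl ∷ []) (unfold-reverse (ι zero) ls) ⟩
        cu ∷ us ++ endV ∷ map leaf (reverse ls ∷ʳ ι zero) ++ cl ∷ []
          ≡⟨ cong (λ xs → cu ∷ us ++ endV ∷ xs ++ cl ∷ []) (map-++ leaf (reverse ls) (ι zero ∷ [])) ⟩
        cu ∷ us ++ endV ∷ (map leaf (reverse ls) ++ leaf (ι zero) ∷ []) ++ cl ∷ []
          ≡⟨ cong (λ xs → cu ∷ us ++ endV ∷ xs) (++-assoc (map leaf (reverse ls)) _ _) ⟩
        cu ∷ us ++ endV ∷ map leaf (reverse ls) ++ leaf (ι zero) ∷ cl ∷ []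
          ≡⟨ ++-assoc (cu ∷ us) (endV ∷ map leaf (reverse ls)) _ ⟨
        (cu ∷ us ++ endV ∷ map leaf (reverse ls)) ++ leaf (ι zero) ∷ cl ∷ [] ∎
        where open ≡-Reasoning
      split = linked-unsnoc (cu ∷ us ++ endV ∷ map leaf (reverse ls)) (subst (Linked _⟶_) regroup linked)

    opaque
      full-walk : ∃ λ js → ∃₂ λ ju jl → Walk (spine zero) (spine zero) isUpper id js ju jl
      full-walk = walk isUpper id (λ _ → refl) (subst (Linked _⟶_)
        (++-assoc (spine zero ∷ map leaf upperLeaves) (endV ∷ map leaf (reverse lowerLeaves)) _) rim-linked)

    rimEdgeAt : Fin ℓ → Fin (length rim)
    rimEdgeAt = proj₁ full-walk

    upperEnd lowerEnd : Fin (length rim)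
    upperEnd = proj₁ (proj₂ full-walk)
    lowerEnd = proj₁ (proj₂ (proj₂ full-walk))

    rimEdgeOf : Fin (2 + ℓ) → Fin (length rim)
    rimEdgeOf zero          = upperEnd
    rimEdgeOf (suc zero)    = lowerEnd
    rimEdgeOf (suc (suc a)) = rimEdgeAt a

    isLower : HVertex → Bool
    isLower (spine zero)    = false
    isLower (spine (suc _)) = true
    isLower (leaf a)        = not (lookup isUpper a)

    leafOr : Fin (2 + ℓ) → HVertex → Fin (2 + ℓ)
    leafOr d (spine _) = d
    leafOr d (leaf a)  = suc (suc a)

    -- Upper rim edges are named by the vertex they lead to, lower ones by the
    -- vertex they come from.
    key : Fin (length rim) → Fin (2 + ℓ)
    key j = if isLower (lookup rim j) then leafOr (suc zero) (lookup rim j)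
                                      else leafOr zero (lookup rim (cyclicSuc j))

    -- The keys are pairwise distinct, so the walk meets no rim edge twice, and by counting it meets
    -- them all.
    walk-keys : ∀ bs ι {cu cl js ju jl} → (∀ i → lookup isUpper (ι i) ≡ lookup bs i) → isLower cu ≡ false →
                Walk cu cl bs ι js ju jl →
                (∀ i → key (js i) ≡ suc (suc (ι i))) × key ju ≡ zero × key jl ≡ suc zero
    walk-keys [] ι p cu-upper ((ju-from , ju-to) , (jl-from , jl-to))
      rewrite ju-from | ju-to | jl-from | cu-upper = (λ ()) , refl , refl
    walk-keys (true ∷ bs) ι {cu} {js = js} p cu-upper ((j-from , j-to) , w) =
      let keys , ends = walk-keys bs (ι ∘ suc) (p ∘ suc) (cong not (p zero)) w
      in (λ { zero → key-zero ; (suc i) → keys i }) , ends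
      where
      key-zero : key (js zero) ≡ suc (suc (ι zero))
      key-zero rewrite j-from | j-to | cu-upper = refl
    walk-keys (false ∷ bs) ι {js = js} p cu-upper ((j-from , j-to) , w) =
      let keys , ends = walk-keys bs (ι ∘ suc) (p ∘ suc) cu-upper w
      in (λ { zero → key-zero ; (suc i) → keys i }) , ends
      where
      key-zero : key (js zero) ≡ suc (suc (ι zero))
      key-zero rewrite j-from | p zero = refl

    key-rimEdgeOf : ∀ r → key (rimEdgeOf r) ≡ r
    key-rimEdgeOf = cases (walk-keys isUpper id (λ _ → refl) refl (proj₂ (proj₂ (proj₂ full-walk))))
      where
      cases : (∀ a → key (rimEdgeAt a) ≡ suc (suc a)) × key upperEnd ≡ zero × key lowerEnd ≡ suc zero →
              ∀ r → key (rimEdgeOf r) ≡ r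
      cases (keys , ku , kl) zero          = ku
      cases (keys , ku , kl) (suc zero)    = kl
      cases (keys , ku , kl) (suc (suc a)) = keys a

    rimEdgeOf-surjective : ∀ j → ∃ λ r → rimEdgeOf r ≡ j
    rimEdgeOf-surjective = injective⇒surjective (sym length-rim)
      λ {r} {r′} q → trans (sym (key-rimEdgeOf r)) (trans (cong key q) (key-rimEdgeOf r′))

    rimEdgeOf-key : ∀ j → rimEdgeOf (key j) ≡ j
    rimEdgeOf-key j with r , refl ← rimEdgeOf-surjective j = cong rimEdgeOf (key-rimEdgeOf r)

    encode : (Edge → Bool) → Word isUpper
    encode t = word t isUpper id rimEdgeAt upperEnd lowerEnd

    pathBit : Word isUpper → ∀ {i : Fin (suc ℓ)} → View i → Bool
    pathBit w ‵fromℕ       = proj₁ (lastLetter isUpper w)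
    pathBit w (‵inject₁ a) = proj₁ (letterAt isUpper w a)

    rimBit : Word isUpper → Fin (2 + ℓ) → Bool
    rimBit w zero          = proj₁ (proj₂ (lastLetter isUpper w))
    rimBit w (suc zero)    = proj₂ (proj₂ (lastLetter isUpper w))
    rimBit w (suc (suc a)) = proj₂ (proj₂ (letterAt isUpper w a))

    decode : Word isUpper → Edge → Bool
    decode w (pathEdge i) = pathBit w (view i)
    decode w (leafEdge a) = proj₁ (proj₂ (letterAt isUpper w a))
    decode w (rimEdge j)  = rimBit w (key j)

    encode-cong : ∀ {t t′} → (∀ e → t e ≡ t′ e) → encode t ≡ encode t′
    encode-cong t≗ = toWord-cong isUpper
      (λ a → cong₂ _,_ (t≗ _) (cong₂ _,_ (t≗ _) (t≗ _))) (cong₂ _,_ (t≗ _) (cong₂ _,_ (t≗ _) (t≗ _)))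

    encode-decode : ∀ w → encode (decode w) ≡ w
    encode-decode w = trans
      (toWord-cong isUpper {g = letterAt isUpper w} {l′ = lastLetter isUpper w}
        (λ a → cong₂ _,_ (cong (pathBit w) (view-inject₁ a))
                         (cong (proj₁ (proj₂ (letterAt isUpper w a)) ,_) (cong (rimBit w) (key-rimEdgeOf (suc (suc a))))))
        (cong₂ _,_ (cong (pathBit w) (view-fromℕ ℓ))
          (cong₂ _,_ (cong (rimBit w) (key-rimEdgeOf zero)) (cong (rimBit w) (key-rimEdgeOf (suc zero))))))
      (toWord-letterAt isUpper {letterAt isUpper w} w (λ _ → refl))

    decode-encode : ∀ t e → decode (encode t) e ≡ t e
    decode-encode t (pathEdge i) = path (view i)
      where
      path : ∀ {i : Fin (suc ℓ)} (v : View i) → pathBit (encode t) v ≡ t (pathEdge i)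
      path ‵fromℕ       = cong proj₁ (lastLetter-toWord isUpper _ _)
      path (‵inject₁ a) = cong proj₁ (letterAt-toWord isUpper _ _ a)
    decode-encode t (leafEdge a) = cong (proj₁ ∘ proj₂) (letterAt-toWord isUpper _ _ a)
    decode-encode t (rimEdge j)  = trans (rim-bit (key j)) (cong (t ∘ inj₂ ∘ inj₂) (rimEdgeOf-key j))
      where
      rim-bit : ∀ r → rimBit (encode t) r ≡ t (rimEdge (rimEdgeOf r))
      rim-bit zero          = cong (proj₁ ∘ proj₂) (lastLetter-toWord isUpper _ _)
      rim-bit (suc zero)    = cong (proj₂ ∘ proj₂) (lastLetter-toWord isUpper _ _)
      rim-bit (suc (suc a)) = cong (proj₂ ∘ proj₂) (letterAt-toWord isUpper _ _ a)

-- The number of faces and orientability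

module FaceNumbers where

  open import Defs
  open import Data.Bool.Base using (Bool; true; false; not)
  open import Data.Bool.Properties as Bool using (¬-not)
  open import Data.Fin using (Fin; zero; suc; #_)
  open import Data.Fin.Permutation using (↔⇒≡)
  open import Data.Fin.Properties using (*↔×; any?)
  open import Data.Fin.Relation.Unary.Top using (View; view; ‵fromℕ; ‵inject₁)
  import Data.Integer.Properties as ℤ
  import Data.Integer.Tactic.RingSolver as ℤRing
  open import Data.List.Base using ([]; _∷_)
  open import Data.Nat.Base using (ℕ; zero; suc; _+_; _*_)
  open import Data.Nat.Properties as ℕ using ()
  open import Data.Nat.Tactic.RingSolver using (solve-∀)
  open import Data.Product using (∃; _,_; proj₂)
  open import Data.Product.Function.NonDependent.Propositional using (_×-↔_)
  open import Data.Sum.Base using (_⊎_; inj₁; inj₂)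
  open import Data.Vec.Base using (Vec; []; _∷_)
  open import Data.Vec.Relation.Unary.All using ([])
  open import Function.Base using (id)
  open import Function.Bundles using (_↔_; Injection; Inverse)
  open import Function.Construct.Composition using (inverse)
  open import Function.Construct.Symmetry using () renaming (inverse to symmetric-inverse)
  open import Function.Properties.Inverse using (↔-sym; ↔-refl; ↔-trans; ↔⇒↣)
  open import Data.Nat.GeneralisedArithmetic using (iterate)
  open import Relation.Binary.Bundles using (Setoid)
  open import Relation.Binary.Construct.Closure.ReflexiveTransitive using (Star; ε; _◅_)
  open import Relation.Binary.PropositionalEquality
  open import Relation.Nullary.Decidable using (Dec; map′; toWitness)
  open import Relation.Nullary.Negation.Core using (contradiction)
  open PartialQuotients
  open FaceAutomaton
  open WordCounts
  open CubicRotations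
  open SpanningTreePotentials
  open HalinFrame
  open HalinTraversal
  open TwistEncoding

  -- Identifies the face number supplied by an arbitrary `EmbedsIn` with the one computed by the
  -- automaton.
  cardinality-unique : ∀ {a ℓ} {S : Setoid a ℓ} {m n} → HasCardinality S m → HasCardinality S n → m ≡ n
  cardinality-unique S↔m S↔n = ↔⇒≡ (inverse (symmetric-inverse S↔m) S↔n)

  module Orientability {G : Graph} {T : Graph.EdgeSet G} (tree : Graph.IsSpanningTree G T)
                       (ρ : TRotationSystem G T) where
    open Graph G
    open IsSpanningTree tree
    open TRotationSystem ρ

    twisted? : Dec (∃ λ e → τ e ≡ true)
    twisted? = map′ (λ (i , p) → Inverse.from E-finite i , p)
      (λ (e , p) → Inverse.to E-finite e , trans (cong τ (Inverse.inverseʳ E-finite refl)) p)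
      (any? λ i → τ (Inverse.from E-finite i) Bool.≟ true)

    untwisted⇒orientable : (∀ e → τ e ≡ false) → OrientableEmbedding system
    untwisted⇒orientable τ≡false = proj₂ , opposite-signs
      where
      s≢not : ∀ s → s ≢ not s
      s≢not true  ()
      s≢not false ()
      opposite-signs : ∀ {x y : Flag system} →
        ChangeVertex system x y ⊎ ChangeEdge system x y ⊎ ChangeFace system x y → proj₂ x ≢ proj₂ y
      opposite-signs (inj₁ (untwisted s _))   = s≢not s
      opposite-signs (inj₁ (twisted {d} s p)) = contradiction (trans (sym (τ≡false (edge d))) p) λ ()
      opposite-signs (inj₂ (inj₁ (corner d))) ()
      opposite-signs (inj₂ (inj₂ (across d))) ()

    -- A coherent orientation is constant at each vertex and along the untwisted
    -- tree, hence constant, so that no edge can be twisted.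
    orientable⇒untwisted : OrientableEmbedding system → ∀ e → τ e ≢ true
    orientable⇒untwisted (sign , opposite-signs) e p =
      opposite-signs (inj₁ (twisted true p))
        (sign-connected (e , true) (e , false) (connected _ _))
      where
      flip : ∀ {a b c : Bool} → a ≢ b → b ≢ c → a ≡ c
      flip a≢b b≢c = trans (¬-not a≢b) (sym (¬-not (≢-sym b≢c)))

      sign-next : ∀ d → sign (d , true) ≡ sign (next d , true)
      sign-next d = flip (opposite-signs (inj₂ (inj₁ (corner d)))) (≢-sym (opposite-signs (inj₂ (inj₂ (across (next d))))))

      sign-iterate : ∀ d n → sign (d , true) ≡ sign (iterate next d n , true)
      sign-iterate d zero    = refl
      sign-iterate d (suc n) = trans (sign-next d) (sign-iterate (next d) n)

      sign-vertex : ∀ d d′ → origin d ≡ origin d′ → sign (d , true) ≡ sign (d′ , true)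
      sign-vertex d d′ q with transitive d d′ q
      ... | n , refl = sign-iterate d n

      sign-opposite : ∀ d → T (edge d) ≡ true → sign (d , true) ≡ sign (opposite d , true)
      sign-opposite d d∈T = flip (opposite-signs (inj₁ (untwisted true (untwistedT (edge d) d∈T))))
                                 (≢-sym (opposite-signs (inj₂ (inj₂ (across (opposite d))))))

      sign-connected : ∀ d d′ → Star (Step T) (origin d) (origin d′) → sign (d , true) ≡ sign (d′ , true)
      sign-connected d d′ w = go w d refl
        where
        go : ∀ {u} → Star (Step T) u (origin d′) → ∀ d → origin d ≡ u → sign (d , true) ≡ sign (d′ , true)
        go ε                              d q = sign-vertex d d′ q
        go ((c , c∈T , refl , refl) ◅ w) d q =
          trans (sign-vertex d c q) (trans (sign-opposite c c∈T) (go w (opposite c) refl))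

  module Count (k : ℕ) (m : ℕ → ℕ) where
    open CaterpillarHalin k m hiding (H)
    open Graph (H k m) using (Vertex; Edge; Dart; end; origin; EdgeSet; IsSpanningTree; #V; V-finite)
    open Frame k m using (frame; length-rim)
    open Traversal k m
    open Encoding k m

    module _ (t : Edge → Bool) where

      corner↔Fin : Corner frame ↔ Fin (#V * 3)
      corner↔Fin = ↔-trans (V-finite ×-↔ ↔-refl) (↔-sym *↔×)

      Q₀ : Partial (Glued frame t) (#V * 3)
      Q₀ = discrete corner↔Fin

      fresh₀ : ∀ x → Fresh (Glued frame t) Q₀ x
      fresh₀ x y = Injection.injective (↔⇒↣ corner↔Fin)

      -- Initially all three pending edges start at `v_0`, and each of its three corners lies beside
      -- two of them. The boundary therefore reads 0, 2, 1, 0, 2, 1, which is the pairing of state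
      -- `zero` up to names.
      pattern₀ : Pattern (Glued frame t) Q₀ (boundary t zero (spine zero) (spine zero)) (corners zero)
      pattern₀ = Pattern-resp {Q = Q₀} {xs = boundary t zero (spine zero) (spine zero)}
        {L = 0 ∷ 2 ∷ 1 ∷ 0 ∷ 2 ∷ 1 ∷ []} {L′ = corners zero}
        (toWitness {a? = samePartition? (0 ∷ 2 ∷ 1 ∷ 0 ∷ 2 ∷ 1 ∷ []) (corners zero)} _)
        (Pattern-map (Glued frame t) {Q = Q₀} {vs} {0 ∷ 1 ∷ 2 ∷ []} (# 0 ∷ # 2 ∷ # 1 ∷ # 0 ∷ # 2 ∷ # 1 ∷ [])
          (Pattern-vertex t {Q = Q₀} 0 (λ i → fresh₀ (spine zero , i)) [] (λ ()) (λ ())))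
        where
        vs : Vec (Corner frame) 3
        vs = (spine zero , # 0) ∷ (spine zero , # 1) ∷ (spine zero , # 2) ∷ []

      untouched₀ : ∀ {v} → spine zero ≢ v → Untouched t Q₀ zero (spine zero) (spine zero) v
      untouched₀ {v} ≢v = record { fresh = λ i → fresh₀ (v , i) ; ≢pe = ≢v ; ≢cu = ≢v ; ≢cl = ≢v }

      faceNumber : ℕ
      faceNumber = faceCount zero isUpper (encode t)

      opaque
        traversed : Traversed t Q₀ isUpper id rimEdgeAt upperEnd lowerEnd zero
        traversed = traverse t isUpper id rimEdgeAt upperEnd lowerEnd zero Q₀ pattern₀
          (proj₂ (proj₂ (proj₂ full-walk))) (λ _ → refl) refl
          (λ _ → untouched₀ λ ()) (λ _ → untouched₀ λ ()) (untouched₀ λ ())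

      module Tr = Traversed traversed

      all-done : ∀ e → Done t Tr.quotient e
      all-done (pathEdge i) = path (view i)
        where
        path : ∀ {i : Fin (suc ℓ)} → View i → Done t Tr.quotient (pathEdge i)
        path ‵fromℕ       = Tr.last-path-done
        path (‵inject₁ a) = Tr.path-done a
      all-done (leafEdge a) = Tr.leaf-done a
      all-done (rimEdge j)  =
        let r , p = rimEdgeOf-surjective j in subst (λ j → Done t Tr.quotient (rimEdge j)) p (rim-done r)
        where
        rim-done : ∀ r → Done t Tr.quotient (rimEdge (rimEdgeOf r))
        rim-done zero          = Tr.upper-done
        rim-done (suc zero)    = Tr.lower-done
        rim-done (suc (suc a)) = Tr.rim-done a

      -- Three corners at each of 2 + 2ℓ vertices balance six gluings for each of ℓ + 1 letters;
      -- what is left are the redundant gluings.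
      size≡faceNumber : Tr.size ≡ faceNumber
      size≡faceNumber = ℕ.+-cancelʳ-≡ (6 * suc ℓ) _ _
        (trans Tr.count (trans (ℕ.+-comm (#V * 3) _) (cong (faceNumber +_) (eq ℓ))))
        where
        eq : ∀ l → (2 + l + l) * 3 ≡ 6 * suc l
        eq = solve-∀

      complete : ∀ {x y} → Glued frame t x y → Partial.class Tr.quotient x ≡ Partial.class Tr.quotient y
      complete (glued e s) = all-done e s

    faces : ∀ ρ → HasCardinality (FaceSetoid ρ) (faceNumber (Rotation.twist frame ρ))
    faces ρ = subst (HasCardinality (FaceSetoid ρ)) (size≡faceNumber twist)
      (faces-cardinality (Tr.quotient twist) (complete twist))
      where open Rotation frame ρ

-- From words to T-rotation systems of Euler-genus 2

module EmbeddingCounts where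

  open import Defs
  open import Data.Bool.Base using (Bool; true; false; _xor_)
  open import Data.Bool.Properties using (xor-same; xor-assoc; xor-identityʳ; ¬-not)
  open import Data.Fin using (Fin; zero; suc)
  open import Data.Integer.Base as ℤ using (ℤ; 0ℤ)
  import Data.Integer.Properties as ℤ
  import Data.Integer.Tactic.RingSolver as ℤRing
  open import Data.Nat.Base as ℕ using (ℕ; zero; suc; _+_; _*_)
  open import Data.Nat.Properties as ℕ using (≡-irrelevant)
  open import Data.Product using (∃; Σ; _,_; proj₁; proj₂)
  open import Data.Unit.Base using (tt)
  open import Function.Base using (_∘_)
  open import Function.Bundles using (_↔_; mk⇔; Inverse; Injection)
  open import Function.Properties.Inverse using (↔⇒↣)
  open import Relation.Binary.Bundles using (Setoid)
  open import Relation.Binary.PropositionalEquality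
  open import Relation.Nullary.Decidable using (Dec; yes; no)
  open PartialQuotients
  open WordCounts
  open CubicRotations
  open SpanningTreePotentials
  open HalinFrame
  open HalinTraversal
  open TwistEncoding
  open FaceNumbers

  eulerCharacteristic-genus : ∀ S → eulerCharacteristic S ≡ ℤ.+ 2 ℤ.- ℤ.+ eulerGenus S
  eulerCharacteristic-genus (orientable j)    = refl
  eulerCharacteristic-genus (nonorientable c) = refl

  module Embeddings (k : ℕ) (m : ℕ → ℕ) {T : Graph.EdgeSet (H k m)} (tree : Graph.IsSpanningTree (H k m) T) where
    open CaterpillarHalin k m hiding (H)
    open Graph (H k m) using (Vertex; Edge; Dart; end; #V; #E)
    open Frame k m using (frame; length-rim)
    open CubicFrame frame
    open Encoding k m
    open Count k m
    open Potential (H k m) tree using (difference; Solves; solution-from; solution-unique)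
    open TRotationSystem using (system; untwistedT)

    root : Vertex
    root = spine zero

    -- There are 2 + 2ℓ vertices and 3 + 3ℓ edges, so characteristic 0 means ℓ + 1 faces.
    euler-sum : ∀ F → ℤ.+ #V ℤ.- ℤ.+ #E ℤ.+ ℤ.+ F ≡ ℤ.+ F ℤ.- ℤ.+ suc ℓ
    euler-sum F = trans (cong (λ r → ℤ.+ #V ℤ.- ℤ.+ (suc ℓ + (ℓ + r)) ℤ.+ ℤ.+ F) length-rim) (eq (ℤ.+ ℓ) (ℤ.+ F))
      where
      eq : ∀ l f → (ℤ.+ 2 ℤ.+ l ℤ.+ l) ℤ.+ ℤ.- ((ℤ.+ 1 ℤ.+ l) ℤ.+ (l ℤ.+ (ℤ.+ 2 ℤ.+ l))) ℤ.+ f ≡ f ℤ.+ ℤ.- (ℤ.+ 1 ℤ.+ l)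
      eq = ℤRing.solve-∀

    faceNumber-2 : ∀ {ρ} → HasEulerGenus ρ 2 → faceNumber (Rotation.twist frame ρ) ≡ suc ℓ
    faceNumber-2 {ρ} (S , embedding , genus≡2) = trans (cardinality-unique (faces ρ) E.faces)
      (ℤ.+-injective (ℤ.i-j≡0⇒i≡j _ _ (begin
        ℤ.+ E.#F ℤ.- ℤ.+ suc ℓ                    ≡⟨ euler-sum E.#F ⟨
        ℤ.+ #V ℤ.- ℤ.+ #E ℤ.+ ℤ.+ E.#F            ≡⟨ E.euler ⟨
        eulerCharacteristic S                     ≡⟨ eulerCharacteristic-genus S ⟩
        ℤ.+ 2 ℤ.- ℤ.+ eulerGenus S                ≡⟨ cong (λ g → ℤ.+ 2 ℤ.- ℤ.+ g) genus≡2 ⟩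
        0ℤ                                        ∎)))
      where
      open ≡-Reasoning
      module E = EmbedsIn embedding

    -- The surface is the Klein bottle if some edge is twisted and the torus otherwise, since a
    -- spanning tree is untwisted; the edges are finitely many, so the alternative is decidable.
    hasEulerGenus-2 : ∀ (ρ : TRotationSystem (H k m) T) → faceNumber (Rotation.twist frame (system ρ)) ≡ suc ℓ →
                      HasEulerGenus (system ρ) 2
    hasEulerGenus-2 ρ F≡ = by-cases twisted?
      where
      open Orientability tree ρ
      F = faceNumber (Rotation.twist frame (system ρ))
      euler : 0ℤ ≡ ℤ.+ #V ℤ.- ℤ.+ #E ℤ.+ ℤ.+ F
      euler = sym (trans (euler-sum F) (ℤ.i≡j⇒i-j≡0 (cong ℤ.+_ F≡)))
      by-cases : Dec (∃ λ e → RotationSystem.τ (system ρ) e ≡ true) → HasEulerGenus (system ρ) 2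
      by-cases (yes (e , p)) = nonorientable 2 , record
        { faces         = faces (system ρ)
        ; euler         = euler
        ; orientability = mk⇔ (λ ()) (λ o → orientable⇒untwisted o e p)
        } , refl
      by-cases (no ¬p) = orientable 1 , record
        { faces         = faces (system ρ)
        ; euler         = euler
        ; orientability = mk⇔ (λ _ → untwisted⇒orientable λ e → ¬-not λ p → ¬p (e , p)) (λ _ → tt)
        } , refl

    module _ (b : Bool) (t : Edge → Bool) where

      direction₀ : Vertex → Bool
      direction₀ = proj₁ (solution-from t root b)

      -- The inverse of the passage from `τ` to `twist`. On tree edges the equation solved by
      -- `direction₀` makes it vanish.
      τ₀ : Edge → Bool
      τ₀ e = t e xor difference direction₀ e

      tRotationSystem : TRotationSystem (H k m) T
      tRotationSystem = record
        { system     = rotationSystem frame direction₀ τ₀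
        ; untwistedT = λ e e∈T → trans (cong (t e xor_) (proj₂ (proj₂ (solution-from t root b)) e e∈T)) (xor-same (t e))
        }

      open Rotation frame (system tRotationSystem)

      direction-tRotationSystem : ∀ v → direction v ≡ direction₀ v
      direction-tRotationSystem v = begin
        positive (slot (dartAt u (rotate (direction₀ u) (slot (dartAt v zero)))))
                                                    ≡⟨ cong positive (slot-dartAt u _) ⟩
        positive (rotate (direction₀ u) (slot (dartAt v zero)))
                                                    ≡⟨ cong₂ (λ u i → positive (rotate (direction₀ u) i)) (origin-dartAt v zero) (slot-dartAt v zero) ⟩
        positive (rotate (direction₀ v) zero)       ≡⟨ positive-rotate (direction₀ v) ⟩
        direction₀ v                                ∎
        where
        open ≡-Reasoning
        u = Graph.origin (H k m) (dartAt v zero)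

      twist-tRotationSystem : ∀ e → twist e ≡ t e
      twist-tRotationSystem e = begin
        τ₀ e xor (direction (end e true) xor direction (end e false))
          ≡⟨ cong₂ (λ x y → τ₀ e xor (x xor y)) (direction-tRotationSystem _) (direction-tRotationSystem _) ⟩
        (t e xor difference direction₀ e) xor difference direction₀ e
          ≡⟨ xor-assoc (t e) _ _ ⟩
        t e xor (difference direction₀ e xor difference direction₀ e)
          ≡⟨ cong (t e xor_) (xor-same (difference direction₀ e)) ⟩
        t e xor false
          ≡⟨ xor-identityʳ (t e) ⟩
        t e ∎
        where open ≡-Reasoning

    -- The first component is the direction at `v_0`. Reversing every rotation preserves all
    -- relative twists, so the word alone cannot recover it.
    Code : Set
    Code = Σ Bool λ _ → Σ (Word isUpper) λ w → faceCount zero isUpper w ≡ suc ℓ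

    code-≡ : ∀ {c c′ : Code} → proj₁ c ≡ proj₁ c′ → proj₁ (proj₂ c) ≡ proj₁ (proj₂ c′) → c ≡ c′
    code-≡ {_ , _ , p} {_ , _ , q} refl refl = cong (λ p → _ , _ , p) (≡-irrelevant p q)

    open Setoid (TEmbeddings (H k m) T 2) using (Carrier; _≈_)

    code : Carrier → Code
    code (ρ , genus) = direction root , encode twist , faceNumber-2 {system ρ} genus
      where open Rotation frame (system ρ)

    code-complete : ∀ {x y} → x ≈ y → code x ≡ code y
    code-complete {ρ , g} {σ , h} x≈y = code-≡ {code (ρ , g)} {code (σ , h)} (direction≡ root) (encode-cong λ e →
        cong₂ _xor_ (_≈ᵣ_.τ-≗ x≈y e) (cong₂ _xor_ (direction≡ (end e true)) (direction≡ (end e false))))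
      where
      direction≡ : ∀ v → Rotation.direction frame (system ρ) v ≡ Rotation.direction frame (system σ) v
      direction≡ v = cong (λ d → positive (slot d)) (_≈ᵣ_.next-≗ x≈y (dartAt v zero))

    -- On tree edges `τ` vanishes, so `twist` is the difference of the directions there. Equal
    -- twists and equal directions at the root then force equal directions everywhere, and these
    -- return `τ` from `twist`.
    code-sound : ∀ {x y} → code x ≡ code y → x ≈ y
    code-sound {ρ , g} {σ , h} p = record
      { next-≗ = λ d → begin
          next ρ d                                                       ≡⟨ ρ.next-rotate d ⟩
          dartAt (origin d) (rotate (ρ.direction (origin d)) (slot d))   ≡⟨ cong (λ o → dartAt (origin d) (rotate o (slot d))) (direction≡ (origin d)) ⟩
          dartAt (origin d) (rotate (σ.direction (origin d)) (slot d))   ≡⟨ σ.next-rotate d ⟨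
          next σ d                                                       ∎
      ; τ-≗    = λ e → begin
          τ ρ e                                                          ≡⟨ untwist (τ ρ e) (difference ρ.direction e) ⟨
          ρ.twist e xor difference ρ.direction e                         ≡⟨ cong₂ _xor_ (twist≡ e) (cong₂ _xor_ (direction≡ (end e true)) (direction≡ (end e false))) ⟩
          σ.twist e xor difference σ.direction e                         ≡⟨ untwist (τ σ e) (difference σ.direction e) ⟩
          τ σ e                                                          ∎
      }
      where
      open ≡-Reasoning
      open TRotationSystem using (next; τ)
      open Graph (H k m) using (origin)
      module ρ = Rotation frame (system ρ)
      module σ = Rotation frame (system σ)
      untwist : ∀ x y → (x xor y) xor y ≡ x
      untwist x y = trans (xor-assoc x y y) (trans (cong (x xor_) (xor-same y)) (xor-identityʳ x))
      twist≡ : ∀ e → ρ.twist e ≡ σ.twist e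
      twist≡ e = trans (sym (decode-encode ρ.twist e))
        (trans (cong (λ c → decode (proj₁ (proj₂ c)) e) p) (decode-encode σ.twist e))
      solves : ∀ σ → Solves (Rotation.direction frame (system σ)) (Rotation.twist frame (system σ))
      solves σ e e∈T = cong (_xor difference (Rotation.direction frame (system σ)) e) (sym (untwistedT σ e e∈T))
      direction≡ : ∀ v → ρ.direction v ≡ σ.direction v
      direction≡ = solution-unique {t = ρ.twist} (solves ρ) (λ e e∈T → trans (solves σ e e∈T) (sym (twist≡ e)))
        {root} (cong proj₁ p)

    decoded : Code → Carrier
    decoded (b , w , F≡) = ρ , hasEulerGenus-2 ρ (trans (cong (faceCount zero isUpper) encode≡) F≡)
      where
      ρ = tRotationSystem b (decode w)
      encode≡ : encode (Rotation.twist frame (system ρ)) ≡ w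
      encode≡ = trans (encode-cong (twist-tRotationSystem b (decode w))) (encode-decode w)

    code-decoded : ∀ c → code (decoded c) ≡ c
    code-decoded c@(b , w , F≡) = code-≡ {code (decoded c)} {c}
      (trans (direction-tRotationSystem b (decode w) root) (proj₁ (proj₂ (solution-from (decode w) root b))))
      (trans (encode-cong (twist-tRotationSystem b (decode w))) (encode-decode w))

    words≡ : wordsWith zero isUpper (suc ℓ) + wordsWith zero isUpper (suc ℓ) ≡ 2 * words₂ isUpper
    words≡ = cong₂ _+_ once (trans once (sym (ℕ.+-identityʳ (words₂ isUpper))))
      where
      once : wordsWith zero isUpper (suc ℓ) ≡ words₂ isUpper
      once = trans (wordsWith-kind zero isUpper (suc ℓ)) (kindWords₂ isUpper)

    opaque
      code↔Fin : Code ↔ Fin (2 * words₂ isUpper)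
      code↔Fin = subst (λ n → Code ↔ Fin n) words≡ (Σ-Bool-Fin λ _ → words↔Fin zero isUpper (suc ℓ))

    embeddings-cardinality : ε[ H k m , T ] 2 ≐ (2 * words₂ isUpper)
    embeddings-cardinality = hasCardinality (TEmbeddings (H k m) T 2) (to ∘ code) (decoded ∘ from)
        (λ i → trans (cong to (code-decoded (from i))) (Inverse.inverseˡ code↔Fin refl))
        (λ {x} {y} q → cong to (code-complete {x} {y} q))
        (λ {x} {y} q → code-sound {x} {y} (Injection.injective (↔⇒↣ code↔Fin) q))
      where open Inverse code↔Fin using (to; from)

open import Data.Nat.Base using (ℕ; suc; _≤_; _∸_; s≤s) renaming (_+_ to _+ℕ_; _^_ to _^ℕ_; _*_ to _*ℕ_)
open import Data.Integer.Base using (+_; -_; _+_; _-_; _*_)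
open import Data.Product using (∃; _×_; _,_)
open import Relation.Binary.PropositionalEquality using (_≡_)
open import Defs

theorem3p7 :
  ∀ (k : ℕ) (m : ℕ → ℕ) → 2 ≤ k → (∀ i → 1 ≤ i → i ≤ k → 1 ≤ m i) →
  ∀ (T : Graph.EdgeSet (H k m)) → Graph.IsSpanningTree (H k m) T →
  ∃ λ n → ε[ H k m , T ] 2 ≐ n ×
    + n ≡
        + 8 * (∑[ i from 1 to k ]
                (- (+ 9) + + 4 * + i + (- (+ 3) + + 4 * + i) * + m i + + 2 * (+ m i * + m i)))
      + + 2 * (∑[ i from 2 to k ]
                (+ (2 ^ℕ (m i +ℕ 3)) + + 3 * + (2 ^ℕ (m (i ∸ 1) +ℕ 3))))
      - + (2 ^ℕ (m 1 +ℕ 5))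
      + + 32 * (∑[ i from 2 to k ] (∑[ j from 1 to i ∸ 1 ] (+ m j * + m i + + m j)))
theorem3p7 (suc (suc q)) m _ pos T tree =
    2 *ℕ WordCounts.words₂ (CaterpillarHalin.isUpper (2 +ℕ q) m)
  , EmbeddingCounts.Embeddings.embeddings-cardinality (2 +ℕ q) m tree
  , ClosedForm.formula q m pos
theorem3p7 1 m (s≤s ())
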